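{- Let $\mathcal{O}$ be a Euclidean oriented matroid on $E$ and let $\mathcal{O}'=\mathcal{O}[e_1^{\alpha_1},\dots,e_k^{\alpha_k}]$ be any lexicographic extension of $\mathcal{O}$ ($[e_1,\dots,e_k]$ an ordered subset of $E$, $\alpha\in\{+,-\}^k$). Then $\mathcal{O}'$ is Euclidean.
   Context: Let $\mathcal{O}$ be an oriented matroid of rank $r$ on a finite ground set $E$, given by its set of cocircuits (sign vectors in $\{+,-,0\}^E$). For sign vectors $X,Y$: $\operatorname{supp}(X)=\{e:X_e\neq 0\}$, $z(X)=E\setminus\operatorname{supp}(X)$, $\operatorname{sep}(X,Y)=\{e: X_e=-Y_e\neq 0\}$, $(X\circ Y)_e=X_e$ if $X_e\neq 0$ and $(X\circ Y)_e=Y_e$ otherwise; $X,Y$ are conformal if $\operatorname{sep}(X,Y)=\emptyset$. An edge is a covector $F$ whose zero set $z(F)$ is a flat of rank $r-2$ of the underlying matroid. Two cocircuits $X\neq\pm Y$ are comodular if $X\circ Y$ is an edge. For comodular cocircuits $X,Y$ and $e\in\operatorname{sep}(X,Y)$ there is a unique cocircuit $Z$ with $Z_e=0$ and $Z_h=(X\circ Y)_h$ for all $h\notin\operatorname{sep}(X,Y)$ ("cocircuit elimination of $e$ between $X$ and $Y$"). An oriented matroid program is a triple $(\mathcal{O},g,f)$ with $g\neq f\in E$, $g$ not a loop, $f$ not a coloop. For comodular cocircuits $X,Y$ with $X_g=Y_g\neq 0$ let $Z$ be obtained by eliminating $g$ between $-X$ and $Y$; write $X\to_{g,f}Y$ if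 $Z_f=+$, $X\leftarrow_{g,f}Y$ if $Z_f=-$, and $X\leftrightarrow_{g,f}Y$ if $Z_f=0$. The cocircuit graph $G_f$ of $(\mathcal{O},g,f)$ has as vertices the cocircuits $X$ with $X_g=+$ and as edges the pairs of conformal comodular such cocircuits, oriented as described. A directed cycle in $G_f$ is a sequence $P^1,\dots,P^n=P^1$ of vertices with $P^1,\dots,P^{n-1}$ pairwise distinct, $\{P^i,P^{i+1}\}$ an edge, $P^i\to P^{i+1}$ or $P^i\leftrightarrow P^{i+1}$ for all $i$, and $P^i\to P^{i+1}$ for at least one $i$. The program is Euclidean if $G_f$ has no directed cycle. An oriented matroid is Euclidean if every oriented matroid program on it is Euclidean. A single-element extension $\mathcal{O}\cup p$ is determined by a localization $\sigma$ from cocircuits of $\mathcal{O}$ to $\{+,-,0\}$. For an ordered subset $I=[e_1,\dots,e_k]$ of $E$, the index of a cocircuit $Y$ w.r.t. $I$ is the smallest $i$ with $Y_{e_i}\neq 0$, or $k+1$ if none. For $\alpha\in\{+,-\}^k$ the lexicographic extension $\mathcal{O}[e_1^{\alpha_1},\dots,e_k^{\alpha_k}]=\mathcal{O}\cup p$ is the single-element extension with localization $\sigma(Y)=\alpha_iY_{e_i}$ if the index $i$ of $Y$ is $\le k$, and $\sigma(Y)=0$ otherwise. -}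

module Defs where

open import Data.Bool.Base using (Bool; true; false)
open import Data.Fin.Base using (Fin; zero; suc; fromℕ; inject₁)
open import Data.Fin.Subset using (Subset; _∈_; _⊆_; _-_; ∁; ⁅_⁆; ∣_∣)
  renaming (⊤ to full; ⊥ to empty)
open import Data.Nat.Base using (ℕ; zero; suc; _≤_; _+_)
open import Data.Product.Base using (∃-syntax; _×_)
open import Data.Sign.Base as Sign using (Sign; opposite)
open import Data.Sum.Base using (_⊎_)
open import Data.Vec.Base using (Vec; []; _∷_; lookup; map; zipWith; replicate)
open import Function.Bundles using (_⇔_)
open import Function.Definitions using (Injective)
open import Relation.Binary.PropositionalEquality.Core using (_≡_; _≢_)
open import Relation.Nullary.Negation.Core using (¬_)
open import Relation.Unary using (Decidable)

-- The signs {+, -, 0}; `± s` is the nonzero sign s.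
data Sign₀ : Set where
  𝟎 : Sign₀
  ± : Sign → Sign₀

neg : Sign₀ → Sign₀
neg 𝟎     = 𝟎
neg (± s) = ± (opposite s)

infixr 7 _∘₀_
_∘₀_ : Sign₀ → Sign₀ → Sign₀
𝟎   ∘₀ t = t
± s ∘₀ t = ± s

isZero : Sign₀ → Bool
isZero 𝟎     = true
isZero (± s) = false

SignVector : ℕ → Set
SignVector = Vec Sign₀

module _ {n : ℕ} where

  0ᵥ : SignVector n
  0ᵥ = replicate n 𝟎

  infix 8 -ᵥ_
  -ᵥ_ : SignVector n → SignVector n
  -ᵥ_ = map neg

  infixr 7 _∘_
  _∘_ : SignVector n → SignVector n → SignVector n
  _∘_ = zipWith _∘₀_

  z : SignVector n → Subset n
  z = map isZero

  supp : SignVector n → Subset n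
  supp X = ∁ (z X)

  Sep : SignVector n → SignVector n → Fin n → Set
  Sep X Y e = lookup X e ≡ neg (lookup Y e) × lookup X e ≢ 𝟎

  Conformal : SignVector n → SignVector n → Set
  Conformal X Y = ∀ e → ¬ Sep X Y e

-- An oriented matroid on the ground set `Fin n`, given by its cocircuits.
-- The set of cocircuits is a subset of a finite set, hence decidable.
record OrientedMatroid (n : ℕ) : Set₁ where
  field
    Cocircuit    : SignVector n → Set
    cocircuit?   : Decidable Cocircuit
    nonzero      : ∀ {X} → Cocircuit X → X ≢ 0ᵥ
    symmetric    : ∀ {X} → Cocircuit X → Cocircuit (-ᵥ X)
    incomparable : ∀ {X Y} → Cocircuit X → Cocircuit Y →
                   supp X ⊆ supp Y → X ≡ Y ⊎ X ≡ -ᵥ Y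
    -- Z⁺ ⊆ (X⁺ ∪ Y⁺) ∖ e and Z⁻ ⊆ (X⁻ ∪ Y⁻) ∖ e
    elimination  : ∀ {X Y} → Cocircuit X → Cocircuit Y → X ≢ -ᵥ Y →
                   ∀ {e} → Sep X Y e →
                   ∃[ Z ] Cocircuit Z × lookup Z e ≡ 𝟎 ×
                     (∀ h s → lookup Z h ≡ ± s → lookup X h ≡ ± s ⊎ lookup Y h ≡ ± s)

  data Covector : SignVector n → Set where
    zeroVector : Covector 0ᵥ
    compose    : ∀ {X F} → Cocircuit X → Covector F → Covector (X ∘ F)

  -- The underlying matroid: its hyperplanes are the zero sets of cocircuits, so
  -- the closure of A is the intersection of all z X ⊇ A.
  infix 4 _∈cl_
  _∈cl_ : Fin n → Subset n → Set
  e ∈cl A = ∀ {X} → Cocircuit X → A ⊆ z X → e ∈ z X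

  Flat : Subset n → Set
  Flat A = ∀ {e} → e ∈cl A → e ∈ A

  Independent : Subset n → Set
  Independent I = ∀ {e} → e ∈ I → ¬ e ∈cl (I - e)

  HasRank : Subset n → ℕ → Set
  HasRank A r = (∃[ I ] I ⊆ A × Independent I × ∣ I ∣ ≡ r)
              × (∀ {I} → I ⊆ A → Independent I → ∣ I ∣ ≤ r)

  Loop : Fin n → Set
  Loop e = e ∈cl empty

  Coloop : Fin n → Set
  Coloop e = ∃[ X ] Cocircuit X × supp X ≡ ⁅ e ⁆

  -- Writing the rank of the oriented matroid as 2 + r avoids truncated subtraction.
  IsEdge : SignVector n → Set
  IsEdge F = Covector F × Flat (z F) × (∃[ r ] HasRank full (2 + r) × HasRank (z F) r)

  record Comodular (X Y : SignVector n) : Set where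
    field
      cocircuitˡ : Cocircuit X
      cocircuitʳ : Cocircuit Y
      X≢Y        : X ≢ Y
      X≢-Y       : X ≢ -ᵥ Y
      isEdge     : IsEdge (X ∘ Y)

  -- Z arises by cocircuit elimination of e between X and Y; for comodular X, Y
  -- and e separating them there is exactly one such Z.
  IsElimination : Fin n → (X Y Z : SignVector n) → Set
  IsElimination e X Y Z =
    Cocircuit Z × lookup Z e ≡ 𝟎 × (∀ h → ¬ Sep X Y h → lookup Z h ≡ lookup (X ∘ Y) h)

  module Graph (g f : Fin n) where

    Vertex : SignVector n → Set
    Vertex X = Cocircuit X × lookup X g ≡ ± Sign.+

    Adjacent : SignVector n → SignVector n → Set
    Adjacent X Y = Conformal X Y × Comodular X Y

    infix 4 _⟶_ _⟷_
    _⟶_ : SignVector n → SignVector n → Set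
    X ⟶ Y = ∃[ Z ] IsElimination g (-ᵥ X) Y Z × lookup Z f ≡ ± Sign.+

    _⟷_ : SignVector n → SignVector n → Set
    X ⟷ Y = ∃[ Z ] IsElimination g (-ᵥ X) Y Z × lookup Z f ≡ 𝟎

    -- P 0, …, P m are the vertices of the closed sequence, P m being P 0 again.
    record DirectedCycle : Set where
      field
        {m}      : ℕ
        P        : Fin (suc m) → SignVector n
        vertex   : ∀ i → Vertex (P i)
        closed   : P (fromℕ m) ≡ P zero
        distinct : Injective _≡_ _≡_ (λ (i : Fin m) → P (inject₁ i))
        adjacent : ∀ (i : Fin m) → Adjacent (P (inject₁ i)) (P (suc i))
        directed : ∀ (i : Fin m) → P (inject₁ i) ⟶ P (suc i) ⊎ P (inject₁ i) ⟷ P (suc i)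
        strict   : ∃[ i ] P (inject₁ i) ⟶ P (suc i)

  record IsProgram (g f : Fin n) : Set where
    field
      g≢f        : g ≢ f
      g-noLoop   : ¬ Loop g
      f-noColoop : ¬ Coloop f

  EuclideanProgram : Fin n → Fin n → Set
  EuclideanProgram g f = ¬ Graph.DirectedCycle g f

  Euclidean : Set
  Euclidean = ∀ g f → IsProgram g f → EuclideanProgram g f

open OrientedMatroid

-- For O′ on E ∪ p, with p the index zero: the cocircuits of the deletion O′ ∖ p
-- are the restrictions to E that are nonzero and have minimal support.
DeletionCocircuit : ∀ {n} → OrientedMatroid (suc n) → SignVector n → Set
DeletionCocircuit O′ Y =
  Y ≢ 0ᵥ × (∃[ s ] Cocircuit O′ (s ∷ Y)) ×
  (∀ {t Y′} → Cocircuit O′ (t ∷ Y′) → Y′ ≢ 0ᵥ → supp Y′ ⊆ supp Y → supp Y ⊆ supp Y′)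

-- Extensions preserve the rank. A coloop p would raise it, and is not excluded by
-- the localization alone: it would give the same σ as a loop.
record IsExtension {n} (O : OrientedMatroid n) (O′ : OrientedMatroid (suc n)) : Set where
  field
    deletion : ∀ Y → Cocircuit O Y ⇔ DeletionCocircuit O′ Y
    noColoop : ¬ Coloop O′ zero

HasLocalization : ∀ {n} → OrientedMatroid n → OrientedMatroid (suc n) →
                  (SignVector n → Sign₀) → Set
HasLocalization O O′ σ = ∀ {Y} → Cocircuit O Y → Cocircuit O′ (σ Y ∷ Y)

infixr 7 _*₀_
_*₀_ : Sign → Sign₀ → Sign₀
a *₀ 𝟎   = 𝟎
a *₀ ± s = ± (a Sign.* s)

-- αᵢ Y_{eᵢ} for the least i with Y_{eᵢ} ≠ 0, and 0 if there is none: a zero entry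
-- contributes 𝟎, which `_∘₀_` skips.
lexσ : ∀ {n k} → Vec (Fin n) k → Vec Sign k → SignVector n → Sign₀
lexσ []      []      Y = 𝟎
lexσ (e ∷ I) (a ∷ α) Y = (a *₀ lookup Y e) ∘₀ lexσ I α Y

-- O′ = O[e₁^α₁, …, e_k^α_k]
record IsLexExtension {n k} (O : OrientedMatroid n) (I : Vec (Fin n) k) (α : Vec Sign k)
                      (O′ : OrientedMatroid (suc n)) : Set where
  field
    isExtension  : IsExtension O O′
    localization : HasLocalization O O′ (lexσ I α)

{-# OPTIONS --safe #-}
module Submission where

open import Defs
open import Data.Bool.Base using (Bool; true; not)
open import Data.Empty using (⊥; ⊥-elim)
open import Data.Fin.Base using (Fin; zero; suc; fromℕ; inject₁; toℕ) renaming (_<_ to _<ᶠ_)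
open import Data.Fin.Properties
  using (all?; any?; ¬∀⟶∃¬; fromℕ≢inject₁; inject₁-injective; suc-injective; toℕ-injective)
  renaming (_≟_ to _≟ᶠ_; <-cmp to <ᶠ-cmp)
open import Data.Fin.Subset using (Subset; inside; outside; _∈_; _∉_; _⊆_; _∪_; _─_; _-_; ⁅_⁆; ∣_∣)
  renaming (⊥ to empty)
open import Data.Fin.Subset.Properties
  using (_∈?_; _⊆?_; ∉⊥; ⊆⊤; ∪-identityʳ; x∈⁅x⁆; x∈⁅y⁆⇒x≡y; x∈p∪q⁺; x∈p∪q⁻; p─q⊆p; x∈p∧x∉q⇒x∈p─q;
         x∈p∧x≢y⇒x∈p-y; p⊆q⇒∣p∣≤∣q∣; p⊂q⇒∣p∣<∣q∣)
open import Data.Nat.Base using (ℕ; suc; _≤_; _<_; _+_; z<s; s<s)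
open import Data.Nat.Induction using (<-wellFounded)
open import Data.Nat.Properties
  using (≤-refl; ≤-trans; ≤-reflexive; ≤-antisym; <-trans; <-asym; <-irrefl; ≮⇒≥; 1+n≰n)
open import Data.Product.Base using (Σ; ∃; ∃-syntax; _×_; _,_; proj₁; proj₂)
open import Data.Sign.Base as Sign using (Sign; opposite)
open import Data.Sign.Properties renaming (_≟_ to _≟ₛ_)
open import Data.Sum.Base using (_⊎_; inj₁; inj₂; [_,_]′; swap) renaming (map to map⊎)
open import Data.Vec.Base using (Vec; []; _∷_; lookup; zipWith; head; tail; here; there)
open import Data.Vec.Properties
  using (≡-dec; lookup-map; lookup-zipWith; lookup-replicate; lookup⇒[]=; []=⇒lookup; zipWith-identityʳ)
open import Data.Vec.Relation.Unary.Unique.Propositional using (Unique)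
open import Function.Base using (_∘′_; case_of_)
open import Function.Bundles using (Equivalence)
open import Function.Definitions using (Injective)
open import Induction.WellFounded using (Acc; acc)
open import Relation.Binary.Construct.Closure.ReflexiveTransitive
  using (Star; ε; _◅_; _◅◅_) renaming (map to map⋆)
open import Relation.Binary.Definitions using (tri<; tri≈; tri>)
open import Relation.Binary.PropositionalEquality
open import Relation.Nullary using (¬_; Dec; yes; no; does; contradiction)
open import Relation.Nullary.Decidable using (_×-dec_; _→-dec_; ¬?; decidable-stable; map′)
open import Relation.Unary using (Decidable)

-- A directed cycle forces all its cocircuits onto one side of f, and a closed walk along comodular
-- pairs of O in a nonnegative direction of f must be level everywhere, because O is Euclidean.
-- The new element p is infinitely close to the first element of I that matters on a given line.
-- If f = p, all vertices of a cycle lie off p, so they are cocircuits of O, and the elements of I are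
-- level along the cycle one after the other. If g = p, one passes to the program with the common
-- leading element e in place of g; f is then level to first order, so the next order decides: it is
-- governed by p at the points at infinity, and again the elements of I become level one by one.
-- If f and g are both in E, a vertex v on p that is not a cocircuit of O lies on an old line infinitely
-- close to its point w with e = 0. The points w form a closed walk of (O, g, f), which is level.
-- The first-order change of v is the change of f along the line, read off at its point d on g,
-- and the points d form a closed walk of (O, e, f) inside g. Both walks are level for f and then for each
-- element of I, which makes p vanish at the points at infinity near those of the cycle.
-- Vertices in O and lines on which f and g are parallel have first-order change zero. If w lies
-- on g but not on f, this happens all along the cycle and g and f are interchanged.

-- An oriented matroid contains no infinitesimals, so closeness is expressed by signs: `V` is near
-- `w` if they agree on `E` wherever `w` is nonzero, and one formula ties the sign of `p` at `w` to
-- the side of the leading element on which `V` lies. Heuristically `V = w + εd`. The difference of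
-- two vertices is governed by the points `w`, and by the points `d` only where the `w` coincide;
-- hence two walks, the second examined once the first is known to be level. Euclideanness forbids
-- only cycles of distinct vertices along conformal pairs, whereas the derived walks jump along
-- lines between arbitrary points. The jumps are therefore subdivided at separating elements. A line
-- is a set of elements together with a property of the cocircuits vanishing on it, not a flat of
-- given rank. A line described without `p` then passes to `O` by restriction. A vertex near a point
-- with `g = 0` and `f ≠ 0` has no position off `g`. An edge from it to a vertex not of this sort
-- runs in the direction `-w`; as `f` has one sign on the cycle, such vertices are either absent or
-- everywhere.

infixl 9 _!_
_!_ : ∀ {n} → SignVector n → Fin n → Sign₀
_!_ = lookup

-- Signs and sign vectors

infix 4 _≟₀_ _≟ᵥ_
_≟₀_ : (x y : Sign₀) → Dec (x ≡ y)
𝟎   ≟₀ 𝟎   = yes refl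
𝟎   ≟₀ ± t = no λ ()
± s ≟₀ 𝟎   = no λ ()
± s ≟₀ ± t with s ≟ₛ t
... | yes eq = yes (cong ± eq)
... | no neq = no λ { refl → neq refl }

_≟ᵥ_ : ∀ {n} (X Y : SignVector n) → Dec (X ≡ Y)
_≟ᵥ_ = ≡-dec _≟₀_

opposite² : ∀ s → opposite (opposite s) ≡ s
opposite² Sign.+ = refl
opposite² Sign.- = refl

neg² : ∀ x → neg (neg x) ≡ x
neg² 𝟎          = refl
neg² (± Sign.+) = refl
neg² (± Sign.-) = refl

neg-≡ : ∀ {x y} → neg x ≡ y → x ≡ neg y
neg-≡ {x} refl = sym (neg² x)

neg-zero : ∀ {x} → x ≡ 𝟎 → neg x ≡ 𝟎
neg-zero refl = refl

neg-zero⁻ : ∀ {x} → neg x ≡ 𝟎 → x ≡ 𝟎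
neg-zero⁻ {𝟎} _ = refl

nonzero-± : ∀ {x} → x ≢ 𝟎 → ∃[ s ] x ≡ ± s
nonzero-± {𝟎}   x≢0 = contradiction refl x≢0
nonzero-± {± s} _   = s , refl

≡±⇒≢𝟎 : ∀ {x s} → x ≡ ± s → x ≢ 𝟎
≡±⇒≢𝟎 refl ()

≢𝟎-resp : ∀ {x y} → x ≡ y → x ≢ 𝟎 → y ≢ 𝟎
≢𝟎-resp refl x≢0 = x≢0

neg-≢𝟎 : ∀ {x} → x ≢ 𝟎 → neg x ≢ 𝟎
neg-≢𝟎 x≢0 eq = x≢0 (neg-zero⁻ eq)

same-or-opposite : ∀ {x y} → x ≢ 𝟎 → y ≢ 𝟎 → x ≡ y ⊎ x ≡ neg y
same-or-opposite {𝟎}          x≢0 _   = contradiction refl x≢0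
same-or-opposite {± s} {𝟎}    _   y≢0 = contradiction refl y≢0
same-or-opposite {± Sign.+} {± Sign.+} _ _ = inj₁ refl
same-or-opposite {± Sign.+} {± Sign.-} _ _ = inj₂ refl
same-or-opposite {± Sign.-} {± Sign.+} _ _ = inj₂ refl
same-or-opposite {± Sign.-} {± Sign.-} _ _ = inj₁ refl

≢neg : ∀ {x} → x ≢ 𝟎 → x ≢ neg x
≢neg {𝟎} x≢0 _ = x≢0 refl
≢neg {± Sign.+} _ ()
≢neg {± Sign.-} _ ()

module _ {n : ℕ} where

  !-neg : ∀ (X : SignVector n) h → (-ᵥ X) ! h ≡ neg (X ! h)
  !-neg X h = lookup-map h neg X

  !-∘ : ∀ (X Y : SignVector n) h → (X ∘ Y) ! h ≡ (X ! h) ∘₀ (Y ! h)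
  !-∘ X Y h = lookup-zipWith _∘₀_ h X Y

  !-0 : ∀ h → 0ᵥ {n} ! h ≡ 𝟎
  !-0 h = lookup-replicate h 𝟎

!-ext : ∀ {n} {X Y : SignVector n} → (∀ h → X ! h ≡ Y ! h) → X ≡ Y
!-ext {X = []}    {[]}    _ = refl
!-ext {X = x ∷ X} {y ∷ Y} p = cong₂ _∷_ (p zero) (!-ext λ h → p (suc h))

-ᵥ² : ∀ {n} (X : SignVector n) → -ᵥ (-ᵥ X) ≡ X
-ᵥ² []      = refl
-ᵥ² (x ∷ X) = cong₂ _∷_ (neg² x) (-ᵥ² X)

nonzero-entry : ∀ {n} {X : SignVector n} → X ≢ 0ᵥ → ∃[ h ] X ! h ≢ 𝟎
nonzero-entry {n} {X} X≢0 = ¬∀⟶∃¬ n _ (λ h → X ! h ≟₀ 𝟎) λ all →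
  X≢0 (!-ext λ h → trans (all h) (sym (!-0 h)))

module _ {n : ℕ} {X : SignVector n} {e : Fin n} where

  ∈z⁺ : X ! e ≡ 𝟎 → e ∈ z X
  ∈z⁺ eq = lookup⇒[]= e _ (trans (lookup-map e isZero X) (cong isZero eq))

  ∈z⁻ : e ∈ z X → X ! e ≡ 𝟎
  ∈z⁻ p with X ! e | trans (sym (lookup-map e isZero X)) ([]=⇒lookup p)
  ... | 𝟎 | _ = refl

  private
    supp-! : lookup (supp X) e ≡ not (isZero (X ! e))
    supp-! = trans (lookup-map e not (z X)) (cong not (lookup-map e isZero X))

  ∈supp⁺ : X ! e ≢ 𝟎 → e ∈ supp X
  ∈supp⁺ X≢0 with s , eq ← nonzero-± X≢0 =
    lookup⇒[]= e _ (trans supp-! (cong (λ x → not (isZero x)) eq))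

  ∈supp⁻ : e ∈ supp X → X ! e ≢ 𝟎
  ∈supp⁻ p with X ! e | trans (sym supp-!) ([]=⇒lookup p)
  ... | ± s | _ = λ ()

infix 4 _≈±_
_≈±_ : ∀ {n} → SignVector n → SignVector n → Set
X ≈± Y = X ≡ Y ⊎ X ≡ -ᵥ Y

module _ {n : ℕ} {X Y : SignVector n} where

  ≈±-zero : ∀ {h} → X ≈± Y → Y ! h ≡ 𝟎 → X ! h ≡ 𝟎
  ≈±-zero     (inj₁ refl) Yh = Yh
  ≈±-zero {h} (inj₂ refl) Yh = trans (!-neg Y h) (neg-zero Yh)

  ≈±-zero′ : ∀ {h} → X ≈± Y → X ! h ≡ 𝟎 → Y ! h ≡ 𝟎
  ≈±-zero′     (inj₁ refl) Xh = Xh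
  ≈±-zero′ {h} (inj₂ refl) Xh = neg-zero⁻ (trans (sym (!-neg Y h)) Xh)

  ≈±-dec : Dec (X ≈± Y)
  ≈±-dec with X ≟ᵥ Y | X ≟ᵥ (-ᵥ Y)
  ... | yes p | _     = yes (inj₁ p)
  ... | no _  | yes q = yes (inj₂ q)
  ... | no p  | no q  = no [ p , q ]′

  ≈±-agree : ∀ {a} → X ≈± Y → X ! a ≢ 𝟎 → X ! a ≡ Y ! a → X ≡ Y
  ≈±-agree (inj₁ eq)       _  _  = eq
  ≈±-agree {a} (inj₂ refl) nz eq =
    contradiction (trans (sym eq) (!-neg Y a))
      (≢neg (≢𝟎-resp eq nz))

≈±-sym : ∀ {n} {X Y : SignVector n} → X ≈± Y → Y ≈± X
≈±-sym (inj₁ eq)              = inj₁ (sym eq)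
≈±-sym {Y = Y} (inj₂ refl) = inj₂ (sym (-ᵥ² Y))

-- Z is a conical combination of X and Y, as far as signs can tell.
record Between {n} (X Y Z : SignVector n) : Set where
  constructor between
  field
    cases : ∀ h s → Z ! h ≡ ± s → X ! h ≡ ± s ⊎ Y ! h ≡ ± s
open Between public

module _ {n : ℕ} {X Y Z : SignVector n} (b : Between X Y Z) where

  between-zero : ∀ {h} → X ! h ≡ 𝟎 → Y ! h ≡ 𝟎 → Z ! h ≡ 𝟎
  between-zero {h} Xh Yh with Z ! h ≟₀ 𝟎
  ... | yes eq = eq
  ... | no nz with s , eq ← nonzero-± nz with cases b h s eq
  ... | inj₁ q = contradiction Xh (≡±⇒≢𝟎 q)
  ... | inj₂ q = contradiction Yh (≡±⇒≢𝟎 q)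

  betweenˡ : ∀ {h} → Y ! h ≡ 𝟎 → Z ! h ≢ 𝟎 → Z ! h ≡ X ! h
  betweenˡ {h} Yh nz with s , eq ← nonzero-± nz with cases b h s eq
  ... | inj₁ q = trans eq (sym q)
  ... | inj₂ q = contradiction Yh (≡±⇒≢𝟎 q)

  betweenʳ : ∀ {h} → X ! h ≡ 𝟎 → Z ! h ≢ 𝟎 → Z ! h ≡ Y ! h
  betweenʳ {h} Xh nz with s , eq ← nonzero-± nz with cases b h s eq
  ... | inj₁ q = contradiction Xh (≡±⇒≢𝟎 q)
  ... | inj₂ q = trans eq (sym q)

  between-swap : Between Y X Z
  between-swap = between λ h s eq → swap (cases b h s eq)

  between-neg : Between (-ᵥ X) (-ᵥ Y) (-ᵥ Z)
  between-neg = between λ h s eq → map⊎ (λ p → trans (!-neg X h) (trans (cong neg p) (cong ± (opposite² s))))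
                            (λ p → trans (!-neg Y h) (trans (cong neg p) (cong ± (opposite² s))))
                            (cases b h (opposite s) (neg-≡ (trans (sym (!-neg Z h)) eq)))

between-reverse : ∀ {n} {X Y Z : SignVector n} → Between (-ᵥ X) Y Z → Between (-ᵥ Y) X (-ᵥ Z)
between-reverse {X = X} b = between-swap (subst (λ V → Between V _ _) (-ᵥ² X) (between-neg b))

-- Points, lines and planes

module Points {n : ℕ} (O : OrientedMatroid n) where
  open OrientedMatroid O public

  Elements : Set₁
  Elements = Fin n → Set

  infixl 6 _∪₁_
  _∪₁_ : Elements → Fin n → Elements
  (A ∪₁ e) h = A h ⊎ h ≡ e

  -- These are the cocircuits of the contraction by `A`, kept with all coordinates so that `re` can
  -- move one cocircuit between different flats.
  record Point (A : Elements) : Set where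
    constructor point
    field
      vec : SignVector n
      coc : Cocircuit vec
      on  : ∀ {h} → A h → vec ! h ≡ 𝟎

    infixl 9 _at_
    _at_ : Fin n → Sign₀
    _at_ h = vec ! h
  open Point public

  ⊖_ : ∀ {A} → Point A → Point A
  ⊖ point X c o = point (-ᵥ X) (symmetric c) λ Ah → trans (!-neg X _) (neg-zero (o Ah))

  re : ∀ {A B} (X : Point A) → (∀ {h} → B h → X at h ≡ 𝟎) → Point B
  re X o = point (vec X) (coc X) o

  -- The closure of A has corank at most two.
  Coline : Elements → Set
  Coline A = (X Y U : Point A) (h : Fin n) → X at h ≡ 𝟎 → Y at h ≡ 𝟎 → U at h ≢ 𝟎 → vec X ≈± vec Y

  Coline-mono : ∀ {A B} → (∀ {h} → A h → B h) → Coline A → Coline B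
  Coline-mono A⊆B c X Y U h = c (re X (on X ∘′ A⊆B)) (re Y (on Y ∘′ A⊆B)) (re U (on U ∘′ A⊆B)) h

  -- Incomparability read backwards. An element at which exactly one of two points vanishes is the
  -- standard means below of fixing a sign: elimination cannot cancel there.
  distinguish : ∀ {X Y} → Cocircuit X → Cocircuit Y → ¬ X ≈± Y → ∃[ a ] X ! a ≡ 𝟎 × Y ! a ≢ 𝟎
  distinguish {X} {Y} cX cY X≉Y
    with a , p ← ¬∀⟶∃¬ n (λ a → X ! a ≡ 𝟎 → Y ! a ≡ 𝟎) (λ a → (X ! a ≟₀ 𝟎) →-dec (Y ! a ≟₀ 𝟎))
                  (λ all → case incomparable cY cX
                     (λ e∈ → ∈supp⁺ λ Xe → ∈supp⁻ e∈ (all _ Xe)) of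
                   λ eq → X≉Y (≈±-sym eq))
    with X ! a ≟₀ 𝟎
  ... | yes Xa = a , Xa , λ Ya → p λ _ → Ya
  ... | no Xa  = contradiction (λ eq → contradiction eq Xa) p

  eliminate : ∀ {A} (X Y : Point A) {e} → vec X ≢ -ᵥ vec Y → X at e ≡ neg (Y at e) → X at e ≢ 𝟎 →
              Σ (Point A) λ Z → Z at e ≡ 𝟎 × Between (vec X) (vec Y) (vec Z)
  eliminate X Y X≢-Y sep nz with Z , cZ , Ze , b₀ ← elimination (coc X) (coc Y) X≢-Y (sep , nz) =
    let b = between b₀ in point Z cZ (λ Ah → between-zero b (on X Ah) (on Y Ah)) , Ze , b

  eliminate⁻ : ∀ {A} (X Y : Point A) {e} → vec X ≢ vec Y → X at e ≡ Y at e → X at e ≢ 𝟎 →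
              Σ (Point A) λ Z → Z at e ≡ 𝟎 × Between (-ᵥ vec X) (vec Y) (vec Z)
  eliminate⁻ X Y {e} X≢Y eq nz =
    eliminate (⊖ X) Y (λ p → X≢Y (trans (sym (-ᵥ² (vec X))) (trans (cong -ᵥ_ p) (-ᵥ² (vec Y)))))
      (trans (!-neg (vec X) e) (cong neg eq)) (λ p → nz (neg-zero⁻ (trans (sym (!-neg (vec X) e)) p)))

  meet : ∀ {A} (X Y : Point A) → ¬ vec X ≈± vec Y → ∀ e → Σ (Point A) λ Z → Z at e ≡ 𝟎
  meet X Y X≉Y e with X at e ≟₀ 𝟎 | Y at e ≟₀ 𝟎
  ... | yes Xe | _      = X , Xe
  ... | no _   | yes Ye = Y , Ye
  ... | no Xe  | no Ye with same-or-opposite Xe Ye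
  ... | inj₁ eq with Z , Ze , _ ← eliminate⁻ X Y (λ p → X≉Y (inj₁ p)) eq Xe = Z , Ze
  ... | inj₂ eq with Z , Ze , _ ← eliminate X Y (λ p → X≉Y (inj₂ p)) eq Xe = Z , Ze

  -- Strong matroid elimination follows from weak elimination by induction on the union of the two supports.
  private
    module _ {X Y X′ Y′ : SignVector n} where
      shrink : (∀ {h} → X ! h ≡ 𝟎 → Y ! h ≡ 𝟎 → X′ ! h ≡ 𝟎 × Y′ ! h ≡ 𝟎) →
               ∀ {e} → X ! e ≢ 𝟎 ⊎ Y ! e ≢ 𝟎 → X′ ! e ≡ 𝟎 → Y′ ! e ≡ 𝟎 →
               ∣ supp X′ ∪ supp Y′ ∣ < ∣ supp X ∪ supp Y ∣
      shrink zeros {e} nz X′e Y′e = p⊂q⇒∣p∣<∣q∣ (sub , e , x∈p∪q⁺ (map⊎ ∈supp⁺ ∈supp⁺ nz) , out)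
        where
        sub : supp X′ ∪ supp Y′ ⊆ supp X ∪ supp Y
        sub {h} h∈ with X ! h ≟₀ 𝟎 | Y ! h ≟₀ 𝟎
        ... | no nz | _ = x∈p∪q⁺ (inj₁ (∈supp⁺ nz))
        ... | _ | no nz = x∈p∪q⁺ (inj₂ (∈supp⁺ nz))
        ... | yes Xh | yes Yh with X′h , Y′h ← zeros Xh Yh =
          contradiction (x∈p∪q⁻ (supp X′) (supp Y′) h∈) [ (λ p → ∈supp⁻ p X′h) , (λ p → ∈supp⁻ p Y′h) ]′
        out : ¬ e ∈ supp X′ ∪ supp Y′
        out e∈ = [ (λ p → ∈supp⁻ p X′e) , (λ p → ∈supp⁻ p Y′e) ]′ (x∈p∪q⁻ (supp X′) (supp Y′) e∈)

    strong : ∀ {X Y} → Cocircuit X → Cocircuit Y → Acc _<_ ∣ supp X ∪ supp Y ∣ →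
             ∀ {e h} → X ! e ≢ 𝟎 → Y ! e ≢ 𝟎 → X ! h ≢ 𝟎 → Y ! h ≡ 𝟎 →
             ∃[ Z ] Cocircuit Z × Z ! e ≡ 𝟎 × Z ! h ≢ 𝟎 × (∀ {k} → X ! k ≡ 𝟎 → Y ! k ≡ 𝟎 → Z ! k ≡ 𝟎)
    strong {X} {Y} cX cY (acc rec) {e} {h} Xe Ye Xh Yh
      with point Z cZ Z0 , Ze ← meet {λ k → X ! k ≡ 𝟎 × Y ! k ≡ 𝟎} (point X cX proj₁) (point Y cY proj₂)
                                   (λ X≈Y → Xh (≈±-zero X≈Y Yh)) e
      with Z ! h ≟₀ 𝟎
    ... | no Zh = Z , cZ , Ze , Zh , λ Xk Yk → Z0 (Xk , Yk)
    -- Weak elimination has lost `h`. Eliminating `x` between `Y` and `Z` keeps `e` and stays zero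
    -- at `h`, so the resulting `V` can replace `Y`. The union of supports has lost `h` in the first
    -- recursive call and `x` in the second.
    ... | yes Zh
      with x , Xx , Zx ← distinguish cX cZ (λ X≈Z → Xe (≈±-zero X≈Z Ze))
      with V , cV , Vx , Ve , V0 ← strong cY cZ
             (rec (shrink {X} {Y} {Y} {Z} (λ Xk Yk → Yk , Z0 (Xk , Yk)) (inj₁ Xh) Yh Zh))
             {x} {e} (λ Yx → Zx (Z0 (Xx , Yx))) Zx Ye Ze
      with W , cW , We , Wh , W0 ← strong cX cV
             (rec (shrink {X} {Y} {X} {V} (λ Xk Yk → Xk , V0 Yk (Z0 (Xk , Yk))) (inj₂ (λ Yx → Zx (Z0 (Xx , Yx)))) Xx Vx))
             {e} {h} Xe Ve Xh (V0 Yh Zh)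
      = W , cW , We , Wh , λ Xk Yk → W0 Xk (V0 Yk (Z0 (Xk , Yk)))

  strong-elimination : ∀ {A} (X Y : Point A) {e h} → X at e ≢ 𝟎 → Y at e ≢ 𝟎 → X at h ≢ 𝟎 → Y at h ≡ 𝟎 →
                       Σ (Point A) λ Z → Z at e ≡ 𝟎 × Z at h ≢ 𝟎
  strong-elimination X Y Xe Ye Xh Yh
    with Z , cZ , Ze , Zh , Z0 ← strong (coc X) (coc Y) (<-wellFounded _) Xe Ye Xh Yh =
    point Z cZ (λ Ak → Z0 (on X Ak) (on Y Ak)) , Ze , Zh

  -- The hypothesis says that K has corank at most three; this is how planes are represented.
  plane : ∀ {K p} → Coline (K ∪₁ p) → ∀ {e} (Q : Point K) → Q at e ≢ 𝟎 → Coline (K ∪₁ e)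
  plane {K} {p} col {e} Q Qe X Y U h Xh Yh Uh = decidable-stable ≈±-dec impossible
    where
    on-e : (W : Point (K ∪₁ e)) → W at e ≡ 𝟎
    on-e W = on W (inj₂ refl)
    onK∪p : (W : Point (K ∪₁ e)) → W at p ≡ 𝟎 → Point (K ∪₁ p)
    onK∪p W Wp = re W λ { (inj₁ Kh) → on W (inj₁ Kh) ; (inj₂ refl) → Wp }
    onK : Point (K ∪₁ e) → Point K
    onK W = re W λ Kh → on W (inj₁ Kh)
    off-e : (W : Point (K ∪₁ e)) → W at p ≢ 𝟎 → Σ (Point (K ∪₁ p)) λ V → V at e ≢ 𝟎
    off-e W Wp with Q at p ≟₀ 𝟎
    ... | yes Qp = re Q (λ { (inj₁ Kh) → on Q Kh ; (inj₂ refl) → Qp }) , Qe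
    ... | no Qp with V , Vp , Ve ← strong-elimination Q (onK W) {p} {e} Qp Wp Qe (on-e W) =
      re V (λ { (inj₁ Kh) → on V Kh ; (inj₂ refl) → Vp }) , Ve
    off-h : (W : Point (K ∪₁ e)) → W at p ≢ 𝟎 → W at h ≡ 𝟎 → Σ (Point (K ∪₁ e)) λ V → V at p ≡ 𝟎 × V at h ≢ 𝟎
    off-h W Wp Wh with U at p ≟₀ 𝟎
    ... | yes Up = U , Up , Uh
    ... | no Up = strong-elimination U W Up Wp Uh Wh
    impossible : ¬ ¬ vec X ≈± vec Y
    -- Distinct `X` and `Y` would span a pencil inside `e` and `h`, which has a point `M` on `p`. On
    -- the line `K ∪₁ p` only one point lies on `e`, yet `M` lies on `h` and `M′` does not.
    pencil : (W : Point (K ∪₁ e)) → W at p ≢ 𝟎 → W at h ≡ 𝟎 → ¬ vec X ≈± vec Y → ⊥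
    pencil W Wp Wh X≉Y
      with M , Mp ← meet {λ k → (K ∪₁ e) k ⊎ k ≡ h} (re X λ { (inj₁ k) → on X k ; (inj₂ refl) → Xh })
                         (re Y λ { (inj₁ k) → on Y k ; (inj₂ refl) → Yh }) X≉Y p
      with M′ , M′p , M′h ← off-h W Wp Wh
      with V , Ve ← off-e W Wp
      = M′h (≈±-zero′ (col (onK∪p (re M (on M ∘′ inj₁)) Mp) (onK∪p M′ M′p) V e (on M (inj₁ (inj₂ refl))) (on-e M′) Ve)
                      (on M (inj₂ refl)))
    impossible X≉Y with X at p ≟₀ 𝟎 | Y at p ≟₀ 𝟎
    ... | no Xp  | _      = pencil X Xp Xh X≉Y
    ... | yes _  | no Yp  = pencil Y Yp Yh X≉Y
    ... | yes Xp | yes Yp with U at p ≟₀ 𝟎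
    ...   | yes Up = X≉Y (col (onK∪p X Xp) (onK∪p Y Yp) (onK∪p U Up) h Xh Yh Uh)
    ...   | no Up with V , Ve ← off-e U Up = X≉Y (col (onK∪p X Xp) (onK∪p Y Yp) V e (on-e X) (on-e Y) Ve)

  -- Z is the point of the line through X and Y on the hyperplane g, in the direction from X to Y.
  record Direction (g : Fin n) {A} (X Y Z : Point A) : Set where
    constructor direction
    field
      distinct : vec X ≢ vec Y
      agree    : X at g ≡ Y at g
      finite   : X at g ≢ 𝟎
      infinite : Z at g ≡ 𝟎
      ahead    : Between (-ᵥ vec X) (vec Y) (vec Z)

    X≉Y : ¬ vec X ≈± vec Y
    X≉Y p = distinct (≈±-agree p finite agree)

    Z≉X : ¬ vec Z ≈± vec X
    Z≉X p = finite (≈±-zero′ p infinite)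

    Z≉Y : ¬ vec Z ≈± vec Y
    Z≉Y p = finite (trans agree (≈±-zero′ p infinite))

  flip-direction : ∀ {g A} {X Y Z : Point A} → Direction g X Y Z → Direction g Y X (⊖ Z)
  flip-direction {g} {Z = Z} (direction d a f i b) = direction (λ p → d (sym p)) (sym a) (≢𝟎-resp a f)
    (trans (!-neg (vec Z) g) (neg-zero i)) (between-reverse b)

  neg-direction : ∀ {g A} {X Y Z : Point A} → Direction g X Y Z → Direction g (⊖ X) (⊖ Y) (⊖ Z)
  neg-direction {g} {X = X} {Y} {Z} (direction d a f i b) = direction
    (λ p → d (trans (sym (-ᵥ² _)) (trans (cong -ᵥ_ p) (-ᵥ² _))))
    (trans (!-neg (vec X) g) (trans (cong neg a) (sym (!-neg (vec Y) g))))
    (λ p → f (neg-zero⁻ (trans (sym (!-neg (vec X) g)) p)))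
    (trans (!-neg (vec Z) g) (neg-zero i)) (between-neg b)

  re-direction : ∀ {g} {A B : Elements} {X Y Z : Point A} (o : ∀ {h} → B h → A h) → Direction g X Y Z →
                 Direction g (re X (on X ∘′ o)) (re Y (on Y ∘′ o)) (re Z (on Z ∘′ o))
  re-direction o (direction d a f i b) = direction d a f i b

  directed : ∀ {g A} (X Y : Point A) → vec X ≢ vec Y → X at g ≡ Y at g → X at g ≢ 𝟎 →
             Σ (Point A) (Direction g X Y)
  directed X Y X≢Y eq nz with Z , Zg , b ← eliminate⁻ X Y X≢Y eq nz = Z , direction X≢Y eq nz Zg b

  module OnColine {A : Elements} (col : Coline A) where

    -- With `h` at infinity, `k` meets the line only at infinity and cannot change sign in the
    -- finite part. If it did, eliminating `k` between `U` and `V`, and `h` between `-V` and `U`,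
    -- would give the same point up to sign; `a` excludes equality and `b` excludes opposition.
    parallel : ∀ (W U V : Point A) {h k} → W at h ≡ 𝟎 → W at k ≡ 𝟎 → U at h ≢ 𝟎 → U at h ≡ V at h →
               U at k ≡ V at k
    parallel W U V {h} {k} Wh Wk Uh UVh with U at k ≟₀ 𝟎 | V at k ≟₀ 𝟎
    ... | yes Uk | yes Vk = trans Uk (sym Vk)
    ... | yes Uk | no Vk = contradiction (≈±-zero (col U W V k Uk Wk Vk) Wh) Uh
    ... | no Uk | yes Vk = contradiction (≈±-zero (col V W U k Vk Wk Uk) Wh) (≢𝟎-resp UVh Uh)
    ... | no Uk | no Vk with same-or-opposite Uk Vk
    ...   | inj₁ eq = eq
    ...   | inj₂ eq with ≈±-dec {X = vec U} {vec V}
    ...     | yes (inj₁ p) = cong (_! k) p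
    ...     | yes (inj₂ p) = contradiction (trans (sym UVh) (trans (cong (_! h) p) (!-neg (vec V) h)))
                                           (≢neg (≢𝟎-resp UVh Uh))
    ...     | no U≉V
      with Z , Zk , bZ ← eliminate U V (λ p → U≉V (inj₂ p)) eq Uk
      with Z′ , Z′h , bZ′ ← eliminate⁻ V U (λ p → U≉V (inj₁ (sym p))) (sym UVh) (≢𝟎-resp UVh Uh)
      with a , Ua , Va ← distinguish (coc U) (coc V) U≉V
      with b , Vb , Ub ← distinguish (coc V) (coc U) (λ p → U≉V (≈±-sym p))
      = ⊥-elim (case ZZ′ of λ
          { (inj₁ p) → ≢neg Va (trans (sym (betweenʳ bZ Ua Za))
                (trans (cong (_! a) p) (trans (betweenˡ bZ′ Ua (λ q → Za (≈±-zero ZZ′ q))) (!-neg (vec V) a))))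
          ; (inj₂ p) → ≢neg Ub (trans (sym (betweenˡ bZ Vb Zb))
                (trans (cong (_! b) p) (trans (!-neg (vec Z′) b)
                   (cong neg (betweenʳ bZ′ (trans (!-neg (vec V) b) (neg-zero Vb)) (λ q → Zb (≈±-zero ZZ′ q))))))) })
      where
      Zh : Z at h ≡ 𝟎
      Zh = ≈±-zero (col Z W V k Zk Wk Vk) Wh
      ZZ′ : vec Z ≈± vec Z′
      ZZ′ = col Z Z′ U h Zh Z′h Uh
      Za : Z at a ≢ 𝟎
      Za p = Uk (≈±-zero (col U Z V a Ua p Va) Zk)
      Zb : Z at b ≢ 𝟎
      Zb p = Vk (≈±-zero (col V Z U b Vb p Ub) Zk)

    parallel⁻ : ∀ (W U V : Point A) {h k} → W at h ≡ 𝟎 → W at k ≡ 𝟎 → U at h ≢ 𝟎 → U at h ≡ neg (V at h) →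
                U at k ≡ neg (V at k)
    parallel⁻ W U V {h} {k} Wh Wk Uh eq =
      trans (parallel W U (⊖ V) Wh Wk Uh (trans eq (sym (!-neg (vec V) h)))) (!-neg (vec V) k)

    module _ {g : Fin n} {X Y Z : Point A} (d : Direction g X Y Z) where
      open Direction d

      forwardʳ : ∀ {a} → X at a ≡ 𝟎 → Y at a ≢ 𝟎 → Z at a ≡ Y at a
      forwardʳ {a} Xa Ya = betweenʳ ahead (trans (!-neg (vec X) a) (neg-zero Xa))
        λ Za → Z≉X (col Z X Y a Za Xa Ya)

      forwardˡ : ∀ {a} → Y at a ≡ 𝟎 → X at a ≢ 𝟎 → Z at a ≡ neg (X at a)
      forwardˡ {a} Ya Xa = trans (betweenˡ ahead Ya λ Za → Z≉Y (col Z Y X a Za Ya Xa)) (!-neg (vec X) a)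

      direction-unique : ∀ (Z′ : Point A) → Z′ at g ≡ 𝟎 → vec Z′ ≈± vec Z
      direction-unique Z′ Z′g = col Z′ Z X g Z′g infinite finite

      -- If `f` vanishes at `Z` it is parallel to `g`, hence constant; otherwise the sign of `Z` at
      -- `f` comes from `-X` or from `Y`, and `-X` has the wrong one.
      sign-forward : ∀ {f t} → Z at f ≡ 𝟎 ⊎ Z at f ≡ ± t → X at f ≡ ± t → Y at f ≡ ± t
      sign-forward {f} {t} (inj₁ Zf) Xf = trans (sym (parallel Z X Y infinite Zf finite agree)) Xf
      sign-forward {f} {t} (inj₂ Zf) Xf with cases ahead f t Zf
      ... | inj₁ p = contradiction (trans Xf (trans (sym p) (!-neg (vec X) f))) (≢neg (≡±⇒≢𝟎 Xf))
      ... | inj₂ p = p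

      sign-backward : ∀ {f t} → Z at f ≡ 𝟎 ⊎ Z at f ≡ ± t → Y at f ≡ ± (opposite t) → X at f ≡ ± (opposite t)
      sign-backward {f} {t} (inj₁ Zf) Yf = trans (parallel Z X Y infinite Zf finite agree) Yf
      sign-backward {f} {t} (inj₂ Zf) Yf with cases ahead f t Zf
      ... | inj₁ p = neg-≡ (trans (sym (!-neg (vec X) f)) p)
      ... | inj₂ p = contradiction (trans (sym p) Yf) (≢neg {± t} λ ())

      -- `Between` leaves room for additional zeros of `Z`. At an `h` where `X` and `Y` are
      -- opposite, such a zero would make `h` parallel to `g`, and then `g` would change sign as
      -- well. This recovers the equality demanded by `IsElimination`.
      strictly-between : ∀ h → ¬ Sep (-ᵥ vec X) (vec Y) h → Z at h ≡ (-ᵥ vec X ∘ vec Y) ! h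
      strictly-between h ¬sep with X at h ≟₀ 𝟎 | Y at h ≟₀ 𝟎
      ... | yes Xh | yes Yh = trans (between-zero ahead -Xh Yh) (sym (trans (!-∘ (-ᵥ vec X) (vec Y) h) (cong₂ _∘₀_ -Xh Yh)))
        where -Xh = trans (!-neg (vec X) h) (neg-zero Xh)
      ... | yes Xh | no Yh = trans (forwardʳ Xh Yh) (sym (trans (!-∘ (-ᵥ vec X) (vec Y) h) (cong (_∘₀ (Y at h)) -Xh)))
        where -Xh = trans (!-neg (vec X) h) (neg-zero Xh)
      ... | no Xh | _ = trans Zh (sym (trans (!-∘ (-ᵥ vec X) (vec Y) h) (trans (cong (_∘₀ (Y at h)) -Xh) (∘-left (neg-≢𝟎 Xh)))))
        where
        -Xh = !-neg (vec X) h
        ∘-left : ∀ {x y} → x ≢ 𝟎 → x ∘₀ y ≡ x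
        ∘-left {𝟎} nz = contradiction refl nz
        ∘-left {± s} _ = refl
        Y-case : Y at h ≡ 𝟎 ⊎ Y at h ≡ neg (X at h)
        Y-case with Y at h ≟₀ 𝟎
        ... | yes Yh = inj₁ Yh
        ... | no Yh with same-or-opposite Yh Xh
        ...   | inj₁ eq = contradiction (trans -Xh (cong neg (sym eq)) , λ p → neg-≢𝟎 Xh (trans (sym -Xh) p)) ¬sep
        ...   | inj₂ eq = inj₂ eq
        Zh : Z at h ≡ neg (X at h)
        Zh with Y-case
        ... | inj₁ Yh = forwardˡ Yh Xh
        ... | inj₂ Yh with Z at h ≟₀ 𝟎
        ...   | yes p = contradiction
                  (trans (sym agree) (parallel⁻ Z X Y p infinite Xh (trans (sym (neg² _)) (cong neg (sym Yh)))))
                  (≢neg (≢𝟎-resp agree finite))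
        ...   | no nz with s , eq ← nonzero-± nz with cases ahead h s eq
        ...     | inj₁ p = trans eq (trans (sym p) -Xh)
        ...     | inj₂ p = trans eq (trans (sym p) Yh)

    module _ {g : Fin n} {X Y Z : Point A} (X≢Y : vec X ≢ vec Y) (agr : X at g ≡ Y at g) (fin : X at g ≢ 𝟎)
             (Zg : Z at g ≡ 𝟎) where

      -- The point on `g` is unique up to sign, so its sign at a single element decides whether it
      -- is the direction from `X` to `Y`.
      direction-byʳ : ∀ {a} → X at a ≡ 𝟎 → Y at a ≢ 𝟎 → Z at a ≡ Y at a → Direction g X Y Z
      direction-byʳ {a} Xa Ya Za with Z₀ , d ← directed X Y X≢Y agr fin =
        direction X≢Y agr fin Zg (subst (Between _ _) (sym Z≡Z₀) (Direction.ahead d))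
        where Z≡Z₀ = ≈±-agree (direction-unique d Z Zg) (≢𝟎-resp (sym Za) Ya) (trans Za (sym (forwardʳ d Xa Ya)))

      direction-byˡ : ∀ {a} → Y at a ≡ 𝟎 → X at a ≢ 𝟎 → Z at a ≡ neg (X at a) → Direction g X Y Z
      direction-byˡ {a} Ya Xa Za with Z₀ , d ← directed X Y X≢Y agr fin =
        direction X≢Y agr fin Zg (subst (Between _ _) (sym Z≡Z₀) (Direction.ahead d))
        where Z≡Z₀ = ≈±-agree (direction-unique d Z Zg) (≢𝟎-resp (sym Za) (neg-≢𝟎 Xa)) (trans Za (sym (forwardˡ d Ya Xa)))

-- Rank

any-signVector? : ∀ {n} {P : SignVector n → Set} → Decidable P → Dec (∃ P)
any-signVector? {ℕ.zero} P? = map′ ([] ,_) (λ { ([] , p) → p }) (P? [])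
any-signVector? {suc n} P?
  with any-signVector? (λ X → P? (𝟎 ∷ X)) | any-signVector? (λ X → P? (± Sign.+ ∷ X)) | any-signVector? (λ X → P? (± Sign.- ∷ X))
... | yes (X , p) | _ | _ = yes (_ , p)
... | _ | yes (X , p) | _ = yes (_ , p)
... | _ | _ | yes (X , p) = yes (_ , p)
... | no ¬0 | no ¬+ | no ¬- = no λ { (𝟎 ∷ X , p) → ¬0 (X , p)
                                   ; (± Sign.+ ∷ X , p) → ¬+ (X , p)
                                   ; (± Sign.- ∷ X , p) → ¬- (X , p) }

∣p∪⁅x⁆∣ : ∀ {n} (p : Subset n) {x} → x ∉ p → ∣ p ∪ ⁅ x ⁆ ∣ ≡ suc ∣ p ∣
∣p∪⁅x⁆∣ (inside  ∷ p) {zero}  x∉p = contradiction here x∉p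
∣p∪⁅x⁆∣ (outside ∷ p) {zero}  x∉p = cong (suc ∘′ ∣_∣) (∪-identityʳ p)
∣p∪⁅x⁆∣ (inside  ∷ p) {suc x} x∉p = cong suc (∣p∪⁅x⁆∣ p (x∉p ∘′ there))
∣p∪⁅x⁆∣ (outside ∷ p) {suc x} x∉p = ∣p∪⁅x⁆∣ p (x∉p ∘′ there)

∣p∣≤1+∣p-x∣ : ∀ {n} (p : Subset n) x → ∣ p ∣ ≤ suc ∣ p - x ∣
∣p∣≤1+∣p-x∣ p x = ≤-trans (p⊆q⇒∣p∣≤∣q∣ sub) (≤-reflexive (∣p∪⁅x⁆∣ (p - x) (λ m → x∉p-x p m)))
  where
  x∉p-x : ∀ {n} (p : Subset n) {x} → x ∉ p - x
  x∉p-x (_ ∷ p) {suc x} (there m) = x∉p-x p m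
  x∉p-x (_ ∷ p) {zero} ()
  sub : p ⊆ (p - x) ∪ ⁅ x ⁆
  sub {y} y∈p with y ≟ᶠ x
  ... | yes refl = x∈p∪q⁺ {p = p - x} (inj₂ (x∈⁅x⁆ x))
  ... | no y≢x   = x∈p∪q⁺ (inj₁ (x∈p∧x≢y⇒x∈p-y y∈p y≢x))

∈-minus : ∀ {n} (p : Subset n) {x y} → y ∈ p - x → y ∈ p × y ≢ x
∈-minus (_ ∷ p) {zero}  (there m) = there (p─q⊆p p empty m) , λ ()
∈-minus (_ ∷ p) {suc x} here = here , λ ()
∈-minus (_ ∷ p) {suc x} (there m) with y∈p , y≢x ← ∈-minus p m = there y∈p , λ { refl → y≢x refl }

∈-insert : ∀ {n} (p : Subset n) {x y} → y ∈ p ∪ ⁅ x ⁆ → y ∈ p ⊎ y ≡ x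
∈-insert p {x} m with x∈p∪q⁻ p ⁅ x ⁆ m
... | inj₁ y∈p = inj₁ y∈p
... | inj₂ y∈x = inj₂ (x∈⁅y⁆⇒x≡y x y∈x)

x∈p∪⁅x⁆ : ∀ {n} (p : Subset n) x → x ∈ p ∪ ⁅ x ⁆
x∈p∪⁅x⁆ p x = x∈p∪q⁺ {p = p} (inj₂ (x∈⁅x⁆ x))

module _ {n : ℕ} {X Y : SignVector n} where

  ∈z-∘⁺ : ∀ {h} → X ! h ≡ 𝟎 → Y ! h ≡ 𝟎 → h ∈ z (X ∘ Y)
  ∈z-∘⁺ {h} Xh Yh = ∈z⁺ (trans (!-∘ X Y h) (cong₂ _∘₀_ Xh Yh))

  ∈z-∘⁻ : ∀ {h} → h ∈ z (X ∘ Y) → X ! h ≡ 𝟎 × Y ! h ≡ 𝟎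
  ∈z-∘⁻ {h} h∈ with X ! h | Y ! h | trans (sym (!-∘ X Y h)) (∈z⁻ h∈)
  ... | 𝟎 | 𝟎 | _ = refl , refl

module Rank {n : ℕ} (O : OrientedMatroid n) where
  open Points O

  Common : SignVector n → SignVector n → Elements
  Common X Y h = X ! h ≡ 𝟎 × Y ! h ≡ 𝟎

  -- A positive witness against membership in the closure; finiteness of the set of sign vectors
  -- makes it decidable.
  Escape : Fin n → Subset n → Set
  Escape e A = ∃[ U ] Cocircuit U × A ⊆ z U × U ! e ≢ 𝟎

  escape : ∀ {e A} → Escape e A → ¬ e ∈cl A
  escape (U , cU , A⊆ , Ue) e∈cl = Ue (∈z⁻ (e∈cl cU A⊆))

  cl? : ∀ e A → e ∈cl A ⊎ Escape e A
  cl? e A with any-signVector? (λ U → cocircuit? U ×-dec (A ⊆? z U) ×-dec ¬? (U ! e ≟₀ 𝟎))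
  ... | yes p = inj₂ p
  ... | no ¬p = inj₁ λ {X} cX A⊆ → ∈z⁺ (decidable-stable (X ! e ≟₀ 𝟎) λ Xe → ¬p (X , cX , A⊆ , Xe))

  cl-mono : ∀ {e A B} → A ⊆ B → e ∈cl A → e ∈cl B
  cl-mono A⊆B e∈ cX B⊆ = e∈ cX (B⊆ ∘′ A⊆B)

  independent-⊆ : ∀ {I J} → I ⊆ J → Independent J → Independent I
  independent-⊆ {I} {J} I⊆J indJ {e} e∈I c = indJ (I⊆J e∈I)
    (cl-mono (λ m → let y∈I , y≢e = ∈-minus I m in x∈p∧x≢y⇒x∈p-y (I⊆J y∈I) y≢e) c)

  module _ {I h} (ind : Independent I) (esc : Escape h I) where

    private
      U = proj₁ esc
      cU = proj₁ (proj₂ esc)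
      I⊆ = proj₁ (proj₂ (proj₂ esc))
      Uh = proj₂ (proj₂ (proj₂ esc))

    outside-escape : h ∉ I
    outside-escape h∈ = Uh (∈z⁻ (I⊆ h∈))

    extend : Independent (I ∪ ⁅ h ⁆)
    extend {e} e∈ c with ∈-insert I e∈
    ... | inj₂ refl = Uh (∈z⁻ (c cU λ m → let y∈ , y≢ = ∈-minus (I ∪ ⁅ h ⁆) m in
                                          [ I⊆ , (λ eq → contradiction eq y≢) ]′ (∈-insert I y∈)))
    ... | inj₁ e∈I = ind e∈I λ {V} cV I-e⊆ → ∈z⁺ (decidable-stable (V ! e ≟₀ 𝟎) λ Ve → bad V cV I-e⊆ Ve)
      where
      bad : ∀ V → Cocircuit V → I - e ⊆ z V → V ! e ≢ 𝟎 → ⊥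
      bad V cV I-e⊆ Ve with V ! h ≟₀ 𝟎
      ... | yes Vh = Ve (∈z⁻ (c cV sub))
        where
        sub : (I ∪ ⁅ h ⁆) - e ⊆ z V
        sub m with y∈ , y≢ ← ∈-minus (I ∪ ⁅ h ⁆) m with ∈-insert I y∈
        ... | inj₁ y∈I = I-e⊆ (x∈p∧x≢y⇒x∈p-y y∈I y≢)
        ... | inj₂ refl = ∈z⁺ Vh
      ... | no Vh with point Z cZ Z0 , Zh , Ze ← strong-elimination {λ k → V ! k ≡ 𝟎 × U ! k ≡ 𝟎}
                         (point V cV proj₁) (point U cU proj₂) {h} {e} Vh Uh Ve (∈z⁻ (I⊆ e∈I))
        = Ze (∈z⁻ (c cZ sub))
        where
        sub : (I ∪ ⁅ h ⁆) - e ⊆ z Z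
        sub m with y∈ , y≢ ← ∈-minus (I ∪ ⁅ h ⁆) m with ∈-insert I y∈
        ... | inj₁ y∈I = ∈z⁺ (Z0 (∈z⁻ (I-e⊆ (x∈p∧x≢y⇒x∈p-y y∈I y≢)) , ∈z⁻ (I⊆ y∈I)))
        ... | inj₂ refl = ∈z⁺ Zh

    extend-size : ∣ I ∪ ⁅ h ⁆ ∣ ≡ suc ∣ I ∣
    extend-size = ∣p∪⁅x⁆∣ I outside-escape

  insert-⊆ : ∀ {I h} {Z : Subset n} → I ⊆ Z → h ∈ Z → I ∪ ⁅ h ⁆ ⊆ Z
  insert-⊆ {I} I⊆ h∈ m = [ I⊆ , (λ { refl → h∈ }) ]′ (∈-insert I m)

  -- Exchange: an `e` in `J` outside `B` is replaced by some `b` in `B` that escapes `J - e`. Such a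
  -- `b` exists, since otherwise `J - e` would span `B` and with it `e`.
  steinitz : ∀ J B → Independent J → (∀ {e} → e ∈ J → e ∈cl B) → Acc _<_ ∣ J ─ B ∣ → ∣ J ∣ ≤ ∣ B ∣
  steinitz J B ind J⊆cl (acc rec) with any? (λ e → (e ∈? J) ×-dec ¬? (e ∈? B))
  ... | no none = p⊆q⇒∣p∣≤∣q∣ λ {e} e∈J → decidable-stable (e ∈? B) λ e∉B → none (e , e∈J , e∉B)
  ... | yes (e , e∈J , e∉B) with any? (λ b → (b ∈? B) ×-dec escape? b)
    where
    escape? : ∀ b → Dec (Escape b (J - e))
    escape? b with cl? b (J - e)
    ... | inj₁ c = no λ p → escape p c
    ... | inj₂ p = yes p
  ... | no none = ⊥-elim (ind e∈J λ cV J-e⊆ → J⊆cl e∈J cV λ b∈B → B⊆cl b∈B cV J-e⊆)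
    where
    B⊆cl : ∀ {b} → b ∈ B → b ∈cl (J - e)
    B⊆cl {b} b∈B with cl? b (J - e)
    ... | inj₁ c = c
    ... | inj₂ p = contradiction (b , b∈B , p) none
  ... | yes (b , b∈B , esc) = ≤-trans (≤-trans (∣p∣≤1+∣p-x∣ J e) (≤-reflexive (sym (extend-size ind′ esc))))
      (steinitz ((J - e) ∪ ⁅ b ⁆) B (extend ind′ esc) sub-cl (rec (p⊂q⇒∣p∣<∣q∣ (sub , e , x∈p∧x∉q⇒x∈p─q e∈J e∉B , e∉))))
    where
    ind′ : Independent (J - e)
    ind′ = independent-⊆ (λ m → proj₁ (∈-minus J m)) ind
    sub-cl : ∀ {x} → x ∈ (J - e) ∪ ⁅ b ⁆ → x ∈cl B
    sub-cl m with ∈-insert (J - e) m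
    ... | inj₁ x∈ = J⊆cl (proj₁ (∈-minus J x∈))
    ... | inj₂ refl = λ _ B⊆ → B⊆ b∈B
    ∈-diff : ∀ {n} (p q : Subset n) {x} → x ∈ p ─ q → x ∈ p × x ∉ q
    ∈-diff (inside ∷ p) (outside ∷ q) here = here , λ ()
    ∈-diff (_ ∷ p) (outside ∷ q) (there m) = let a , b = ∈-diff p q m in there a , λ { (there r) → b r }
    ∈-diff (_ ∷ p) (inside ∷ q) (there m) = let a , b = ∈-diff p q m in there a , λ { (there r) → b r }
    sub : ((J - e) ∪ ⁅ b ⁆) ─ B ⊆ J ─ B
    sub m with x∈ , x∉B ← ∈-diff ((J - e) ∪ ⁅ b ⁆) B m with ∈-insert (J - e) x∈
    ... | inj₁ x∈J = x∈p∧x∉q⇒x∈p─q (proj₁ (∈-minus J x∈J)) x∉B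
    ... | inj₂ refl = contradiction b∈B x∉B
    e∉ : e ∉ ((J - e) ∪ ⁅ b ⁆) ─ B
    e∉ m with ∈-insert (J - e) (proj₁ (∈-diff ((J - e) ∪ ⁅ b ⁆) B m))
    ... | inj₁ e∈ = proj₂ (∈-minus J e∈) refl
    ... | inj₂ refl = e∉B b∈B

  basis : ∀ A I → I ⊆ A → Independent I → Acc _<_ ∣ A ─ I ∣ →
          ∃[ B ] B ⊆ A × Independent B × (∀ {e} → e ∈ A → e ∈cl B)
  basis A I I⊆A ind (acc rec) with any? (λ a → (a ∈? A) ×-dec escape? a)
    where
    escape? : ∀ b → Dec (Escape b I)
    escape? b with cl? b I
    ... | inj₁ c = no λ p → escape p c
    ... | inj₂ p = yes p
  ... | no none = I , I⊆A , ind , A⊆cl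
    where
    A⊆cl : ∀ {e} → e ∈ A → e ∈cl I
    A⊆cl {e} e∈A with cl? e I
    ... | inj₁ c = c
    ... | inj₂ p = contradiction (e , e∈A , p) none
  ... | yes (a , a∈A , esc) = basis A (I ∪ ⁅ a ⁆) (insert-⊆ I⊆A a∈A) (extend ind esc) (rec
        (p⊂q⇒∣p∣<∣q∣ ((λ m → mono A I m) , a , x∈p∧x∉q⇒x∈p─q a∈A (outside-escape ind esc) , out A I a)))
    where
    mono : ∀ {n} (p q : Subset n) {a x} → x ∈ p ─ (q ∪ ⁅ a ⁆) → x ∈ p ─ q
    mono (_ ∷ p) (outside ∷ q) {suc a} here = here
    mono (_ ∷ p) (outside ∷ q) {suc a} (there m) = there (mono p q m)
    mono (_ ∷ p) (inside ∷ q) {suc a} (there m) = there (mono p q m)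
    mono (_ ∷ p) (outside ∷ q) {zero} {suc x} (there m) = there (subst (λ r → x ∈ p ─ r) (∪-identityʳ q) m)
    mono (_ ∷ p) (inside ∷ q) {zero} {suc x} (there m) = there (subst (λ r → x ∈ p ─ r) (∪-identityʳ q) m)
    out : ∀ {n} (p q : Subset n) a → a ∉ p ─ (q ∪ ⁅ a ⁆)
    out (_ ∷ p) (outside ∷ q) (suc a) (there m) = out p q a m
    out (_ ∷ p) (inside ∷ q) (suc a) (there m) = out p q a m
    out (_ ∷ p) (outside ∷ q) zero ()
    out (_ ∷ p) (inside ∷ q) zero ()

  -- Two different points `W`, `W′` on `h` would let a basis of the edge be extended by `h`, `k` and
  -- `l`, escaping through `U`, `W′` and `W` in turn: one element more than the rank permits.
  edge⇒coline : ∀ {X Y} → IsEdge (X ∘ Y) → Coline (Common X Y)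
  edge⇒coline {X} {Y} (_ , _ , r , (_ , bound) , (I , I⊆ , ind , ∣I∣≡r) , _) W W′ U h Wh W′h Uh =
    decidable-stable ≈±-dec λ W≉W′ → too-large W≉W′
    where
    I⊆z : (V : Point (Common X Y)) → I ⊆ z (vec V)
    I⊆z V e∈I = ∈z⁺ (on V (∈z-∘⁻ {X = X} (I⊆ e∈I)))
    too-large : ¬ vec W ≈± vec W′ → ⊥
    too-large W≉W′ with k , Wk , W′k ← distinguish (coc W) (coc W′) W≉W′ | l , Wl ← nonzero-entry (nonzero (coc W)) =
      1+n≰n (≤-trans (≤-reflexive (sym size)) (bound ⊆⊤ ind₃))
      where
      esc₁ : Escape h I
      esc₁ = vec U , coc U , I⊆z U , Uh
      ind₁ = extend ind esc₁
      esc₂ : Escape k (I ∪ ⁅ h ⁆)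
      esc₂ = vec W′ , coc W′ , insert-⊆ (I⊆z W′) (∈z⁺ W′h) , W′k
      ind₂ = extend ind₁ esc₂
      esc₃ : Escape l ((I ∪ ⁅ h ⁆) ∪ ⁅ k ⁆)
      esc₃ = vec W , coc W , insert-⊆ (insert-⊆ (I⊆z W) (∈z⁺ Wh)) (∈z⁺ Wk) , Wl
      ind₃ : Independent (((I ∪ ⁅ h ⁆) ∪ ⁅ k ⁆) ∪ ⁅ l ⁆)
      ind₃ = extend ind₂ esc₃
      size : ∣ ((I ∪ ⁅ h ⁆) ∪ ⁅ k ⁆) ∪ ⁅ l ⁆ ∣ ≡ 3 + r
      size = trans (extend-size ind₂ esc₃) (cong suc (trans (extend-size ind₁ esc₂)
               (cong suc (trans (extend-size ind esc₁) (cong suc ∣I∣≡r)))))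

  -- A basis `I` of the common zeros is completed by `h` and `l`: on the line only `±X` vanishes at
  -- `h`, and `l` is chosen where `X` does not vanish, so no cocircuit vanishes on all of `B`.
  coline⇒edge : ∀ {X Y} → Cocircuit X → Cocircuit Y → ¬ X ≈± Y → Coline (Common X Y) → IsEdge (X ∘ Y)
  coline⇒edge {X} {Y} cX cY X≉Y col
    with I , I⊆ , ind , spans ← basis (z (X ∘ Y)) empty (λ m → contradiction m ∉⊥) (λ m → contradiction m ∉⊥) (<-wellFounded _)
       | h , Xh , Yh ← distinguish cX cY X≉Y
       | l , Xl ← nonzero-entry (nonzero cX)
    = covector , flat , ∣ I ∣ ,
      ((B , ⊆⊤ , ind₂ , sizeB) , λ {J} _ indJ → ≤-trans (steinitz J B indJ (λ {e} _ → full-cl e) (<-wellFounded _)) (≤-reflexive sizeB)) ,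
      ((I , I⊆ , ind , refl) , λ {J} J⊆ indJ → steinitz J I indJ (λ m → spans (J⊆ m)) (<-wellFounded _))
    where
    covector : Covector (X ∘ Y)
    covector = subst (λ V → Covector (X ∘ V)) (zipWith-identityʳ {f = _∘₀_} (λ { 𝟎 → refl ; (± s) → refl }) Y) (compose cX (compose cY zeroVector))
    flat : Flat (z (X ∘ Y))
    flat e∈ = ∈z-∘⁺ (∈z⁻ (e∈ cX (λ m → ∈z⁺ (proj₁ (∈z-∘⁻ {X = X} m))))) (∈z⁻ (e∈ cY (λ m → ∈z⁺ (proj₂ (∈z-∘⁻ {X = X} m)))))
    esc₁ : Escape h I
    esc₁ = Y , cY , (λ m → ∈z⁺ (proj₂ (∈z-∘⁻ {X = X} (I⊆ m)))) , Yh
    ind₁ = extend ind esc₁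
    esc₂ : Escape l (I ∪ ⁅ h ⁆)
    esc₂ = X , cX , insert-⊆ (λ m → ∈z⁺ (proj₁ (∈z-∘⁻ {X = X} (I⊆ m)))) (∈z⁺ Xh) , Xl
    B = (I ∪ ⁅ h ⁆) ∪ ⁅ l ⁆
    ind₂ : Independent B
    ind₂ = extend ind₁ esc₂
    sizeB : ∣ B ∣ ≡ 2 + ∣ I ∣
    sizeB = trans (extend-size ind₁ esc₂) (cong suc (extend-size ind esc₁))
    full-cl : ∀ e → e ∈cl B
    full-cl e {V} cV B⊆ = contradiction
      (≈±-zero (col (point X cX proj₁) (point V cV onV) (point Y cY proj₂) h Xh (∈z⁻ (B⊆ h∈B)) Yh) (∈z⁻ (B⊆ (x∈p∪⁅x⁆ _ l)))) Xl
      where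
      h∈B : h ∈ B
      h∈B = x∈p∪q⁺ (inj₁ (x∈p∪⁅x⁆ I h))
      onV : ∀ {k} → Common X Y k → V ! k ≡ 𝟎
      onV (Xk , Yk) = ∈z⁻ (spans (∈z-∘⁺ Xk Yk) cV λ m → B⊆ (x∈p∪q⁺ (inj₁ (x∈p∪q⁺ (inj₁ m)))))

-- Closed walks

module _ {a r} {A : Set a} (R : A → A → Set r) (R-refl : ∀ {x} → R x x)
         (R-trans : ∀ {x y z} → R x y → R y z → R x z) where

  private
    from-start : ∀ {m} (P : Fin (suc m) → A) → (∀ i → R (P (inject₁ i)) (P (suc i))) → ∀ i → R (P zero) (P i)
    from-start P step zero = R-refl
    from-start {suc m} P step (suc i) = R-trans (step zero) (from-start (P ∘′ suc) (λ i → step (suc i)) i)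

    to-end : ∀ {m} (P : Fin (suc m) → A) → (∀ i → R (P (inject₁ i)) (P (suc i))) → ∀ i → R (P i) (P (fromℕ m))
    to-end {ℕ.zero} P step zero = R-refl
    to-end {suc m} P step zero = R-trans (step zero) (to-end (P ∘′ suc) (λ i → step (suc i)) zero)
    to-end {suc m} P step (suc i) = to-end (P ∘′ suc) (λ i → step (suc i)) i

  cyclic : ∀ {m} (P : Fin (suc m) → A) → P (fromℕ m) ≡ P zero → (∀ i → R (P (inject₁ i)) (P (suc i))) →
           ∀ i j → R (P i) (P j)
  cyclic P closed step i j = R-trans (subst (R (P i)) closed (to-end P step i)) (from-start P step j)

module _ {A : Set} (_≟_ : (x y : A) → Dec (x ≡ y)) (R : A → A → Set) where

  record SimplePath (x y : A) : Set where
    field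
      {m}      : ℕ
      P        : Fin (suc m) → A
      start    : P zero ≡ x
      end      : P (fromℕ m) ≡ y
      step     : ∀ i → R (P (inject₁ i)) (P (suc i))
      distinct : Injective _≡_ _≡_ P

  drop-path : ∀ {m} (P : Fin (suc m) → A) → (∀ i → R (P (inject₁ i)) (P (suc i))) → Injective _≡_ _≡_ P →
              ∀ j → SimplePath (P j) (P (fromℕ m))
  drop-path P step inj zero = record { P = P ; start = refl ; end = refl ; step = step ; distinct = inj }
  drop-path {suc m} P step inj (suc j) = drop-path (P ∘′ suc) (λ i → step (suc i)) (suc-injective ∘′ inj) j

  -- A `DirectedCycle` has distinct vertices. Only the way back from the head of a strict edge to
  -- its tail is shortened, so the strict edge itself is never erased.
  erase-loops : ∀ {x y} → Star R x y → SimplePath x y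
  erase-loops {x} ε = record { m = 0 ; P = λ _ → x ; start = refl ; end = refl ; step = λ ()
                             ; distinct = λ { {zero} {zero} _ → refl } }
  erase-loops {x} (r ◅ path) with erase-loops path
  ... | record { P = P ; start = start ; end = end ; step = step ; distinct = distinct }
    with any? (λ j → P j ≟ x)
  ... | yes (j , refl) = subst (SimplePath x) end (drop-path P step distinct j)
  ... | no x∉ = record
    { P = λ { zero → x ; (suc i) → P i } ; start = refl ; end = end
    ; step = λ { zero → subst (R x) (sym start) r ; (suc i) → step i }
    ; distinct = λ { {zero} {zero} _ → refl ; {zero} {suc j} eq → contradiction (j , sym eq) x∉
                   ; {suc i} {zero} eq → contradiction (i , eq) x∉ ; {suc i} {suc j} eq → cong suc (distinct eq) } }

-- Separators and level walks in a Euclidean program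

Nonneg : Sign → Sign₀ → Set
Nonneg t x = x ≡ 𝟎 ⊎ x ≡ ± t

nonneg-neg : ∀ {t x} → Nonneg t x → Nonneg (opposite t) (neg x)
nonneg-neg = map⊎ (cong neg) (cong neg)

module Separation {n : ℕ} where

  Sep? : (X Y : SignVector n) → ∀ e → Dec (Sep X Y e)
  Sep? X Y e = (X ! e ≟₀ neg (Y ! e)) ×-dec ¬? (X ! e ≟₀ 𝟎)

  separated : Sign₀ → Sign₀ → Bool
  separated x y = does ((x ≟₀ neg y) ×-dec ¬? (x ≟₀ 𝟎))

  separator : (X Y : SignVector n) → Subset n
  separator = zipWith separated

  ∈separator⁺ : ∀ {X Y e} → Sep X Y e → e ∈ separator X Y
  ∈separator⁺ {X} {Y} {e} s = lookup⇒[]= e _ (trans (lookup-zipWith separated e X Y) (does-true (Sep? X Y e)))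
    where
    does-true : (d : Dec (Sep X Y e)) → does d ≡ true
    does-true (yes _) = refl
    does-true (no ¬s) = contradiction s ¬s

  ∈separator⁻ : ∀ {X Y e} → e ∈ separator X Y → Sep X Y e
  ∈separator⁻ {X} {Y} {e} m = does-true (Sep? X Y e) (trans (sym (lookup-zipWith separated e X Y)) ([]=⇒lookup m))
    where
    does-true : (d : Dec (Sep X Y e)) → does d ≡ true → Sep X Y e
    does-true (yes s) _ = s

  separator-shrinks : ∀ (X Y X′ Y′ : SignVector n) {h} → (∀ {e} → Sep X′ Y′ e → Sep X Y e) → Sep X Y h → ¬ Sep X′ Y′ h →
                      ∣ separator X′ Y′ ∣ < ∣ separator X Y ∣
  separator-shrinks X Y X′ Y′ {h} sub s ¬s = p⊂q⇒∣p∣<∣q∣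
    ((λ m → ∈separator⁺ {X} (sub (∈separator⁻ {X′} m))) , h , ∈separator⁺ {X} s , λ m → ¬s (∈separator⁻ {X′} m))

module Levels {n : ℕ} (O : OrientedMatroid n) (euclidean : OrientedMatroid.Euclidean O) (g f : Fin n) where
  open Points O
  open Rank O
  open Graph g f
  open Separation

  Edge : SignVector n → SignVector n → SignVector n → Set
  Edge Z X Y = Vertex X × Vertex Y × Adjacent X Y × IsElimination g (-ᵥ X) Y Z

  Ascent : SignVector n → SignVector n → Set
  Ascent X Y = Vertex X × Vertex Y × Adjacent X Y × (X ⟶ Y ⊎ X ⟷ Y)

  _⇝_ : SignVector n → SignVector n → Set
  _⇝_ = Star Ascent

  edge⇒ascent : ∀ {X Y Z} → Nonneg Sign.+ (Z ! f) → Edge Z X Y → Ascent X Y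
  edge⇒ascent (inj₁ Zf) (vX , vY , adj , el) = vX , vY , adj , inj₂ (_ , el , Zf)
  edge⇒ascent (inj₂ Zf) (vX , vY , adj , el) = vX , vY , adj , inj₁ (_ , el , Zf)

  no-strict-cycle : ∀ {X Y Z} → Edge Z X Y → Z ! f ≡ ± Sign.+ → Y ⇝ X → ⊥
  no-strict-cycle {X} {Y} {Z} (vX , vY , adj , el) Zf path = euclidean g f program (cycle (erase-loops _≟ᵥ_ Ascent path))
    where
    program : IsProgram g f
    program = record
      { g≢f = λ { refl → ≡±⇒≢𝟎 Zf (proj₁ (proj₂ el)) }
      ; g-noLoop = λ loop → ≡±⇒≢𝟎 (proj₂ vX) (∈z⁻ (loop (proj₁ vX) λ m → contradiction m ∉⊥))
      ; f-noColoop = no-coloop }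
      where
      -- By incomparability the cocircuit `D` of a coloop `f` would be, up to sign, the only one not
      -- vanishing at `f`. It vanishes at `g`, so `f` would vanish at all vertices, and then at `Z`.
      no-coloop : ¬ Coloop f
      no-coloop (D , cD , suppD) = ≡±⇒≢𝟎 Zf (trans (proj₂ (proj₂ el) f ¬sep) (trans (!-∘ (-ᵥ X) Y f)
          (cong₂ _∘₀_ (trans (!-neg X f) (neg-zero (vanish vX))) (vanish vY))))
        where
        vanish : ∀ {V} → Vertex V → V ! f ≡ 𝟎
        vanish {V} (cV , Vg) with V ! f ≟₀ 𝟎
        ... | yes Vf = Vf
        ... | no Vf = contradiction (∈z⁻-D (incomparable cD cV λ m → ∈supp⁺ (subst (λ h → V ! h ≢ 𝟎) (sym (only m)) Vf))) λ Dg → g∉D Dg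
          where
          only : ∀ {h} → h ∈ supp D → h ≡ f
          only m = x∈⁅y⁆⇒x≡y f (subst (_ ∈_) suppD m)
          ∈z⁻-D : D ≡ V ⊎ D ≡ -ᵥ V → D ! g ≢ 𝟎
          ∈z⁻-D p Dg = ≡±⇒≢𝟎 Vg (≈±-zero′ p Dg)
          g∉D : D ! g ≢ 𝟎 → ⊥
          g∉D Dg with refl ← only (∈supp⁺ {X = D} Dg) = ≡±⇒≢𝟎 Zf (proj₁ (proj₂ el))
        ¬sep : ¬ Sep (-ᵥ X) Y f
        ¬sep (_ , nz) = nz (trans (!-neg X f) (neg-zero (vanish vX)))
    cycle : SimplePath _≟ᵥ_ Ascent Y X → DirectedCycle
    cycle record { P = P ; start = refl ; end = refl ; step = step ; distinct = distinct } = record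
      { P = λ { zero → X ; (suc i) → P i }
      ; vertex = λ { zero → vX ; (suc zero) → vY ; (suc (suc i)) → proj₁ (proj₂ (step i)) }
      ; closed = refl
      ; distinct = λ { {zero} {zero} _ → refl
                     ; {zero} {suc j} eq → contradiction (distinct eq) fromℕ≢inject₁
                     ; {suc i} {zero} eq → contradiction (sym (distinct eq)) fromℕ≢inject₁
                     ; {suc i} {suc j} eq → cong suc (inject₁-injective (distinct eq)) }
      ; adjacent = λ { zero → adj ; (suc i) → proj₁ (proj₂ (proj₂ (step i))) }
      ; directed = λ { zero → inj₁ (Z , el , Zf) ; (suc i) → proj₂ (proj₂ (proj₂ (step i))) }
      ; strict = zero , Z , el , Zf }

  -- The sign in `⊖ X` turns the direction into an interior point: `W` is where `h` crosses the
  -- segment from `X` to `Y`. Both halves keep the same point `Z` at infinity, and neither is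
  -- separated by `h`.
  module Subdivision {A} (col : Coline A) {X Y Z : Point A} (d : Direction g X Y Z) {h} (s : Sep (vec X) (vec Y) h)
                     {W : Point A} (w : Direction h (⊖ X) Y W) where
    open OnColine col
    private
      Xh = proj₁ s
      Xh≢0 = proj₂ s
      Wh = Direction.infinite w
      W≡Y : ∀ {a} → X at a ≡ 𝟎 → Y at a ≢ 𝟎 → W at a ≡ Y at a
      W≡Y {a} Xa Ya = forwardʳ w (trans (!-neg (vec X) a) (neg-zero Xa)) Ya
      W≡X : ∀ {b} → Y at b ≡ 𝟎 → X at b ≢ 𝟎 → W at b ≡ X at b
      W≡X {b} Yb Xb = trans (forwardˡ w Yb (λ p → Xb (neg-zero⁻ (trans (sym (!-neg (vec X) b)) p))))
                              (trans (cong neg (!-neg (vec X) b)) (neg² _))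
      ahead′ : Between (vec X) (vec Y) (vec W)
      ahead′ = subst (λ V → Between V (vec Y) (vec W)) (-ᵥ² (vec X)) (Direction.ahead w)

    Xg≡Wg : X at g ≡ W at g
    Xg≡Wg = sym (trans (strictly-between w g ¬sep) (trans (!-∘ (-ᵥ (-ᵥ vec X)) (vec Y) g)
              (trans (cong₂ _∘₀_ (cong (_! g) (-ᵥ² (vec X))) (sym (Direction.agree d))) (∘-idem (X at g)))))
      where
      ∘-idem : ∀ x → x ∘₀ x ≡ x
      ∘-idem 𝟎     = refl
      ∘-idem (± _) = refl
      ¬sep : ¬ Sep (-ᵥ (-ᵥ vec X)) (vec Y) g
      ¬sep (p , _) = ≢neg (Direction.finite d) (trans (cong (_! g) (sym (-ᵥ² (vec X)))) (trans p (cong neg (sym (Direction.agree d)))))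

    firstHalf : Direction g X W Z
    firstHalf with a , Xa , Ya ← distinguish (coc X) (coc Y) (Direction.X≉Y d) =
      direction-byʳ (λ p → Xh≢0 (trans (cong (_! h) p) Wh)) Xg≡Wg (Direction.finite d) (Direction.infinite d) Xa
        (≢𝟎-resp (sym (W≡Y Xa Ya)) Ya) (trans (forwardʳ d Xa Ya) (sym (W≡Y Xa Ya)))

    secondHalf : Direction g W Y Z
    secondHalf with b , Yb , Xb ← distinguish (coc Y) (coc X) (λ p → Direction.X≉Y d (≈±-sym p)) =
      direction-byˡ (λ p → Xh≢0 (trans Xh (neg-zero (trans (cong (_! h) (sym p)) Wh))))
        (trans (sym Xg≡Wg) (Direction.agree d)) (≢𝟎-resp Xg≡Wg (Direction.finite d)) (Direction.infinite d) Yb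
        (≢𝟎-resp (sym (W≡X Yb Xb)) Xb) (trans (forwardˡ d Yb Xb) (cong neg (sym (W≡X Yb Xb))))

    first-shrinks : ∣ separator (vec X) (vec W) ∣ < ∣ separator (vec X) (vec Y) ∣
    first-shrinks = separator-shrinks (vec X) (vec Y) (vec X) (vec W) sub s λ (p , nz) → nz (trans p (neg-zero Wh))
      where
      sub : ∀ {e} → Sep (vec X) (vec W) e → Sep (vec X) (vec Y) e
      sub {e} (p , nz) with t , eq ← nonzero-± (λ We → nz (trans p (neg-zero We))) with cases ahead′ e t eq
      ... | inj₁ q = contradiction (trans p (cong neg (trans eq (sym q)))) (≢neg nz)
      ... | inj₂ q = trans p (cong neg (trans eq (sym q))) , nz

    second-shrinks : ∣ separator (vec W) (vec Y) ∣ < ∣ separator (vec X) (vec Y) ∣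
    second-shrinks = separator-shrinks (vec X) (vec Y) (vec W) (vec Y) sub s λ (_ , nz) → nz Wh
      where
      sub : ∀ {e} → Sep (vec W) (vec Y) e → Sep (vec X) (vec Y) e
      sub {e} (p , nz) with t , eq ← nonzero-± nz with cases ahead′ e t eq
      ... | inj₁ q = trans q (trans (sym eq) p) , ≡±⇒≢𝟎 q
      ... | inj₂ q = contradiction (trans (trans q (sym eq)) p) (≢neg (≡±⇒≢𝟎 q))

  -- The path is nonempty and all its edges share `Z`, so they all have the type of the whole jump;
  -- in particular a strict jump yields a strict edge.
  refine : ∀ {A} → Coline A → (X Y Z : Point A) → Direction g X Y Z → X at g ≡ ± Sign.+ →
           Acc _<_ ∣ separator (vec X) (vec Y) ∣ →
           ∃[ W ] Edge (vec Z) (vec X) W × Star (Edge (vec Z)) W (vec Y)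
  refine {A} col X Y Z d Xg (acc rec) with any? (Sep? (vec X) (vec Y))
  ... | no conformal = vec Y ,
      ((coc X , Xg) , (coc Y , trans (sym (Direction.agree d)) Xg) ,
       ((λ e s → conformal (e , s)) , record
         { cocircuitˡ = coc X ; cocircuitʳ = coc Y ; X≢Y = λ p → Direction.X≉Y d (inj₁ p) ; X≢-Y = λ p → Direction.X≉Y d (inj₂ p)
         ; isEdge = coline⇒edge (coc X) (coc Y) (Direction.X≉Y d) (Coline-mono (λ Ah → on X Ah , on Y Ah) col) }) ,
       (coc Z , Direction.infinite d , OnColine.strictly-between col d)) , ε
  ... | yes (h , s@(Xh , Xh≢0))
    with W , w ← directed (⊖ X) Y (λ p → Direction.X≉Y d (inj₂ (trans (sym (-ᵥ² (vec X))) (cong -ᵥ_ p))))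
                   (trans (!-neg (vec X) h) (trans (cong neg Xh) (neg² (Y at h))))
                   (λ p → Xh≢0 (neg-zero⁻ (trans (sym (!-neg (vec X) h)) p)))
    with W₁ , first , path₁ ← refine col X W Z (Subdivision.firstHalf col d s w) Xg (rec (Subdivision.first-shrinks col d s w))
       | W₂ , second , path₂ ← refine col W Y Z (Subdivision.secondHalf col d s w)
           (trans (sym (Subdivision.Xg≡Wg col d s w)) Xg) (rec (Subdivision.second-shrinks col d s w))
    = W₁ , first , path₁ ◅◅ (second ◅ path₂)

  private
    module _ {A} (col : Coline A) {X Y Z : Point A} (d : Direction g X Y Z) (Xg : X at g ≡ ± Sign.+)
             (Zf : Nonneg Sign.+ (Z at f)) where

      ascend : vec X ⇝ vec Y
      ascend with W , e , es ← refine col X Y Z d Xg (<-wellFounded _) = edge⇒ascent Zf e ◅ map⋆ (edge⇒ascent Zf) es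

      ascend-level : vec Y ⇝ vec X → Z at f ≡ 𝟎
      ascend-level back with W , e , es ← refine col X Y Z d Xg (<-wellFounded _) =
        [ (λ Zf → Zf) , (λ Zf → ⊥-elim (no-strict-cycle e Zf (map⋆ (edge⇒ascent (inj₂ Zf)) es ◅◅ back))) ]′ Zf

  -- Le s t X Y: a path from X to Y among the cocircuits with sign s on g, moving in direction t of f.
  Le : Sign → Sign → SignVector n → SignVector n → Set
  Le Sign.+ Sign.+ X Y = X ⇝ Y
  Le Sign.+ Sign.- X Y = Y ⇝ X
  Le Sign.- Sign.+ X Y = (-ᵥ Y) ⇝ (-ᵥ X)
  Le Sign.- Sign.- X Y = (-ᵥ X) ⇝ (-ᵥ Y)

  le-refl : ∀ s t {X} → Le s t X X
  le-refl Sign.+ Sign.+ = ε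
  le-refl Sign.+ Sign.- = ε
  le-refl Sign.- Sign.+ = ε
  le-refl Sign.- Sign.- = ε

  le-trans : ∀ s t {X Y Z} → Le s t X Y → Le s t Y Z → Le s t X Z
  le-trans Sign.+ Sign.+ p q = p ◅◅ q
  le-trans Sign.+ Sign.- p q = q ◅◅ p
  le-trans Sign.- Sign.+ p q = q ◅◅ p
  le-trans Sign.- Sign.- p q = p ◅◅ q

  le-flip : ∀ s t {X Y} → Le s (opposite t) X Y → Le s t Y X
  le-flip Sign.+ Sign.+ p = p
  le-flip Sign.+ Sign.- p = p
  le-flip Sign.- Sign.+ p = p
  le-flip Sign.- Sign.- p = p

  le-flip⁻ : ∀ s t {X Y} → Le s t Y X → Le s (opposite t) X Y
  le-flip⁻ Sign.+ Sign.+ p = p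
  le-flip⁻ Sign.+ Sign.- p = p
  le-flip⁻ Sign.- Sign.+ p = p
  le-flip⁻ Sign.- Sign.- p = p

  module _ {A} (col : Coline A) {X Y Z : Point A} (d : Direction g X Y Z) where

    private
      neg-at : ∀ (V : Point A) {h x} → V at h ≡ x → (⊖ V) at h ≡ neg x
      neg-at V {h} p = trans (!-neg (vec V) h) (cong neg p)
      neg-nonneg : ∀ (V : Point A) {t} → Nonneg t (V at f) → Nonneg (opposite t) ((⊖ V) at f)
      neg-nonneg V = map⊎ (neg-at V) (neg-at V)
      Yg : ∀ {s} → X at g ≡ ± s → Y at g ≡ ± s
      Yg Xg = trans (sym (Direction.agree d)) Xg

    le-step : ∀ s t → X at g ≡ ± s → Nonneg t (Z at f) → Le s t (vec X) (vec Y)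
    le-step Sign.+ Sign.+ Xg Zf = ascend col d Xg Zf
    le-step Sign.+ Sign.- Xg Zf = ascend col (flip-direction d) (Yg Xg) (neg-nonneg Z Zf)
    le-step Sign.- Sign.+ Xg Zf = ascend col (neg-direction (flip-direction d)) (neg-at Y (Yg Xg)) (neg-nonneg (⊖ Z) (neg-nonneg Z Zf))
    le-step Sign.- Sign.- Xg Zf = ascend col (neg-direction d) (neg-at X Xg) (neg-nonneg Z Zf)

    -- If `f` were nonzero at `Z`, the jump would refine to strict edges, which the return path
    -- closes to a directed cycle of `(O, g, f)`. Signs `-` are reduced to `+` by negating the
    -- points or reversing the jump.
    le-level : ∀ s t → X at g ≡ ± s → Nonneg t (Z at f) → Le s t (vec Y) (vec X) → Z at f ≡ 𝟎
    le-level Sign.+ Sign.+ Xg Zf back = ascend-level col d Xg Zf back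
    le-level Sign.+ Sign.- Xg Zf back = neg-zero⁻ (trans (sym (!-neg (vec Z) f))
      (ascend-level col (flip-direction d) (Yg Xg) (neg-nonneg Z Zf) back))
    le-level Sign.- Sign.+ Xg Zf back = trans (cong (_! f) (sym (-ᵥ² (vec Z))))
      (ascend-level col (neg-direction (flip-direction d)) (neg-at Y (Yg Xg)) (neg-nonneg (⊖ Z) (neg-nonneg Z Zf)) back)
    le-level Sign.- Sign.- Xg Zf back = neg-zero⁻ (trans (sym (!-neg (vec Z) f))
      (ascend-level col (neg-direction d) (neg-at X Xg) (neg-nonneg Z Zf) back))

-- Lexicographic extensions

!-tail : ∀ {n} (V : SignVector (suc n)) h → tail V ! h ≡ V ! suc h
!-tail (_ ∷ V) h = refl

≈±-trans : ∀ {n} {X Y Z : SignVector n} → X ≈± Y → Y ≈± Z → X ≈± Z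
≈±-trans (inj₁ refl) q = q
≈±-trans (inj₂ refl) (inj₁ refl) = inj₂ refl
≈±-trans {Z = Z} (inj₂ refl) (inj₂ refl) = inj₁ (-ᵥ² Z)

≈±-tail : ∀ {n} {X Y : SignVector (suc n)} → X ≈± Y → tail X ≈± tail Y
≈±-tail (inj₁ refl) = inj₁ refl
≈±-tail {Y = _ ∷ _} (inj₂ refl) = inj₂ refl

between-tail : ∀ {n} {X Y Z : SignVector (suc n)} → Between X Y Z → Between (tail X) (tail Y) (tail Z)
between-tail {X = _ ∷ _} {_ ∷ _} {_ ∷ _} b = between λ h → cases b (suc h)

tail-neg : ∀ {n} (X : SignVector (suc n)) → tail (-ᵥ X) ≡ -ᵥ tail X
tail-neg (_ ∷ _) = refl

*₀-nonzero : ∀ a {x} → x ≢ 𝟎 → a *₀ x ≢ 𝟎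
*₀-nonzero a {𝟎}   nz = nz
*₀-nonzero a {± s} _ ()

lexσ-zero : ∀ {n k} (I : Vec (Fin n) k) (α : Vec Sign k) (Y : SignVector n) →
            (∀ j → Y ! lookup I j ≡ 𝟎) → lexσ I α Y ≡ 𝟎
lexσ-zero []      []      Y zeros = refl
lexσ-zero (e ∷ I) (a ∷ α) Y zeros rewrite zeros zero = lexσ-zero I α Y λ j → zeros (suc j)

lexσ-lead : ∀ {n k} (I : Vec (Fin n) k) (α : Vec Sign k) (Y : SignVector n) i →
            (∀ j → j <ᶠ i → Y ! lookup I j ≡ 𝟎) → Y ! lookup I i ≢ 𝟎 →
            lexσ I α Y ≡ lookup α i *₀ (Y ! lookup I i)
lexσ-lead (e ∷ I) (a ∷ α) Y zero zeros nz with Y ! e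
... | 𝟎   = contradiction refl nz
... | ± s = refl
lexσ-lead (e ∷ I) (a ∷ α) Y (suc i) zeros nz rewrite zeros zero z<s =
  lexσ-lead I α Y i (λ j j<i → zeros (suc j) (s<s j<i)) nz

module Extension {n k : ℕ} (O : OrientedMatroid n) (I : Vec (Fin n) k) (α : Vec Sign k)
                 (O′ : OrientedMatroid (suc n)) (ext : IsLexExtension O I α O′) where

  open Points O′
  module M = Points O
  open IsLexExtension ext
  open IsExtension isExtension

  σ : SignVector n → Sign₀
  σ = lexσ I α

  Old : SignVector (suc n) → Set
  Old V = M.Cocircuit (tail V)

  smaller : ∀ {X Y} → Cocircuit X → Cocircuit Y → (∀ h → Y ! h ≡ 𝟎 → X ! h ≡ 𝟎) → X ≈± Y
  smaller cX cY sub = incomparable cX cY λ m → ∈supp⁺ λ Yh → ∈supp⁻ m (sub _ Yh)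

  tail-nonzero : ∀ {V} → Cocircuit V → tail V ≢ 0ᵥ
  tail-nonzero {V} cV eq with V | V ! zero ≟₀ 𝟎
  ... | 𝟎 ∷ _ | yes _ = nonzero cV (cong (𝟎 ∷_) eq)
  ... | ± s ∷ X | no _ = noColoop (_ , cV , cong (inside ∷_) (trans (cong supp eq) (supp-0 _)))
    where
    supp-0 : ∀ n → supp (0ᵥ {n}) ≡ empty
    supp-0 ℕ.zero = refl
    supp-0 (suc n) = cong (outside ∷_) (supp-0 n)
  ... | ± _ ∷ _ | yes ()
  ... | 𝟎 ∷ _ | no p = contradiction refl p

  nonzero-outside-p : ∀ {V} → Cocircuit V → ∃[ h ] V ! suc h ≢ 𝟎
  nonzero-outside-p {V} cV with h , nz ← nonzero-entry (tail-nonzero cV) = h , ≢𝟎-resp (!-tail V h) nz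

  -- Eliminating p between two cocircuits with supports in supp V contradicts the minimality of supp V.
  private
    p-unique : ∀ {V W} → Cocircuit V → Cocircuit W → V ! zero ≢ 𝟎 → (∀ h → V ! suc h ≡ 𝟎 → W ! suc h ≡ 𝟎) → V ≈± W
    p-unique {V} {W} cV cW Vp sub with ≈±-dec {X = V} {W}
    ... | yes p = p
    ... | no V≉W with Z , Zp ← meet {λ h → V ! h ≡ 𝟎 × W ! h ≡ 𝟎} (point V cV proj₁) (point W cW proj₂) V≉W zero =
      contradiction (≈±-zero′ (smaller (coc Z) cV λ { zero Vp₀ → contradiction Vp₀ Vp ; (suc h) Vh → on Z (Vh , sub h Vh) }) Zp) Vp

  off-p⇒old : ∀ {V} → Cocircuit V → V ! zero ≢ 𝟎 → Old V
  off-p⇒old {V@(s ∷ Y)} cV Vp = Equivalence.from (deletion (tail V)) (tail-nonzero cV , (_ , cV) , minimal)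
    where
    minimal : ∀ {t Y′} → Cocircuit (t ∷ Y′) → Y′ ≢ 0ᵥ → supp Y′ ⊆ supp Y → supp Y ⊆ supp Y′
    minimal {t} {Y′} cY′ _ sub {h} h∈ = ∈supp⁺ λ Y′h → ∈supp⁻ h∈ (≈±-zero {h = suc h} (p-unique cV cY′ Vp
      λ h Yh → decidable-stable (Y′ ! h ≟₀ 𝟎) λ nz → ∈supp⁻ (sub (∈supp⁺ nz)) Yh) Y′h)

  lift-cocircuit : ∀ {Y} → M.Cocircuit Y → Cocircuit (σ Y ∷ Y)
  lift-cocircuit = localization

  old-σ : ∀ {V} → Cocircuit V → Old V → V ! zero ≡ σ (tail V)
  old-σ {V@(s ∷ Y)} cV old with V ! zero ≟₀ 𝟎
  ... | yes Vp = trans Vp (sym (≈±-zero′ {h = zero} (smaller cV (lift-cocircuit old)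
                   λ { zero _ → Vp ; (suc h) Yh → Yh }) Vp))
  ... | no Vp with p-unique cV (lift-cocircuit old) Vp (λ h Yh → Yh)
  ...   | inj₁ eq = cong head eq
  ...   | inj₂ eq = ⊥-elim (M.nonzero old (!-ext λ h → trans (self-opposite (trans (cong (_! suc h) eq) (!-neg Y h))) (sym (!-0 h))))
    where
    self-opposite : ∀ {x} → x ≡ neg x → x ≡ 𝟎
    self-opposite {𝟎} _ = refl
    self-opposite {± Sign.+} ()
    self-opposite {± Sign.-} ()

  on-hyperplane : ∀ {V} → Cocircuit V → ¬ Old V → V ! zero ≡ 𝟎
  on-hyperplane {V} cV new = decidable-stable (V ! zero ≟₀ 𝟎) λ Vp → new (off-p⇒old cV Vp)

  -- The restriction of `V` is nonzero but not a cocircuit of the deletion, so its support is not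
  -- minimal. A cocircuit showing this cannot vanish at `p`, or it would lie below `V` in `O′`
  -- itself.
  new-smaller : ∀ {V} → Cocircuit V → ¬ Old V → ∃[ U ] Cocircuit U × U ! zero ≢ 𝟎 × (∀ h → V ! suc h ≡ 𝟎 → U ! suc h ≡ 𝟎)
  new-smaller {V@(s ∷ Y)} cV new with any-signVector? (λ U → cocircuit? U ×-dec ¬? (U ! zero ≟₀ 𝟎) ×-dec
                                        all? (λ h → (V ! suc h ≟₀ 𝟎) →-dec (U ! suc h ≟₀ 𝟎)))
  ... | yes p = p
  ... | no none = contradiction (Equivalence.from (deletion Y) (tail-nonzero cV , (_ , cV) , minimal)) new
    where
    minimal : ∀ {t Y′} → Cocircuit (t ∷ Y′) → Y′ ≢ 0ᵥ → supp Y′ ⊆ supp Y → supp Y ⊆ supp Y′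
    minimal {± t} {Y′} cY′ _ sub = contradiction
      (_ , cY′ , (λ ()) , λ h Yh → decidable-stable (Y′ ! h ≟₀ 𝟎) λ nz → ∈supp⁻ (sub (∈supp⁺ nz)) Yh) none
    minimal {𝟎} {Y′} cY′ _ sub {h} h∈ = ∈supp⁺ λ Y′h → ∈supp⁻ h∈ (≈±-zero′ {h = suc h} (smaller cY′ cV
      λ { zero _ → refl ; (suc h) Yh → decidable-stable (Y′ ! h ≟₀ 𝟎) λ nz → ∈supp⁻ (sub (∈supp⁺ nz)) Yh }) Y′h)

  old? : ∀ V → Dec (Old V)
  old? V = M.cocircuit? (tail V)

  e : Fin k → Fin (suc n)
  e i = suc (lookup I i)

  old-lead : ∀ {V} → Cocircuit V → Old V → ∀ i → (∀ j → j <ᶠ i → V ! e j ≡ 𝟎) → V ! e i ≢ 𝟎 →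
             V ! zero ≡ lookup α i *₀ (V ! e i)
  old-lead {V} cV old i zeros nz = trans (old-σ cV old) (trans
    (lexσ-lead I α (tail V) i (λ j j<i → trans (!-tail V _) (zeros j j<i)) (≢𝟎-resp (sym (!-tail V _)) nz))
    (cong (lookup α i *₀_) (!-tail V _)))

  all-zero⇒on-p : ∀ {V} → Cocircuit V → (∀ j → V ! e j ≡ 𝟎) → V ! zero ≡ 𝟎
  all-zero⇒on-p {V} cV zeros = decidable-stable (V ! zero ≟₀ 𝟎) λ Vp →
    Vp (trans (old-σ cV (off-p⇒old cV Vp)) (lexσ-zero I α (tail V) λ j → trans (!-tail V _) (zeros j)))

  First : Fin k → SignVector (suc n) → Set
  First i V = (∀ j → j <ᶠ i → V ! e j ≡ 𝟎) × V ! e i ≢ 𝟎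

  first? : ∀ V → (∀ j → V ! e j ≡ 𝟎) ⊎ ∃ λ i → First i V
  first? V with all? (λ j → V ! e j ≟₀ 𝟎)
  ... | yes zeros = inj₁ zeros
  ... | no ¬zeros = inj₂ (search k e ¬zeros)
    where
    search : ∀ k (e : Fin k → Fin (suc n)) → ¬ (∀ j → V ! e j ≡ 𝟎) →
             ∃ λ i → (∀ j → j <ᶠ i → V ! e j ≡ 𝟎) × V ! e i ≢ 𝟎
    search ℕ.zero e nz = contradiction (λ ()) nz
    search (suc k) e nz with V ! e zero ≟₀ 𝟎
    ... | no nz₀ = zero , (λ _ ()) , nz₀
    ... | yes z₀ with i , zeros , nzᵢ ← search k (e ∘′ suc) (λ all → nz λ { zero → z₀ ; (suc j) → all j }) =
      suc i , (λ { zero _ → z₀ ; (suc j) (s<s j<i) → zeros j j<i }) , nzᵢ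

  old-on-p : ∀ {V} → Cocircuit V → Old V → V ! zero ≡ 𝟎 → ∀ j → V ! e j ≡ 𝟎
  old-on-p {V} cV old Vp j with first? V
  ... | inj₁ zeros = zeros j
  ... | inj₂ (i , zeros , nz) = contradiction (trans (sym (old-lead cV old i zeros nz)) Vp) (*₀-nonzero (lookup α i) nz)

  -- A consists of elements of O, so the line descends to O.
  module Off {A : Elements} (col : Coline A) (p∉A : ¬ A zero) where
    open OnColine col

    private
      new-point : (V : Point A) → ¬ Old (vec V) → Σ (Point A) λ U → U at zero ≢ 𝟎 × (∀ h → V at suc h ≡ 𝟎 → U at suc h ≡ 𝟎)
      new-point V new with U , cU , Up , sub ← new-smaller (coc V) new =
        point U cU (λ { {zero} Ap → contradiction Ap p∉A ; {suc h} Ah → sub h (on V Ah) }) , Up , sub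

    -- On an old line a new point lies on no element of `E` that crosses the line: the point `U` off
    -- `p` from `new-smaller` would lie on it too and so coincide with `V`.
    new-generic : (V Q : Point A) → ¬ Old (vec V) → ∀ {h} → Q at suc h ≢ 𝟎 → V at suc h ≢ 𝟎
    new-generic V Q new {h} Qh Vh with U , Up , sub ← new-point V new =
      Up (≈±-zero (col U V Q (suc h) (sub h Vh) Vh Qh) (on-hyperplane (coc V) new))

    -- The hyperplane p meets the line A close to the point Z₁ where the leading element e i does.
    module Near (i : Fin k) (pre : ∀ j → j <ᶠ i → A (e j)) (Q : Point A) (Qe : Q at e i ≢ 𝟎) where

      private
        lead : (V : Point A) → Old (vec V) → V at e i ≢ 𝟎 → V at zero ≡ lookup α i *₀ (V at e i)
        lead V old = old-lead (coc V) old i λ j j<i → on V (pre j j<i)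

        off-p : Σ (Point A) λ U → U at zero ≢ 𝟎
        off-p with old? (vec Q)
        ... | yes old = Q , λ Qp → *₀-nonzero (lookup α i) Qe (trans (sym (lead Q old Qe)) Qp)
        ... | no new with U , Up , _ ← new-point Q new = U , Up

      module _ (Z Z₁ : Point A) (Zp : Z at zero ≡ 𝟎) (Z₁e : Z₁ at e i ≡ 𝟎)
               {a} (Za : Z at suc a ≡ Z₁ at suc a) (Za≢0 : Z at suc a ≢ 𝟎) where

        private
          coincide : Z₁ at zero ≡ 𝟎 → vec Z ≡ vec Z₁
          coincide Z₁p with U , Up ← off-p = ≈±-agree (col Z Z₁ U zero Zp Z₁p Up) Za≢0 Za

          module _ (Z₁p : Z₁ at zero ≢ 𝟎) where
            Ze : Z at e i ≢ 𝟎
            Ze Ze₀ = Z₁p (≈±-zero′ (col Z Z₁ Q (e i) Ze₀ Z₁e Qe) Zp)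

            new : ¬ Old (vec Z)
            new old = *₀-nonzero (lookup α i) Ze (trans (sym (lead Z old Ze)) Zp)

            Z≉Z₁ : ¬ vec Z ≈± vec Z₁
            Z≉Z₁ eq = Z₁p (≈±-zero′ eq Zp)

            module _ (S W : Point A) (S≈Z₁ : vec S ≈± vec Z₁) {h} (Zh : Z at h ≢ 𝟎) (Z₁h : Z₁ at h ≢ 𝟎)
                     (Wh : W at h ≡ 𝟎) (b : Between (vec S) (vec Z) (vec W)) where
              -- The lexicographic rule is applied to `W`, which inherits `p` from `S` because `Z`
              -- is on `p`, and the leading element from `Z` because `S` is on `e i`.
              formula : S at zero ≡ lookup α i *₀ (Z at e i)
              formula = trans (sym (betweenˡ b Zp Wp)) (trans (lead W (off-p⇒old (coc W) Wp) We)
                          (cong (lookup α i *₀_) (betweenʳ b (≈±-zero S≈Z₁ Z₁e) We)))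
                where
                Wp : W at zero ≢ 𝟎
                Wp p = Zh (≈±-zero′ (col W Z Z₁ zero p Zp Z₁p) Wh)
                We : W at e i ≢ 𝟎
                We p = Z₁h (≈±-zero′ (col W Z₁ Z (e i) p Z₁e Ze) Wh)

        near-p : lookup α i *₀ (Z at e i) ≡ neg (Z₁ at zero)
        near-p with Z₁ at zero ≟₀ 𝟎
        ... | yes Z₁p = trans (cong (lookup α i *₀_) (trans (cong (_! e i) (coincide Z₁p)) Z₁e)) (sym (neg-zero Z₁p))
        ... | no Z₁p with W , Wa , b ← eliminate⁻ Z₁ Z (λ eq → Z≉Z₁ Z₁p (inj₁ (sym eq))) (sym Za) (≢𝟎-resp Za Za≢0) =
          trans (sym (formula Z₁p (⊖ Z₁) W (inj₂ refl) Za≢0 (≢𝟎-resp Za Za≢0) Wa b)) (!-neg (vec Z₁) zero)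

        near : ∀ {h} → Z₁ at suc h ≢ 𝟎 → Z at suc h ≡ Z₁ at suc h
        near {h} Z₁h with Z₁ at zero ≟₀ 𝟎
        ... | yes Z₁p = cong (_! suc h) (coincide Z₁p)
        ... | no Z₁p with same-or-opposite (new-generic Z Z₁ (new Z₁p) Z₁h) Z₁h
        ...   | inj₁ eq = eq
        -- A disagreement at `h` would allow elimination with `Z₁` instead of `⊖ Z₁`, and `formula`
        -- would then contradict `near-p`.
        ...   | inj₂ eq with W , Wh , b ← eliminate Z₁ Z (λ p → Z≉Z₁ Z₁p (≈±-sym (inj₂ p)))
                              (trans (sym (neg² _)) (cong neg (sym eq))) Z₁h =
          ⊥-elim (≢neg Z₁p (trans (formula Z₁p Z₁ W (inj₁ refl) (new-generic Z Z₁ (new Z₁p) Z₁h) Z₁h Wh b) near-p))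

    A↓ : Fin n → Set
    A↓ h = A (suc h)

    up : M.Point A↓ → Point A
    up (M.point Y cY o) = point (σ Y ∷ Y) (lift-cocircuit cY) λ { {zero} Ap → contradiction Ap p∉A ; {suc h} Ah → o Ah }

    col↓ : M.Coline A↓
    col↓ X Y U h Xh Yh Uh = ≈±-tail (col (up X) (up Y) (up U) (suc h) Xh Yh Uh)

    down : (X : Point A) → Old (vec X) → M.Point A↓
    down X old = M.point (tail (vec X)) old λ Ah → trans (!-tail (vec X) _) (on X Ah)

    module _ {g : Fin n} {X Y Z : Point A} (d : Direction (suc g) X Y Z) where
      open Direction d

      old-direction : Old (vec Z)
      old-direction = decidable-stable (old? (vec Z)) λ new → new-generic Z X new finite infinite

      direction↓ : (oX : Old (vec X)) (oY : Old (vec Y)) (oZ : Old (vec Z)) → M.Direction g (down X oX) (down Y oY) (down Z oZ)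
      direction↓ oX oY oZ = M.direction
        (λ eq → distinct (tails (trans (old-σ (coc X) oX) (trans (cong σ eq) (sym (old-σ (coc Y) oY)))) eq))
        (trans (!-tail (vec X) g) (trans agree (sym (!-tail (vec Y) g))))
        (λ p → finite (trans (sym (!-tail (vec X) g)) p))
        (trans (!-tail (vec Z) g) infinite)
        (subst (λ V → Between V _ _) (tail-neg (vec X)) (between-tail ahead))
        where
        tails : ∀ {V W : SignVector (suc n)} → V ! zero ≡ W ! zero → tail V ≡ tail W → V ≡ W
        tails {_ ∷ _} {_ ∷ _} = cong₂ _∷_

  module _ (euclidean : M.Euclidean) (g f : Fin n) where
    open Levels O euclidean g f

    module _ {A} (col : Coline A) (p∉A : ¬ A zero) {X Y Z : Point A} (d : Direction (suc g) X Y Z)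
             (oX : Old (vec X)) (oY : Old (vec Y)) s t (Xg : X at suc g ≡ ± s) (Zf : Nonneg t (Z at suc f)) where
      private
        oZ = Off.old-direction col p∉A d
        d↓ = Off.direction↓ col p∉A d oX oY oZ

      le-step′ : Le s t (tail (vec X)) (tail (vec Y))
      le-step′ = le-step (Off.col↓ col p∉A) d↓ s t (trans (!-tail (vec X) g) Xg) (map⊎ (trans (!-tail (vec Z) f)) (trans (!-tail (vec Z) f)) Zf)

      le-level′ : Le s t (tail (vec Y)) (tail (vec X)) → Z at suc f ≡ 𝟎
      le-level′ back = trans (sym (!-tail (vec Z) f)) (le-level (Off.col↓ col p∉A) d↓ s t (trans (!-tail (vec X) g) Xg)
                         (map⊎ (trans (!-tail (vec Z) f)) (trans (!-tail (vec Z) f)) Zf) back)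

-- The order of the signs x and y in direction t, where − < 0 < +.
Mono : Sign → Sign₀ → Sign₀ → Set
Mono t x y = (x ≡ ± t → y ≡ ± t) × (y ≡ ± (opposite t) → x ≡ ± (opposite t))

mono-refl : ∀ {t x} → Mono t x x
mono-refl = (λ p → p) , (λ p → p)

mono-trans : ∀ {t x y w} → Mono t x y → Mono t y w → Mono t x w
mono-trans (p , q) (p′ , q′) = p′ ∘′ p , q ∘′ q′

mono-antisym : ∀ t {x y} → Mono t x y → Mono t y x → x ≡ y
mono-antisym t {x} {y} (p , q) (p′ , q′) with x ≟₀ ± t | x ≟₀ ± (opposite t) | y ≟₀ ± t | y ≟₀ ± (opposite t)
... | yes r | _ | _ | _ = trans r (sym (p r))
... | _ | yes r | _ | _ = trans r (sym (q′ r))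
... | _ | _ | yes r | _ = trans (p′ r) (sym r)
... | _ | _ | _ | yes r = trans (q r) (sym r)
... | no a | no b | no c | no d = trans (zero-sign a b) (sym (zero-sign c d))
  where
  zero-sign : ∀ {t x} → x ≢ ± t → x ≢ ± (opposite t) → x ≡ 𝟎
  zero-sign {_} {𝟎} _ _ = refl
  zero-sign {Sign.+} {± Sign.+} a _ = contradiction refl a
  zero-sign {Sign.+} {± Sign.-} _ b = contradiction refl b
  zero-sign {Sign.-} {± Sign.+} _ b = contradiction refl b
  zero-sign {Sign.-} {± Sign.-} a _ = contradiction refl a

nonneg-cases : ∀ {t x} → (x ≢ 𝟎 → Nonneg t x) → Nonneg t x
nonneg-cases {x = 𝟎} _ = inj₁ refl
nonneg-cases {x = ± s} p = p λ ()

-- Where the first element is nonzero it decides the value, so it has direction `a Sign.* t` at all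
-- `Zs` at once. By hypothesis it then vanishes at all of them, and the next element takes over.
lexσ-level : ∀ {n k m} (Zs : Fin m → SignVector n) →
             (∀ h t → (∀ i → Nonneg t (Zs i ! h)) → ∀ i → Zs i ! h ≡ 𝟎) →
             (I : Vec (Fin n) k) (α : Vec Sign k) → ∀ t →
             (∀ i → Nonneg t (lexσ I α (Zs i))) → ∀ i → lexσ I α (Zs i) ≡ 𝟎
lexσ-level Zs level [] [] t nonneg i = refl
lexσ-level Zs level (e ∷ I) (a ∷ α) t nonneg i =
  trans (skip i) (lexσ-level Zs level I α t (λ j → subst (Nonneg t) (skip j) (nonneg j)) i)
  where
  unscale : ∀ a {x r} → Nonneg t ((a *₀ x) ∘₀ r) → Nonneg (a Sign.* t) x
  unscale a {𝟎} _ = inj₁ refl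
  unscale Sign.+ {± s} (inj₂ eq) = inj₂ eq
  unscale Sign.- {± s} (inj₂ eq) = inj₂ (trans (cong ± (sym (opposite² s))) (cong neg eq))
  skip : ∀ j → (a *₀ (Zs j ! e)) ∘₀ lexσ I α (Zs j) ≡ lexσ I α (Zs j)
  skip j rewrite level e (a Sign.* t) (λ i → unscale a (nonneg i)) j = refl

-- With e parallel to f along a line, a sign condition on f at Z becomes one on e, and so on p at Z₁.
transfer-sign : ∀ a s t u {Ze Zf Z₁p} → Ze ≡ 𝟎 ⊎ (Ze ≡ ± s × Zf ≡ ± u) ⊎ (Ze ≡ neg (± s) × Zf ≡ neg (± u)) →
                Nonneg t Zf → a *₀ Ze ≡ neg Z₁p → Nonneg (opposite ((a Sign.* s) Sign.* (t Sign.* u))) Z₁p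
transfer-sign a s t u (inj₁ refl) _ eq = inj₁ (neg-zero⁻ (sym eq))
transfer-sign a s t u (inj₂ (inj₁ (refl , refl))) (inj₂ refl) eq = inj₂ (trans (neg-≡ (sym eq)) (cong neg (compute a s t)))
  where
  compute : ∀ a s t → ± (a Sign.* s) ≡ ± ((a Sign.* s) Sign.* (t Sign.* t))
  compute Sign.+ Sign.+ Sign.+ = refl
  compute Sign.+ Sign.+ Sign.- = refl
  compute Sign.+ Sign.- Sign.+ = refl
  compute Sign.+ Sign.- Sign.- = refl
  compute Sign.- Sign.+ Sign.+ = refl
  compute Sign.- Sign.+ Sign.- = refl
  compute Sign.- Sign.- Sign.+ = refl
  compute Sign.- Sign.- Sign.- = refl
transfer-sign a s t u (inj₂ (inj₂ (refl , refl))) (inj₂ refl) eq = inj₂ (trans (neg-≡ (sym eq)) (cong neg (compute a s u)))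
  where
  compute : ∀ a s u → ± (a Sign.* opposite s) ≡ ± ((a Sign.* s) Sign.* (opposite u Sign.* u))
  compute Sign.+ Sign.+ Sign.+ = refl
  compute Sign.+ Sign.+ Sign.- = refl
  compute Sign.+ Sign.- Sign.+ = refl
  compute Sign.+ Sign.- Sign.- = refl
  compute Sign.- Sign.+ Sign.+ = refl
  compute Sign.- Sign.+ Sign.- = refl
  compute Sign.- Sign.- Sign.+ = refl
  compute Sign.- Sign.- Sign.- = refl

-- Programs involving p

module Cycle {n} (O : OrientedMatroid n) {g f : Fin n} (cycle : OrientedMatroid.Graph.DirectedCycle O g f) where
  open Points O
  open Rank O
  open Graph.DirectedCycle cycle public using (m; P; closed)
  private module DC = Graph.DirectedCycle cycle

  from to : Fin m → SignVector n
  from i = P (inject₁ i)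
  to i = P (suc i)

  Line : Fin m → Elements
  Line i = Common (from i) (to i)

  line : ∀ i → Coline (Line i)
  line i = edge⇒coline (Comodular.isEdge (proj₂ (DC.adjacent i)))

  conformal : ∀ i → Conformal (from i) (to i)
  conformal i = proj₁ (DC.adjacent i)

  on-g : ∀ i → P i ! g ≡ ± Sign.+
  on-g i = proj₂ (DC.vertex i)

  cocircuit : ∀ i → Cocircuit (P i)
  cocircuit i = proj₁ (DC.vertex i)

  X Y : ∀ i → Point (Line i)
  X i = point (from i) (cocircuit _) proj₁
  Y i = point (to i) (cocircuit _) proj₂

  private
    elimination-between : ∀ {X Y Z : SignVector n} → IsElimination g X Y Z → Between X Y Z
    elimination-between {X} {Y} {Z} (_ , _ , off-sep) = between cases′
      where
      cases′ : ∀ h s → Z ! h ≡ ± s → X ! h ≡ ± s ⊎ Y ! h ≡ ± s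
      cases′ h s Zh with Separation.Sep? X Y h
      ... | no ¬sep = pick (X ! h) (trans (sym Zh) (trans (off-sep h ¬sep) (!-∘ X Y h)))
        where
        pick : ∀ x → ± s ≡ x ∘₀ (Y ! h) → x ≡ ± s ⊎ Y ! h ≡ ± s
        pick 𝟎 eq = inj₂ (sym eq)
        pick (± _) eq = inj₁ (sym eq)
      ... | yes (sep , nz) with same-or-opposite nz (λ ())
      ...   | inj₁ eq = inj₁ eq
      ...   | inj₂ eq = inj₂ (trans (sym (neg² _)) (trans (cong neg (trans (sym sep) eq)) (neg² (± s))))

    arrow : ∀ i {Z} → IsElimination g (-ᵥ from i) (to i) Z → Σ (Point (Line i)) λ Z′ → Direction g (X i) (Y i) Z′ × vec Z′ ≡ Z
    arrow i {Z} el = Zᵢ , direction (Comodular.X≢Y (proj₂ (DC.adjacent i))) (trans (on-g _) (sym (on-g _))) (≡±⇒≢𝟎 (on-g _)) (proj₁ (proj₂ el)) b , refl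
      where
      b = elimination-between el
      Zᵢ = point Z (proj₁ el) λ (Xh , Yh) → between-zero b (trans (!-neg (from i) _) (neg-zero Xh)) Yh

    abstract
      chosen : ∀ i → Σ (Point (Line i)) λ Z → Direction g (X i) (Y i) Z × Nonneg Sign.+ (Z at f)
      chosen i with DC.directed i
      ... | inj₁ (_ , el , Zf) with Z , d , refl ← arrow i el = Z , d , inj₂ Zf
      ... | inj₂ (_ , el , Zf) with Z , d , refl ← arrow i el = Z , d , inj₁ Zf

  Z : ∀ i → Point (Line i)
  Z i = proj₁ (chosen i)

  dir : ∀ i → Direction g (X i) (Y i) (Z i)
  dir i = proj₁ (proj₂ (chosen i))

  Z-f : ∀ i → Nonneg Sign.+ (Z i at f)
  Z-f i = proj₂ (proj₂ (chosen i))

  abstract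
    -- The chosen `Z i` need not be the elimination that witnesses strictness, but the two agree up
    -- to sign.
    not-level : ¬ (∀ i → Z i at f ≡ 𝟎)
    not-level level with i , _ , el , Zf ← DC.strict with Z′ , d , refl ← arrow i el =
      ≡±⇒≢𝟎 Zf (≈±-zero (OnColine.direction-unique (line i) (dir i) Z′ (Direction.infinite d)) (level i))

    f-constant : ∀ i j → P i ! f ≡ P j ! f
    f-constant i j = mono-antisym Sign.+ (mono i j) (mono j i)
      where
      mono : ∀ i j → Mono Sign.+ (P i ! f) (P j ! f)
      mono = cyclic (λ V W → Mono Sign.+ (V ! f) (W ! f)) (λ {V} → mono-refl {x = V ! f})
               (λ {V} {W} {U} → mono-trans {x = V ! f} {W ! f} {U ! f}) P closed
               λ i → OnColine.sign-forward (line i) (dir i) (Z-f i) , OnColine.sign-backward (line i) (dir i) (Z-f i)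

    f-nonzero : ∀ i → P i ! f ≢ 𝟎
    f-nonzero i Pf = not-level λ j → between-zero (Direction.ahead (dir j))
      (trans (!-neg (from j) f) (neg-zero (trans (f-constant _ i) Pf))) (trans (f-constant _ i) Pf)

module Boundary {n k : ℕ} (O : OrientedMatroid n) (I : Vec (Fin n) k) (α : Vec Sign k)
                (O′ : OrientedMatroid (suc n)) (ext : IsLexExtension O I α O′)
                (euclidean : OrientedMatroid.Euclidean O) where
  open Extension O I α O′ ext
  open Points O′

  first-unique : ∀ {i j V} → First i V → First j V → i ≡ j
  first-unique {i} {j} (zeros , nz) (zeros′ , nz′) with <ᶠ-cmp i j
  ... | tri< i<j _ _ = contradiction (zeros′ i i<j) nz
  ... | tri≈ _ i≡j _ = i≡j
  ... | tri> _ _ j<i = contradiction (zeros j j<i) nz′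

  abstract
    -- Counted from zero, hence one less than the usual index, with `k` if all elements of `I`
    -- vanish.
    index : SignVector (suc n) → ℕ
    index V with first? V
    ... | inj₁ _ = k
    ... | inj₂ (i , _) = toℕ i

    index-first : ∀ {i V} → First i V → index V ≡ toℕ i
    index-first {i} {V} fst with first? V
    ... | inj₁ zeros = contradiction (zeros i) (proj₂ fst)
    ... | inj₂ (j , fst′) = cong toℕ (first-unique {V = V} fst′ fst)

  first-off-p : ∀ {V} → Cocircuit V → V ! zero ≢ 𝟎 → ∃ λ i → First i V
  first-off-p {V} cV Vp with first? V
  ... | inj₁ zeros = contradiction (all-zero⇒on-p cV zeros) Vp
  ... | inj₂ p = p

  f-is-p : ∀ {g} → ¬ Graph.DirectedCycle (suc g) zero
  f-is-p {g} cycle = not-level λ i → trans (old-σ (coc (Z i)) (old-Z i))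
      (lexσ-level (λ i → tail (vec (Z i))) level I α Sign.+
        (λ i → subst (Nonneg Sign.+) (old-σ (coc (Z i)) (old-Z i)) (Z-f i)) i)
    where
    open Cycle O′ cycle
    old : ∀ i → Old (P i)
    old i = off-p⇒old (cocircuit i) (f-nonzero i)
    p∉ : ∀ i → ¬ Line i zero
    p∉ i (Xp , _) = f-nonzero _ Xp
    old-Z : ∀ i → Old (vec (Z i))
    old-Z i = Off.old-direction (line i) (p∉ i) (dir i)
    level : ∀ h t → (∀ i → Nonneg t (tail (vec (Z i)) ! h)) → ∀ i → tail (vec (Z i)) ! h ≡ 𝟎
    level h t nonneg i = trans (!-tail (vec (Z i)) h) (le-level′ euclidean g h (line i) (p∉ i) (dir i) (old _) (old _) Sign.+ t (on-g _) (nn i)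
        (cyclic (λ V W → L.Le Sign.+ t (tail V) (tail W)) (L.le-refl Sign.+ t) (L.le-trans Sign.+ t) P closed
          (λ i → le-step′ euclidean g h (line i) (p∉ i) (dir i) (old _) (old _) Sign.+ t (on-g _) (nn i)) _ _))
      where
      module L = Levels O euclidean g h
      nn : ∀ i → Nonneg t (Z i at suc h)
      nn i = subst (Nonneg t) (!-tail (vec (Z i)) h) (nonneg i)

  g-is-p : ∀ {f} → ¬ Graph.DirectedCycle zero (suc f)
  g-is-p {f} cycle = not-level Zf-zero
    where
    open Cycle O′ cycle
    p≢0 : ∀ i → P i ! zero ≢ 𝟎
    p≢0 i = ≡±⇒≢𝟎 (on-g i)
    old : ∀ i → Old (P i)
    old i = off-p⇒old (cocircuit i) (p≢0 i)
    p∉ : ∀ i → ¬ Line i zero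
    p∉ i (Xp , _) = p≢0 _ Xp
    abstract
      witness : ∀ i → ∃[ a ] X i at suc a ≡ 𝟎 × Y i at suc a ≢ 𝟎
      witness i with distinguish (coc (X i)) (coc (Y i)) (Direction.X≉Y (dir i))
      ... | zero , Xp , _ = contradiction Xp (p≢0 _)
      ... | suc a , Xa , Ya = a , Xa , Ya
      witness′ : ∀ i → ∃[ a ] Y i at suc a ≡ 𝟎 × X i at suc a ≢ 𝟎
      witness′ i with distinguish (coc (Y i)) (coc (X i)) (λ p → Direction.X≉Y (dir i) (≈±-sym p))
      ... | zero , Yp , _ = contradiction Yp (p≢0 _)
      ... | suc a , Ya , Xa = a , Ya , Xa

    module _ (i : Fin m) where
      open OnColine (line i)

      -- The first element of `I` that matters on this line is `e a`, and it meets the line at `Y`;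
      -- so `p` meets it near `Y`.
      up-index : ∀ {a b} → First a (from i) → First b (to i) → a <ᶠ b → Z i at suc f ≡ Y i at suc f
      up-index {a} {b} (zeros , nz) (zeros′ , _) a<b with c , Xc , Yc ← witness i =
        Off.Near.near (line i) (p∉ i) a (λ j j<a → zeros j j<a , zeros′ j (<-trans j<a a<b)) (X i) nz
          (Z i) (Y i) (Direction.infinite (dir i)) (zeros′ a a<b) (forwardʳ (dir i) Xc Yc)
          (≢𝟎-resp (sym (forwardʳ (dir i) Xc Yc)) Yc) (f-nonzero _)

      down-index : ∀ {a b} → First a (from i) → First b (to i) → b <ᶠ a → Z i at suc f ≡ neg (X i at suc f)
      down-index {a} {b} (zeros , _) (zeros′ , nz) b<a with c , Yc , Xc ← witness′ i =
        trans (Off.Near.near (line i) (p∉ i) b (λ j j<b → zeros j (<-trans j<b b<a) , zeros′ j j<b) (Y i) nz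
          (Z i) (⊖ X i) (Direction.infinite (dir i)) (trans (!-neg (from i) _) (neg-zero (zeros b b<a)))
          (trans (forwardˡ (dir i) Yc Xc) (sym (!-neg (from i) _)))
          (≢𝟎-resp (sym (forwardˡ (dir i) Yc Xc)) (neg-≢𝟎 Xc)) (λ p → f-nonzero _ (neg-zero⁻ (trans (sym (!-neg (from i) _)) p))))
          (!-neg (from i) _)

    abstract
      first : ∀ i → ∃ λ a → First a (P i)
      first i = first-off-p (cocircuit i) (p≢0 i)

    -- `f` has one nonzero sign on the whole cycle while `Z` is nonnegative at `f`. If that sign is
    -- `+` the index never falls, if it is `-` it never rises; on a closed walk it is constant.
    index-const : ∀ i j → index (P i) ≡ index (P j)
    index-const i j with t , eq ← nonzero-± (f-nonzero i) = ≤-antisym (all-≤ t eq i j) (all-≤ t eq j i)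
      where
      step-up : P i ! suc f ≡ ± Sign.+ → ∀ l → index (from l) ≤ index (to l)
      step-up eq l with a , fa ← first (inject₁ l) | b , fb ← first (suc l) = subst₂ _≤_ (sym (index-first fa)) (sym (index-first fb))
        (≮⇒≥ λ b<a → absurd (subst (Nonneg Sign.+) (trans (down-index l fa fb b<a) (cong neg (trans (f-constant _ i) eq))) (Z-f l)))
        where
        absurd : ¬ Nonneg Sign.+ (± Sign.-)
        absurd (inj₁ ())
        absurd (inj₂ ())
      step-down : P i ! suc f ≡ ± Sign.- → ∀ l → index (to l) ≤ index (from l)
      step-down eq l with a , fa ← first (inject₁ l) | b , fb ← first (suc l) = subst₂ _≤_ (sym (index-first fb)) (sym (index-first fa))
        (≮⇒≥ λ a<b → absurd (subst (Nonneg Sign.+) (trans (up-index l fa fb a<b) (trans (f-constant _ i) eq)) (Z-f l)))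
        where
        absurd : ¬ Nonneg Sign.+ (± Sign.-)
        absurd (inj₁ ())
        absurd (inj₂ ())
      all-≤ : ∀ t → P i ! suc f ≡ ± t → ∀ a b → index (P a) ≤ index (P b)
      all-≤ Sign.+ eq = cyclic (λ V W → index V ≤ index W) ≤-refl ≤-trans P closed (step-up eq)
      all-≤ Sign.- eq a b = cyclic (λ V W → index W ≤ index V) ≤-refl (λ p q → ≤-trans q p) P closed (step-down eq) b a

    lead : Fin k
    lead = proj₁ (first zero)

    first-lead : ∀ i → First lead (P i)
    first-lead i with a , fa ← first i =
      subst (λ a → First a (P i)) (toℕ-injective (trans (sym (index-first fa)) (trans (index-const i zero) (index-first (proj₂ (first zero)))))) fa

    a : Sign
    a = lookup α lead

    lead-sign : ∀ i → P i ! e lead ≡ ± a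
    lead-sign i = unscale a (trans (sym (old-lead (cocircuit i) (old i) lead (proj₁ (first-lead i)) (proj₂ (first-lead i)))) (on-g i))
      where
      unscale : ∀ a {x} → a *₀ x ≡ ± Sign.+ → x ≡ ± a
      unscale Sign.+ {± Sign.+} _ = refl
      unscale Sign.- {± Sign.-} _ = refl

    abstract
      Z₁-dir : ∀ i → Σ (Point (Line i)) (Direction (e lead) (X i) (Y i))
      Z₁-dir i = directed (X i) (Y i) (Direction.distinct (dir i)) (trans (lead-sign _) (sym (lead-sign _))) (≡±⇒≢𝟎 (lead-sign _))

    Z₁ : ∀ i → Point (Line i)
    Z₁ i = proj₁ (Z₁-dir i)

    old-Z₁ : ∀ i → Old (vec (Z₁ i))
    old-Z₁ i = Off.old-direction (line i) (p∉ i) (proj₂ (Z₁-dir i))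

    module _ (i : Fin m) where
      private
        c = proj₁ (witness i)
        Xc = proj₁ (proj₂ (witness i))
        Yc = proj₂ (proj₂ (witness i))
        Zc : Z i at suc c ≡ Z₁ i at suc c
        Zc = trans (OnColine.forwardʳ (line i) (dir i) Xc Yc) (sym (OnColine.forwardʳ (line i) (proj₂ (Z₁-dir i)) Xc Yc))
        Zc≢0 : Z i at suc c ≢ 𝟎
        Zc≢0 = ≢𝟎-resp (sym (OnColine.forwardʳ (line i) (dir i) Xc Yc)) Yc
        module N = Off.Near (line i) (p∉ i) lead (λ j j<l → proj₁ (first-lead _) j j<l , proj₁ (first-lead _) j j<l) (X i) (proj₂ (first-lead _))

      near : ∀ {h} → Z₁ i at suc h ≢ 𝟎 → Z i at suc h ≡ Z₁ i at suc h
      near = N.near (Z i) (Z₁ i) (Direction.infinite (dir i)) (Direction.infinite (proj₂ (Z₁-dir i))) Zc Zc≢0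

      near-p : a *₀ (Z i at e lead) ≡ neg (Z₁ i at zero)
      near-p = N.near-p (Z i) (Z₁ i) (Direction.infinite (dir i)) (Direction.infinite (proj₂ (Z₁-dir i))) Zc Zc≢0

    level : ∀ h t → (∀ i → Nonneg t (tail (vec (Z₁ i)) ! h)) → ∀ i → tail (vec (Z₁ i)) ! h ≡ 𝟎
    level h t nonneg i = trans (!-tail (vec (Z₁ i)) h) (le-level′ euclidean _ h (line i) (p∉ i) (proj₂ (Z₁-dir i)) (old _) (old _) a t (lead-sign _) (nn i)
        (cyclic (λ V W → L.Le a t (tail V) (tail W)) (L.le-refl a t) (L.le-trans a t) P closed
          (λ i → le-step′ euclidean _ h (line i) (p∉ i) (proj₂ (Z₁-dir i)) (old _) (old _) a t (lead-sign _) (nn i)) _ _))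
      where
      module L = Levels O euclidean (lookup I lead) h
      nn : ∀ i → Nonneg t (Z₁ i at suc h)
      nn i = subst (Nonneg t) (!-tail (vec (Z₁ i)) h) (nonneg i)

    Z₁f-zero : ∀ i → Z₁ i at suc f ≡ 𝟎
    Z₁f-zero i = trans (sym (!-tail (vec (Z₁ i)) f)) (level f Sign.+ (λ i → subst (Nonneg Sign.+) (sym (!-tail (vec (Z₁ i)) f))
      (nonneg-cases λ nz → subst (Nonneg Sign.+) (near i nz) (Z-f i))) i)

    -- `f` is now parallel to the leading element, which has the sign `a` at every vertex, as `f`
    -- has the sign `u`. Hence `transfer-sign` gives `Z₁` the same direction at `p` for all `i`, as
    -- `lexσ-level` requires.
    Z₁p-zero : ∀ i → Z₁ i at zero ≡ 𝟎
    Z₁p-zero i with u , eq ← nonzero-± (f-nonzero zero) = trans (old-σ (coc (Z₁ i)) (old-Z₁ i))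
      (lexσ-level (λ i → tail (vec (Z₁ i))) level I α (opposite ((a Sign.* a) Sign.* (Sign.+ Sign.* u)))
        (λ i → subst (Nonneg _) (old-σ (coc (Z₁ i)) (old-Z₁ i)) (transfer-sign a a Sign.+ u (compare i (trans (f-constant _ zero) eq)) (Z-f i) (near-p i))) i)
      where
      compare : ∀ {u} i → X i at suc f ≡ ± u → Z i at e lead ≡ 𝟎 ⊎ (Z i at e lead ≡ ± a × Z i at suc f ≡ ± u) ⊎
                                       (Z i at e lead ≡ neg (± a) × Z i at suc f ≡ neg (± u))
      compare i Xf with Z i at e lead ≟₀ 𝟎
      ... | yes Ze = inj₁ Ze
      ... | no Ze with same-or-opposite Ze (≡±⇒≢𝟎 (lead-sign (inject₁ i)))
      ...   | inj₁ eq = inj₂ (inj₁ (trans eq (lead-sign _) ,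
                trans (OnColine.parallel (line i) (Z₁ i) (Z i) (X i) (Direction.infinite (proj₂ (Z₁-dir i))) (Z₁f-zero i) Ze eq) Xf))
      ...   | inj₂ eq = inj₂ (inj₂ (trans eq (cong neg (lead-sign _)) ,
                trans (OnColine.parallel⁻ (line i) (Z₁ i) (Z i) (X i) (Direction.infinite (proj₂ (Z₁-dir i))) (Z₁f-zero i) Ze eq) (cong neg Xf)))

    Zf-zero : ∀ i → Z i at suc f ≡ 𝟎
    Zf-zero i = ≈±-zero (line i (Z i) (Z₁ i) (X i) zero (Direction.infinite (dir i)) (Z₁p-zero i) (p≢0 _)) (Z₁f-zero i)

-- Programs on E

module Interior {n k : ℕ} (O : OrientedMatroid n) (I : Vec (Fin n) k) (α : Vec Sign k)
                (O′ : OrientedMatroid (suc n)) (ext : IsLexExtension O I α O′)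
                (euclidean : OrientedMatroid.Euclidean O) where
  open Extension O I α O′ ext
  open Boundary O I α O′ ext euclidean
  open Points O′
  open Rank O′ using (Common)

  Hyp : SignVector (suc n) → Elements
  Hyp V h = h ≢ zero × V ! h ≡ 𝟎

  p∉Hyp : ∀ V → ¬ Hyp V zero
  p∉Hyp _ (p , _) = p refl

  module _ {V} (cV : Cocircuit V) (new : ¬ Old V) where

    self : Point (Hyp V)
    self = point V cV proj₂

    on-p⇒self : (X : Point (Hyp V)) → X at zero ≡ 𝟎 → vec X ≈± V
    on-p⇒self X Xp = smaller (coc X) cV λ { zero _ → Xp ; (suc h) Vh → on X ((λ ()) , Vh) }

    -- Only `±V` lies on `p` here. Two different points on `h` would span a pencil inside `h` that
    -- meets `p`; so `V` would vanish at `h`, and `h` would belong to `Hyp V`.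
    new-line : Coline (Hyp V)
    new-line W W′ U zero Wh W′h Uh = ≈±-trans (on-p⇒self W Wh) (≈±-sym (on-p⇒self W′ W′h))
    new-line W W′ U (suc h) Wh W′h Uh = decidable-stable ≈±-dec absurd
      where
      absurd : ¬ ¬ vec W ≈± vec W′
      absurd W≉W′ with N , Np ← meet {λ l → Hyp V l ⊎ l ≡ suc h}
                           (re W λ { (inj₁ q) → on W q ; (inj₂ refl) → Wh }) (re W′ λ { (inj₁ q) → on W′ q ; (inj₂ refl) → W′h }) W≉W′ zero =
        Uh (on U ((λ ()) , ≈±-zero′ (on-p⇒self (re N (on N ∘′ inj₁)) Np) (on N (inj₂ refl))))

  -- A new cocircuit V lies on the old line Hyp V, infinitely close to the point w where the leading
  -- element e i meets this line.
  record New (V : SignVector (suc n)) : Set where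
    field
      cV     : Cocircuit V
      new    : ¬ Old V
      i      : Fin k
      first  : First i V
      w      : Point (Hyp V)
      w-e    : w at e i ≡ 𝟎
      w-p    : w at zero ≢ 𝟎
      near   : ∀ {h} → w at suc h ≢ 𝟎 → V ! suc h ≡ w at suc h
      near-p : lookup α i *₀ (V ! e i) ≡ neg (w at zero)

    V-p : V ! zero ≡ 𝟎
    V-p = on-hyperplane cV new

    line : Coline (Hyp V)
    line = new-line cV new

    me : Point (Hyp V)
    me = self cV new

    w-old : Old (vec w)
    w-old = off-p⇒old (coc w) w-p

    -- The point of the line Hyp V on g, on the same side of e i as V.
    record Slope (g : Fin n) : Set where
      field
        d   : Point (Hyp V)
        d-g : d at suc g ≡ 𝟎
        d-e : d at e i ≡ V ! e i

      d-e≢0 : d at e i ≢ 𝟎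
      d-e≢0 = ≢𝟎-resp (sym d-e) (proj₂ first)

      d-old : V ! suc g ≢ 𝟎 → Old (vec d)
      d-old Vg = off-p⇒old (coc d) λ d-p → Vg (≈±-zero′ (on-p⇒self cV new d d-p) d-g)

    abstract
      -- In the picture `V = w + εd`, `d` vanishes at `g` so that `g` keeps its value, and `d` has
      -- the sign of `V` at `e i` because `w` vanishes there.
      slope : ∀ g → w at suc g ≢ 𝟎 → Slope g
      slope g wg with D , Dg ← meet me w (λ eq → w-p (≈±-zero′ eq V-p)) (suc g)
        with same-or-opposite {D at e i} {V ! e i} (λ De → wg (≈±-zero′ (line D w me (e i) De w-e (proj₂ first)) Dg)) (proj₂ first)
      ... | inj₁ eq = record { d = D ; d-g = Dg ; d-e = eq }
      ... | inj₂ eq = record { d = ⊖ D ; d-g = trans (!-neg (vec D) (suc g)) (neg-zero Dg)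
                             ; d-e = trans (!-neg (vec D) (e i)) (trans (cong neg eq) (neg² _)) }

      -- If w lies on g, any other old point of the line serves as a substitute for V in O.
      finite-point : ∀ g → w at suc g ≡ 𝟎 → V ! suc g ≢ 𝟎 → Σ (Point (Hyp V)) λ u → Old (vec u) × u at suc g ≡ V ! suc g
      finite-point g wg Vg
        with h , wh ← nonzero-outside-p (coc w)
        with U , Uh , b ← eliminate⁻ w me {suc h} (λ eq → w-p (trans (cong (_! zero) eq) V-p)) (sym (near wh)) wh
        with same-or-opposite {U at suc g} {V ! suc g} (λ Ug → wh (≈±-zero′ (line U w me (suc g) Ug wg Vg) Uh)) Vg
      ... | inj₁ eq = U , off-p⇒old (coc U) (λ Up → contradiction (≈±-zero′ (on-p⇒self cV new U Up) Uh) (≢𝟎-resp (sym (near wh)) wh)) , eq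
      ... | inj₂ eq = ⊖ U , off-p⇒old (coc (⊖ U)) (λ Up → contradiction (≈±-zero′ (on-p⇒self cV new (⊖ U) Up) (trans (!-neg (vec U) (suc h)) (neg-zero Uh))) (≢𝟎-resp (sym (near wh)) wh))
                          , trans (!-neg (vec U) (suc g)) (trans (cong neg eq) (neg² _))

  abstract
    -- `new-smaller` supplies the second point that spans the line with `V`. The sign of the point
    -- on `e i` is chosen by agreement with `V` at one element `h`; `Near` extends the agreement.
    new-vertex : ∀ {V} → Cocircuit V → ¬ Old V → New V
    new-vertex {V} cV new with first? V | new-smaller cV new
    ... | inj₁ zeros | U , cU , Up , sub = contradiction (all-zero⇒on-p cU λ j → sub _ (zeros j)) Up
    ... | inj₂ (i , fst) | U , cU , Up , sub
      with W , We ← meet (self cV new) (point U cU λ { {zero} (p , _) → contradiction refl p ; {suc h} (_ , Vh) → sub h Vh })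
                         (λ eq → Up (≈±-zero′ eq (on-hyperplane cV new))) (e i)
      with h , Wh ← nonzero-outside-p (coc W)
      with same-or-opposite {V ! suc h} {W at suc h} (Off.new-generic (new-line cV new) (p∉Hyp V) (self cV new) W new Wh) Wh
    ... | inj₁ eq = record { cV = cV ; new = new ; i = i ; first = fst ; w = W ; w-e = We
        ; w-p = λ Wp → proj₂ fst (≈±-zero′ (on-p⇒self cV new W Wp) We)
        ; near = N.near (self cV new) W (on-hyperplane cV new) We eq (≢𝟎-resp (sym eq) Wh)
        ; near-p = N.near-p (self cV new) W (on-hyperplane cV new) We eq (≢𝟎-resp (sym eq) Wh) }
      where module N = Off.Near (new-line cV new) (p∉Hyp V) i (λ j j<i → (λ ()) , proj₁ fst j j<i) (self cV new) (proj₂ fst)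
    ... | inj₂ eq = record { cV = cV ; new = new ; i = i ; first = fst ; w = ⊖ W ; w-e = ⊖We
        ; w-p = λ Wp → proj₂ fst (≈±-zero′ (on-p⇒self cV new (⊖ W) Wp) ⊖We)
        ; near = N.near (self cV new) (⊖ W) (on-hyperplane cV new) ⊖We eq′ (≢𝟎-resp (sym eq) (neg-≢𝟎 Wh))
        ; near-p = N.near-p (self cV new) (⊖ W) (on-hyperplane cV new) ⊖We eq′ (≢𝟎-resp (sym eq) (neg-≢𝟎 Wh)) }
      where
      module N = Off.Near (new-line cV new) (p∉Hyp V) i (λ j j<i → (λ ()) , proj₁ fst j j<i) (self cV new) (proj₂ fst)
      ⊖We : (⊖ W) at e i ≡ 𝟎
      ⊖We = trans (!-neg (vec W) (e i)) (neg-zero We)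
      eq′ : V ! suc h ≡ (⊖ W) at suc h
      eq′ = trans eq (sym (!-neg (vec W) (suc h)))

opposite-≢ : ∀ {t} → ± t ≢ ± (opposite t)
opposite-≢ {t} = ≢neg {± t} λ ()

nonneg-≢ : ∀ {t x} → Nonneg t x → x ≢ ± (opposite t)
nonneg-≢ (inj₁ refl) ()
nonneg-≢ (inj₂ refl) eq = opposite-≢ eq

mono-flip : ∀ t {x y} → Mono (opposite t) y x → Mono t x y
mono-flip t (p , q) = (λ eq → subst (λ t → _ ≡ ± t) (opposite² t) (q (trans eq (cong ± (sym (opposite² t)))))) , p

-- Positions, drifts and what a single edge says about them

module Edges {n k : ℕ} (O : OrientedMatroid n) (I : Vec (Fin n) k) (α : Vec Sign k)
             (O′ : OrientedMatroid (suc n)) (ext : IsLexExtension O I α O′)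
             (euclidean : OrientedMatroid.Euclidean O) (g f : Fin n) where
  open Extension O I α O′ ext
  open Boundary O I α O′ ext euclidean
  open Interior O I α O′ ext euclidean
  open Points O′
  open Rank O′ using (Common)
  open Levels O euclidean g f using (Le; le-refl; le-trans; le-flip; le-flip⁻)
  open New using (Slope)
  open Slope

  record Edge (s t : Sign) (x y : SignVector (suc n)) : Set where
    field
      line : Coline (Common x y)
      cx   : Cocircuit x
      cy   : Cocircuit y
      Z    : Point (Common x y)
      dir  : Direction (suc g) (point x cx proj₁) (point y cy proj₂) Z
      Z-f  : Nonneg t (Z at suc f)
      conf : Conformal x y
      x-g  : x ! suc g ≡ ± s

    y-g : y ! suc g ≡ ± s
    y-g = trans (sym (Direction.agree dir)) x-g

  flip : ∀ {s t x y} → Edge s t x y → Edge s (opposite t) y x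
  flip {x = x} {y} E = record
    { line = Coline-mono (λ (xh , yh) → yh , xh) line ; cx = cy ; cy = cx
    ; Z = re (⊖ Z) (λ (yh , xh) → on (⊖ Z) (xh , yh))
    ; dir = re-direction (λ (yh , xh) → xh , yh) (flip-direction dir)
    ; Z-f = map⊎ (trans (!-neg (vec Z) (suc f)) ∘′ cong neg) (trans (!-neg (vec Z) (suc f)) ∘′ cong neg) Z-f
    ; conf = λ e (sep , nz) → conf e (trans (sym (neg² _)) (cong neg (sym sep)) , λ xe → nz (trans sep (neg-zero xe)))
    ; x-g = y-g }
    where open Edge E

  -- Each kind provides a cocircuit of `O` off `g` to stand for a vertex `V` of the program. There
  -- is deliberately no kind for `w` on `g` but not on `f`.
  data Kind (V : SignVector (suc n)) : Set where
    old     : Old V → Kind V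
    generic : (N : New V) → New.w N at suc g ≢ 𝟎 → Slope N g → Kind V
    base    : (N : New V) → New.w N at suc g ≡ 𝟎 → New.w N at suc f ≡ 𝟎 →
              (u : Point (Hyp V)) → Old (vec u) → u at suc g ≡ V ! suc g → Kind V

  position : ∀ {V} → Kind V → SignVector n
  position {V} (old _)    = tail V
  position (generic N _ _) = tail (vec (New.w N))
  position (base _ _ _ u _ _) = tail (vec u)

  -- The first-order change of f along the line Hyp V, if V is infinitely close to its position but different.
  drift : ∀ {V} → Kind V → Sign₀
  drift (old _) = 𝟎
  drift (generic _ _ S) = d S at suc f
  drift (base _ _ _ _ _ _) = 𝟎

  -- First-order information. `mono` makes the drift constant on a closed walk, and `still` settles
  -- drift zero. For a nonzero drift, `rise` and `fall` force a constant leading index: between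
  -- generic vertices of different indices, the slope at the later index is either level for `f` or
  -- followed by the edge.
  record Level (t : Sign) {x y} (κ : Kind x) (μ : Kind y) (Zf : Sign₀) : Set where
    field
      mono  : Mono t (drift κ) (drift μ)
      still : drift κ ≡ 𝟎 → drift μ ≡ 𝟎 → Zf ≡ 𝟎
      rise  : ∀ {i j} → First i x → First j y → i <ᶠ j → Nonneg t (drift μ)
      fall  : ∀ {i j} → First i x → First j y → j <ᶠ i → Nonneg (opposite t) (drift κ)

  -- Two stages: `up` is the step in the walk of positions, and only the return path supplied by the
  -- closed walk gives access to the first order.
  record Result (s t : Sign) {x y} (κ : Kind x) (μ : Kind y) (Zf : Sign₀) : Set where
    field
      up   : Le s t (position κ) (position μ)
      back : Le s t (position μ) (position κ) → Level t κ μ Zf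

  unflip : ∀ {s t x y} {κ : Kind x} {μ : Kind y} {Zf} → Result s (opposite t) μ κ (neg Zf) → Result s t κ μ Zf
  unflip {s} {t} {κ = κ} {μ} R = record
    { up = le-flip s t (Result.up R)
    ; back = λ b → level (Result.back R (le-flip⁻ s t b)) }
    where
    level : ∀ {Zf} → Level (opposite t) μ κ (neg Zf) → Level t κ μ Zf
    level l = record
      { mono = mono-flip t (Level.mono l)
      ; still = λ p q → neg-zero⁻ (Level.still l q p)
      ; rise = λ fi fj i<j → subst (λ t → Nonneg t (drift μ)) (opposite² t) (Level.fall l fj fi i<j)
      ; fall = λ fi fj j<i → Level.rise l fj fi j<i }

  -- An edge inside the hyperplane p is treated in the plane through it that is spanned by elements other than p.
  module OnP {s t x y} (E : Edge s t x y) (x-p : x ! zero ≡ 𝟎) (y-p : y ! zero ≡ 𝟎) where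
    open Edge E

    K : Elements
    K h = h ≢ zero × x ! h ≡ 𝟎 × y ! h ≡ 𝟎

    K-line : ∀ e → (Q : Point K) → Q at e ≢ 𝟎 → Coline (K ∪₁ e)
    K-line e = plane (Coline-mono (λ { {zero} _ → inj₂ refl ; {suc h} q → inj₁ ((λ ()) , q) }) line)

    p∉ : ∀ {h} → ¬ (K ∪₁ suc h) zero
    p∉ (inj₁ (p , _)) = p refl

    x∈K y∈K : Point K
    x∈K = point x cx λ (_ , xh , _) → xh
    y∈K = point y cy λ (_ , _ , yh) → yh

    ofˣ : Point (Hyp x) → Point K
    ofˣ X = re X λ (p , xh , _) → on X (p , xh)

    ofʸ : Point (Hyp y) → Point K
    ofʸ X = re X λ (p , _ , yh) → on X (p , yh)

    _⊕_ : ∀ (X : Point K) {h} → X at h ≡ 𝟎 → Point (K ∪₁ h)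
    X ⊕ Xh = re X λ { (inj₁ q) → on X q ; (inj₂ refl) → Xh }

    x≉y : ¬ x ≈± y
    x≉y = Direction.X≉Y dir

    Z∈K : Point K
    Z∈K = re Z λ (_ , q) → on Z q

    ZC : Point (K ∪₁ suc g)
    ZC = Z∈K ⊕ Direction.infinite dir

    C-line : Coline (K ∪₁ suc g)
    C-line = K-line (suc g) x∈K (≡±⇒≢𝟎 x-g)

    abstract
      Z-p : Z at zero ≡ 𝟎
      Z-p = on Z (x-p , y-p)

      only-y : ∃[ a ] x ! suc a ≡ 𝟎 × y ! suc a ≢ 𝟎
      only-y with distinguish cx cy x≉y
      ... | zero , _ , yp = contradiction y-p yp
      ... | suc a , xa , ya = a , xa , ya

      only-x : ∃[ a ] y ! suc a ≡ 𝟎 × x ! suc a ≢ 𝟎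
      only-x with distinguish cy cx (λ p → x≉y (≈±-sym p))
      ... | zero , _ , xp = contradiction x-p xp
      ... | suc a , ya , xa = a , ya , xa

      Zʸ : ∀ {a} → x ! a ≡ 𝟎 → y ! a ≢ 𝟎 → Z at a ≡ y ! a
      Zʸ = OnColine.forwardʳ line dir

      Zˣ : ∀ {a} → y ! a ≡ 𝟎 → x ! a ≢ 𝟎 → Z at a ≡ neg (x ! a)
      Zˣ = OnColine.forwardˡ line dir

    -- Here y is old, or its leading element comes after that of x.
    module Lower (N : New x) (w-g : New.w N at suc g ≢ 𝟎) (S : Slope N g)
                 (pre : ∀ j → j <ᶠ New.i N → y ! e j ≡ 𝟎) (y-e : y ! e (New.i N) ≡ 𝟎)
                 (w′ : Point K) (w′-e : w′ at e (New.i N) ≡ 𝟎) (w′-old : Old (vec w′)) (w′-g : w′ at suc g ≢ 𝟎)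
                 (near′ : ∀ {h} → w′ at suc h ≢ 𝟎 → y ! suc h ≡ w′ at suc h) where
      open New N hiding (Slope; module Slope; line)

      dC : Point (K ∪₁ suc g)
      dC = ofˣ (d S) ⊕ d-g S

      Z-e : Z at e i ≡ neg (x ! e i)
      Z-e = Zˣ y-e (proj₂ first)

      Z-e≢0 : Z at e i ≢ 𝟎
      Z-e≢0 = ≢𝟎-resp (sym Z-e) (neg-≢𝟎 (proj₂ first))

      -- `V` makes `f` parallel to `e i` on the line at infinity, where `Z` and `d S` lie on
      -- opposite sides of `e i` because `y` vanishes there.
      descend : (V : Point (K ∪₁ suc g)) → V at e i ≡ 𝟎 → V at suc f ≡ 𝟎 → Z at suc f ≡ neg (d S at suc f)
      descend V Ve Vf = OnColine.parallel⁻ C-line V ZC dC Ve Vf Z-e≢0 (trans Z-e (cong neg (sym (d-e S))))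

      module N = Off.Near C-line p∉ i (λ j j<i → inj₁ ((λ ()) , proj₁ first j j<i , pre j j<i)) dC (d-e≢0 S)

      -- Let `Z₁` be the direction from `w` to `w′` along `K ∪₁ e i`. On the line `K ∪₁ suc g` it is
      -- the point of `e i` and `Z` the point of `p`, so the two are close and `Z₁` inherits the
      -- sign of `f`.
      apart : vec w ≢ vec w′ → Le s t (tail (vec w)) (tail (vec w′)) ×
              (Le s t (tail (vec w′)) (tail (vec w)) → Σ (Point (K ∪₁ e i)) λ Z₁ → Z₁ at suc g ≡ 𝟎 × Z₁ at suc f ≡ 𝟎 × Z at suc f ≡ neg (d S at suc f))
      apart w≢w′ = le-step′ euclidean g f lineB p∉ dir₁ w-old w′-old s t w-g≡s Z₁f ,
                   λ b → let z = le-level′ euclidean g f lineB p∉ dir₁ w-old w′-old s t w-g≡s Z₁f b in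
                         Z₁ , Direction.infinite dir₁ , z , descend Z₁C Z₁e z
        where
        lineB = K-line (e i) x∈K (proj₂ first)
        wB w′B : Point (K ∪₁ e i)
        wB = ofˣ w ⊕ w-e
        w′B = w′ ⊕ w′-e
        w-g≡s : w at suc g ≡ ± s
        w-g≡s = trans (sym (near w-g)) x-g
        w≡w′ : w at suc g ≡ w′ at suc g
        w≡w′ = trans w-g≡s (trans (sym y-g) (near′ w′-g))
        found = directed wB w′B w≢w′ w≡w′ w-g
        Z₁ = proj₁ found
        dir₁ = proj₂ found
        a = proj₁ only-y
        xa = proj₁ (proj₂ only-y)
        ya = proj₂ (proj₂ only-y)
        wa : w at suc a ≡ 𝟎
        wa = on w ((λ ()) , xa)
        w′a : w′ at suc a ≢ 𝟎
        w′a p = w≢w′ (≈±-agree (lineB wB w′B (y∈K ⊕ y-e) (suc a) wa p ya) w-g w≡w′)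
        Z₁e : Z₁ at e i ≡ 𝟎
        Z₁e = on Z₁ (inj₂ refl)
        Z₁C : Point (K ∪₁ suc g)
        Z₁C = re Z₁ (on Z₁ ∘′ inj₁) ⊕ Direction.infinite dir₁
        Za : Z at suc a ≡ Z₁ at suc a
        Za = trans (Zʸ xa ya) (trans (near′ w′a) (sym (OnColine.forwardʳ lineB dir₁ wa w′a)))
        Z₁f : Nonneg t (Z₁ at suc f)
        Z₁f = nonneg-cases λ nz → subst (Nonneg t) (N.near ZC Z₁C Z-p Z₁e Za (≢𝟎-resp (sym (Zʸ xa ya)) ya) nz) Z-f

  module _ {s t x y} (E : Edge s t x y) (x-p : x ! zero ≡ 𝟎) (y-p : y ! zero ≡ 𝟎)
           (N : New x) (w-g : New.w N at suc g ≢ 𝟎) (S : Slope N g) where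
    open New N hiding (Slope; module Slope; line)
    open Edge E
    open OnP E x-p y-p

    private
      level : (N′ : New y) (w′-g : New.w N′ at suc g ≢ 𝟎) (S′ : Slope N′ g) → i <ᶠ New.i N′ → Nonneg t (d S′ at suc f) →
              (d S′ at suc f ≡ 𝟎 → Z at suc f ≡ neg (d S at suc f)) → Level t (generic N w-g S) (generic N′ w′-g S′) (Z at suc f)
      level N′ w′-g S′ i<i′ nn Zf = record
        { mono = (λ eq → [ (λ z → contradiction (trans (Zf z) (cong neg eq)) (nonneg-≢ Z-f)) , (λ q → q) ]′ nn)
               , λ eq → contradiction eq (nonneg-≢ nn)
        ; still = λ p q → trans (Zf q) (neg-zero p)
        ; rise = λ _ _ _ → nn
        ; fall = λ fi fj j<i → ⊥-elim (<-asym i<i′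
            (subst₂ (λ a b → a <ᶠ b) (first-unique {V = y} fj (New.first N′)) (first-unique {V = x} fi first) j<i)) }

    generic-old : (oy : Old y) → Result s t {y = y} (generic N w-g S) (old oy) (Z at suc f)
    generic-old oy = record { up = proj₁ result ; back = λ b → let _ , _ , _ , Zf = proj₂ result b in level₀ Zf }
      where
      zeros : ∀ j → y ! e j ≡ 𝟎
      zeros = old-on-p cy oy y-p
      y-finite : y ! suc g ≢ 𝟎
      y-finite = ≡±⇒≢𝟎 y-g
      near-self : ∀ {h} → y ! suc h ≢ 𝟎 → y ! suc h ≡ y ! suc h
      near-self _ = refl
      -- An old `y` on `p` has all elements of `I` zero, so it serves as its own nearby point `w′`.
      module Lo = Lower N w-g S (λ j _ → zeros j) (zeros i) y∈K (zeros i) oy y-finite near-self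
      result = Lo.apart λ eq → w-p (trans (cong (_! zero) eq) y-p)
      level₀ : Z at suc f ≡ neg (d S at suc f) → Level t {y = y} (generic N w-g S) (old oy) (Z at suc f)
      level₀ Zf = record
        { mono = (λ eq → contradiction (trans Zf (cong neg eq)) (nonneg-≢ Z-f)) , λ ()
        ; still = λ p _ → trans Zf (neg-zero p)
        ; rise = λ _ _ _ → inj₁ refl
        ; fall = λ {_} {j} _ fj _ → contradiction (zeros j) (proj₂ fj) }

    generic-higher : (N′ : New y) (w′-g : New.w N′ at suc g ≢ 𝟎) (S′ : Slope N′ g) → i <ᶠ New.i N′ →
                     Result s t (generic N w-g S) (generic N′ w′-g S′) (Z at suc f)
    generic-higher N′ w′-g S′ i<i′ with vec w ≟ᵥ vec (New.w N′)
    ... | no w≢w′ = record { up = proj₁ result ; back = λ b → let Z₁ , Z₁g , Z₁f , Zf = proj₂ result b in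
                     level N′ w′-g S′ i<i′ (inj₁ (d′f Z₁ Z₁g Z₁f)) (λ _ → Zf) }
      where
      module N′ = New N′
      y-e = proj₁ N′.first i i<i′
      module Lo = Lower N w-g S (λ j j<i → proj₁ N′.first j (<-trans j<i i<i′)) y-e (ofʸ N′.w) (on N′.w ((λ ()) , y-e)) N′.w-old w′-g N′.near
      result = Lo.apart w≢w′
      d′f : (Z₁ : Point (K ∪₁ e i)) → Z₁ at suc g ≡ 𝟎 → Z₁ at suc f ≡ 𝟎 → d S′ at suc f ≡ 𝟎
      d′f Z₁ Z₁g Z₁f = ≈±-zero (K-line (e i) x∈K (proj₂ first) (ofʸ (d S′) ⊕ on (d S′) ((λ ()) , y-e)) Z₁ (ofˣ w ⊕ w-e) (suc g) (d-g S′) Z₁g w-g) Z₁f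
    -- With equal positions the slope `d S′` takes over: it lies on `e i` since `y` does, so `Z` is
    -- close to it on the line `K ∪₁ suc g`.
    ... | yes w≡w′ = record { up = subst (λ W → Le s t (tail (vec w)) (tail W)) w≡w′ (le-refl s t)
                            ; back = λ _ → level N′ w′-g S′ i<i′ (nonneg-cases λ nz → subst (Nonneg t) (near-f nz) Z-f)
                                             (λ z → Lo.descend d′C d′-e z) }
      where
      module N′ = New N′
      y-e = proj₁ N′.first i i<i′
      module Lo = Lower N w-g S (λ j j<i → proj₁ N′.first j (<-trans j<i i<i′)) y-e (ofʸ N′.w) (on N′.w ((λ ()) , y-e)) N′.w-old w′-g N′.near
      d′C : Point (K ∪₁ suc g)
      d′C = ofʸ (d S′) ⊕ d-g S′
      d′-e : d S′ at e i ≡ 𝟎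
      d′-e = on (d S′) ((λ ()) , y-e)
      a = proj₁ only-y
      xa = proj₁ (proj₂ only-y)
      ya = proj₂ (proj₂ only-y)
      ya≡d′a : y ! suc a ≡ d S′ at suc a
      ya≡d′a = OnColine.parallel N′.line N′.w N′.me (d S′) N′.w-e (trans (cong (_! suc a) (sym w≡w′)) (on w ((λ ()) , xa)))
                 (proj₂ N′.first) (sym (d-e S′))
      near-f : ∀ {h} → d S′ at suc h ≢ 𝟎 → Z at suc h ≡ d S′ at suc h
      near-f = Lo.N.near ZC d′C Z-p d′-e (trans (Zʸ xa ya) ya≡d′a) (≢𝟎-resp (sym (Zʸ xa ya)) ya)

  level-zero : ∀ {t x y} {κ : Kind x} {μ : Kind y} {Zf} → drift κ ≡ 𝟎 → drift μ ≡ 𝟎 → Zf ≡ 𝟎 → Level t κ μ Zf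
  level-zero {t} {κ = κ} {μ} p q z = record
    { mono = subst₂ (Mono t) (sym p) (sym q) mono-refl ; still = λ _ _ → z ; rise = λ _ _ _ → inj₁ q ; fall = λ _ _ _ → inj₁ p }

  module _ {s} {A} (col : Coline A) (p∉A : ¬ A zero) (X Y Q : Point A) (oX : Old (vec X)) (oY : Old (vec Y))
           (X-g : X at suc g ≡ ± s) (Y-g : Y at suc g ≡ ± s) (Q-g : Q at suc g ≡ 𝟎) (Q-f : Q at suc f ≡ 𝟎) where

    -- `f` and `g` meet this line in the same point `Q`, so every step on it is level and may be
    -- taken in either direction.
    level-line : ∀ t → Le s t (tail (vec X)) (tail (vec Y))
    level-line t with vec X ≟ᵥ vec Y
    ... | yes eq = subst (λ V → Le s t (tail (vec X)) (tail V)) eq (le-refl s t)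
    ... | no neq with Z , d ← directed {g = suc g} X Y neq (trans X-g (sym Y-g)) (≡±⇒≢𝟎 X-g) =
      le-step′ euclidean g f col p∉A d oX oY s t X-g (inj₁ (≈±-zero (≈±-sym (OnColine.direction-unique col d Q Q-g)) Q-f))

  module SameIndex {s t x y} (E : Edge s t x y) (x-p : x ! zero ≡ 𝟎) (y-p : y ! zero ≡ 𝟎)
                   (N : New x) (w-g : New.w N at suc g ≢ 𝟎) (S : Slope N g)
                   (N′ : New y) (w′-g : New.w N′ at suc g ≢ 𝟎) (S′ : Slope N′ g) (i≡i′ : New.i N ≡ New.i N′) where
    open Edge E
    open OnP E x-p y-p
    open New N hiding (Slope; module Slope; line)
    private module N′ = New N′

    first′ : First i y
    first′ = subst (λ i → First i y) (sym i≡i′) N′.first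

    w′-e : N′.w at e i ≡ 𝟎
    w′-e = subst (λ i → N′.w at e i ≡ 𝟎) (sym i≡i′) N′.w-e

    d′-e : d S′ at e i ≡ y ! e i
    d′-e = subst (λ i → d S′ at e i ≡ y ! e i) (sym i≡i′) (d-e S′)

    -- Conformality enters here: it puts both slopes on the same side of `e i`, where they can be
    -- compared in a program with `e i` in place of `g`.
    x-e≡y-e : x ! e i ≡ y ! e i
    x-e≡y-e with same-or-opposite (proj₂ first) (proj₂ first′)
    ... | inj₁ eq = eq
    ... | inj₂ eq = contradiction (eq , proj₂ first) (conf (e i))

    d≡d′ : d S at e i ≡ d S′ at e i
    d≡d′ = trans (d-e S) (trans x-e≡y-e (sym d′-e))

    dC d′C : Point (K ∪₁ suc g)
    dC = ofˣ (d S) ⊕ d-g S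
    d′C = ofʸ (d S′) ⊕ d-g S′

    B-line : Coline (K ∪₁ e i)
    B-line = K-line (e i) x∈K (proj₂ first)

    wB w′B : Point (K ∪₁ e i)
    wB = ofˣ w ⊕ w-e
    w′B = ofʸ N′.w ⊕ w′-e

    w-s : w at suc g ≡ ± s
    w-s = trans (sym (near w-g)) x-g

    w′-s : N′.w at suc g ≡ ± s
    w′-s = trans (sym (N′.near w′-g)) y-g

    private
      a = proj₁ only-x
      ya = proj₁ (proj₂ only-x)
      xa = proj₂ (proj₂ only-x)
      Za : Z at suc a ≡ neg (x ! suc a)
      Za = Zˣ ya xa

    module Near′ = Off.Near C-line p∉ i (λ j j<i → inj₁ ((λ ()) , proj₁ first j j<i , proj₁ first′ j j<i)) dC (d-e≢0 S)

    -- `Z₁` is the leading term of `y - x = (w′ - w) + ε(d′ - d)`: the change of position if there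
    -- is one, otherwise the change of slope.
    record Target : Set where
      field
        Z₁     : Point (K ∪₁ suc g)
        Z₁-e   : Z₁ at e i ≡ 𝟎
        near₁  : ∀ {h} → Z₁ at suc h ≢ 𝟎 → Z at suc h ≡ Z₁ at suc h
        near-p₁ : lookup α i *₀ (Z at e i) ≡ neg (Z₁ at zero)
        move   : Direction (suc g) wB w′B (re Z₁ (on Z₁ ∘′ inj₁) ⊕ Z₁-e) ⊎ (vec w ≡ vec N′.w × Direction (e i) dC d′C Z₁)

    private
      apart : vec w ≢ vec N′.w → Target
      apart w≢w′ = record
        { Z₁ = Z₁C ; Z₁-e = Z₁e
        ; near₁ = Near′.near ZC Z₁C Z-p Z₁e Za≡Z₁a (≢𝟎-resp (sym Za) (neg-≢𝟎 xa))
        ; near-p₁ = Near′.near-p ZC Z₁C Z-p Z₁e Za≡Z₁a (≢𝟎-resp (sym Za) (neg-≢𝟎 xa))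
        ; move = inj₁ (direction w≢w′ (trans w-s (sym w′-s)) w-g (Direction.infinite (proj₂ found)) (Direction.ahead (proj₂ found))) }
        where
        found = directed {g = suc g} wB w′B w≢w′ (trans w-s (sym w′-s)) w-g
        Z₁ = proj₁ found
        Z₁e : Z₁ at e i ≡ 𝟎
        Z₁e = on Z₁ (inj₂ refl)
        Z₁C : Point (K ∪₁ suc g)
        Z₁C = re Z₁ (on Z₁ ∘′ inj₁) ⊕ Direction.infinite (proj₂ found)
        w′a : N′.w at suc a ≡ 𝟎
        w′a = on N′.w ((λ ()) , ya)
        wa : w at suc a ≢ 𝟎
        wa p = w≢w′ (≈±-agree (K-line (suc a) x∈K xa (ofˣ w ⊕ p) (ofʸ N′.w ⊕ w′a) (y∈K ⊕ ya) (e i) w-e w′-e (proj₂ first′))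
                      w-g (trans w-s (sym w′-s)))
        Za≡Z₁a : Z at suc a ≡ Z₁ at suc a
        Za≡Z₁a = trans Za (trans (cong neg (near wa)) (sym (OnColine.forwardˡ B-line (proj₂ found) w′a wa)))

      together : vec w ≡ vec N′.w → Target
      together w≡w′ = record
        { Z₁ = Z₁ ; Z₁-e = Z₁e
        ; near₁ = Near′.near ZC Z₁ Z-p Z₁e Za≡Z₁a (≢𝟎-resp (sym Za) (neg-≢𝟎 xa))
        ; near-p₁ = Near′.near-p ZC Z₁ Z-p Z₁e Za≡Z₁a (≢𝟎-resp (sym Za) (neg-≢𝟎 xa))
        ; move = inj₂ (w≡w′ , proj₂ found) }
        where
        wa : w at suc a ≡ 𝟎
        wa = trans (cong (_! suc a) w≡w′) (on N′.w ((λ ()) , ya))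
        d′a : d S′ at suc a ≡ 𝟎
        d′a = on (d S′) ((λ ()) , ya)
        xa≡da : x ! suc a ≡ d S at suc a
        xa≡da = OnColine.parallel (New.line N) w me (d S) w-e wa (proj₂ first) (sym (d-e S))
        da : d S at suc a ≢ 𝟎
        da = ≢𝟎-resp xa≡da xa
        found = directed {g = e i} dC d′C (λ eq → da (trans (cong (_! suc a) eq) d′a)) d≡d′ (d-e≢0 S)
        Z₁ = proj₁ found
        Z₁e : Z₁ at e i ≡ 𝟎
        Z₁e = Direction.infinite (proj₂ found)
        Za≡Z₁a : Z at suc a ≡ Z₁ at suc a
        Za≡Z₁a = trans Za (trans (cong neg xa≡da) (sym (OnColine.forwardˡ C-line (proj₂ found) d′a da)))

    abstract
      target : Target
      target with vec w ≟ᵥ vec N′.w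
      ... | yes eq = together eq
      ... | no neq = apart neq
    open Target target public

    -- f is parallel to the leading element on the line through d and d′.
    compare : Z₁ at suc f ≡ 𝟎 → Z at e i ≡ 𝟎 ⊎ (Z at e i ≡ d S at e i × Z at suc f ≡ d S at suc f) ⊎
              (Z at e i ≡ neg (d S at e i) × Z at suc f ≡ neg (d S at suc f))
    compare Z₁f with Z at e i ≟₀ 𝟎
    ... | yes Ze = inj₁ Ze
    ... | no Ze with same-or-opposite Ze (d-e≢0 S)
    ...   | inj₁ eq = inj₂ (inj₁ (eq , OnColine.parallel C-line Z₁ ZC dC Z₁-e Z₁f Ze eq))
    ...   | inj₂ eq = inj₂ (inj₂ (eq , OnColine.parallel⁻ C-line Z₁ ZC dC Z₁-e Z₁f Ze eq))

    Z≈Z₁ : Z at e i ≡ 𝟎 → vec Z ≈± vec Z₁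
    Z≈Z₁ Ze = C-line ZC Z₁ dC (e i) Ze Z₁-e (d-e≢0 S)

    Z₁-f : Nonneg t (Z₁ at suc f)
    Z₁-f = nonneg-cases λ nz → subst (Nonneg t) (near₁ nz) Z-f

    generic-same : Result s t (generic N w-g S) (generic N′ w′-g S′) (Z at suc f)
    generic-same with move
    ... | inj₁ dir₁ = record { up = le-step′ euclidean g f B-line p∉ dir₁ w-old N′.w-old s t w-s Z₁-f
                             ; back = λ b → level (le-level′ euclidean g f B-line p∉ dir₁ w-old N′.w-old s t w-s Z₁-f b) }
      where
      level : Z₁ at suc f ≡ 𝟎 → Level t (generic N w-g S) (generic N′ w′-g S′) (Z at suc f)
      level Z₁f = record
        { mono = subst (Mono t (d S at suc f)) (OnColine.parallel C-line Z₁ dC d′C Z₁-e Z₁f (d-e≢0 S) d≡d′) mono-refl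
        ; still = λ df _ → [ (λ Ze → ≈±-zero (Z≈Z₁ Ze) Z₁f) , [ (λ (_ , q) → trans q df) , (λ (_ , q) → trans q (neg-zero df)) ]′ ]′ (compare Z₁f)
        ; rise = λ fi fj i<j → contradiction i<j (<-irrefl (cong toℕ (trans (first-unique {V = x} fi first) (first-unique {V = y} first′ fj))))
        ; fall = λ fi fj j<i → contradiction j<i (<-irrefl (cong toℕ (trans (first-unique {V = y} fj first′) (first-unique {V = x} first fi)))) }
    ... | inj₂ (w≡w′ , dir₁) = record { up = subst (λ W → Le s t (tail (vec w)) (tail W)) w≡w′ (le-refl s t) ; back = λ _ → level }
      where
      level : Level t (generic N w-g S) (generic N′ w′-g S′) (Z at suc f)
      level = record
        { mono = OnColine.sign-forward C-line dir₁ Z₁-f , OnColine.sign-backward C-line dir₁ Z₁-f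
        ; still = λ df d′f → decidable-stable (Z at suc f ≟₀ 𝟎) λ Zf → Direction.X≉Y dir₁ (C-line dC d′C ZC (suc f) df d′f Zf)
        ; rise = λ fi fj i<j → contradiction i<j (<-irrefl (cong toℕ (trans (first-unique {V = x} fi first) (first-unique {V = y} first′ fj))))
        ; fall = λ fi fj j<i → contradiction j<i (<-irrefl (cong toℕ (trans (first-unique {V = y} fj first′) (first-unique {V = x} first fi)))) }

  module _ {s t x y} (E : Edge s t x y) where
    open Edge E

    -- Between old cocircuits p may lie on the edge, but only if it is in the closure of the other elements there.
    old-old : (ox : Old x) (oy : Old y) → Result s t {x} {y} (old ox) (old oy) (Z at suc f)
    old-old ox oy = record
      { up = le-step′ euclidean g f lineA (λ (p , _) → p refl) dirA ox oy s t x-g Z-f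
      ; back = λ b → level-zero {κ = old ox} {μ = old oy} refl refl
                       (le-level′ euclidean g f lineA (λ (p , _) → p refl) dirA ox oy s t x-g Z-f b) }
      where
      A : Elements
      A h = h ≢ zero × Common x y h
      dirA = re-direction {B = A} proj₂ dir
      p∈ : x ! zero ≡ 𝟎 → y ! zero ≡ 𝟎 → (U : Point A) → U at zero ≡ 𝟎
      p∈ xp yp U = all-zero⇒on-p (coc U) λ j → on U ((λ ()) , old-on-p cx ox xp j , old-on-p cy oy yp j)
      with-p : x ! zero ≡ 𝟎 → y ! zero ≡ 𝟎 → (U : Point A) → ∀ {h} → Common x y h → U at h ≡ 𝟎
      with-p xp yp U {zero} _ = p∈ xp yp U
      with-p xp yp U {suc h} q = on U ((λ ()) , q)
      lineA : Coline A
      lineA with x ! zero ≟₀ 𝟎 | y ! zero ≟₀ 𝟎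
      ... | yes xp | yes yp = λ X Y U → line (re X (with-p xp yp X)) (re Y (with-p xp yp Y)) (re U (with-p xp yp U))
      ... | no xp | _ = Coline-mono (λ { {zero} (q , _) → contradiction q xp ; {suc h} q → (λ ()) , q }) line
      ... | _ | no yp = Coline-mono (λ { {zero} (_ , q) → contradiction q yp ; {suc h} q → (λ ()) , q }) line

    module _ (x-p : x ! zero ≢ 𝟎) (ox : Old x) where

      private
        p∉line : ¬ Common x y zero
        p∉line (xp , _) = x-p xp

        X : Point (Common x y)
        X = point x cx proj₁

        ofʸ′ : Point (Hyp y) → Point (Common x y)
        ofʸ′ V = re V λ { {zero} (xp , _) → contradiction xp x-p ; {suc h} (_ , yh) → on V ((λ ()) , yh) }

      -- As `x` is off `p`, the edge runs along the line `Hyp y`, which contains `w′` and `d S′`;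
      -- hence `Z` is `±d S′`.
      off-generic : (N′ : New y) (w′-g : New.w N′ at suc g ≢ 𝟎) (S′ : Slope N′ g) →
                    Result s t {x} (old ox) (generic N′ w′-g S′) (Z at suc f)
      off-generic N′ w′-g S′ with x ≟ᵥ vec (New.w N′)
      ... | yes x≡w′ = record { up = subst (λ W → Le s t (tail x) (tail W)) x≡w′ (le-refl s t) ; back = λ _ → level }
        where
        module N′ = New N′
        Z≈d′ : vec Z ≈± vec (d S′)
        Z≈d′ = line Z (ofʸ′ (d S′)) X (suc g) (Direction.infinite dir) (d-g S′) (≡±⇒≢𝟎 x-g)
        Ze : Z at e N′.i ≡ y ! e N′.i
        Ze = OnColine.forwardʳ line dir (trans (cong (_! e N′.i) x≡w′) N′.w-e) (proj₂ N′.first)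
        Zf≡d′f : Z at suc f ≡ d S′ at suc f
        Zf≡d′f = cong (_! suc f) (≈±-agree Z≈d′ (≢𝟎-resp (sym Ze) (proj₂ N′.first)) (trans Ze (sym (d-e S′))))
        nn : Nonneg t (d S′ at suc f)
        nn = subst (Nonneg t) Zf≡d′f Z-f
        level : Level t {x} (old ox) (generic N′ w′-g S′) (Z at suc f)
        level = record { mono = (λ ()) , (λ eq → contradiction eq (nonneg-≢ nn)) ; still = λ _ q → trans Zf≡d′f q
                       ; rise = λ _ _ _ → nn ; fall = λ _ _ _ → inj₁ refl }
      ... | no x≢w′ = record
        { up = le-step′ euclidean g f line p∉line dir₁ ox N′.w-old s t x-g Z-f
        ; back = λ b → let z = le-level′ euclidean g f line p∉line dir₁ ox N′.w-old s t x-g Z-f b in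
                       level-zero {κ = old ox} {μ = generic N′ w′-g S′} refl (≈±-zero (≈±-sym Z≈d′) z) z }
        where
        module N′ = New N′
        Z≈d′ : vec Z ≈± vec (d S′)
        Z≈d′ = line Z (ofʸ′ (d S′)) X (suc g) (Direction.infinite dir) (d-g S′) (≡±⇒≢𝟎 x-g)
        agree : x ! suc g ≡ N′.w at suc g
        agree = trans x-g (trans (sym y-g) (N′.near w′-g))
        witness : ∃[ h ] x ! suc h ≡ 𝟎 × N′.w at suc h ≢ 𝟎
        witness with distinguish cx (coc N′.w) (λ eq → x≢w′ (≈±-agree eq (≡±⇒≢𝟎 x-g) agree))
        ... | zero , xp , _ = contradiction xp x-p
        ... | suc h , xh , wh = h , xh , wh
        dir₁ : Direction (suc g) X (ofʸ′ N′.w) Z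
        dir₁ = let h , xh , wh = witness ; yh = N′.near wh in
          OnColine.direction-byʳ line x≢w′ agree (≡±⇒≢𝟎 x-g) (Direction.infinite dir) xh wh
            (trans (OnColine.forwardʳ line dir xh (≢𝟎-resp (sym yh) wh)) yh)

      off-base : (N′ : New y) (w′-g : New.w N′ at suc g ≡ 𝟎) (w′-f : New.w N′ at suc f ≡ 𝟎) (u : Point (Hyp y)) (u-old : Old (vec u))
                 (u-g : u at suc g ≡ y ! suc g) → Result s t {x} (old ox) (base N′ w′-g w′-f u u-old u-g) (Z at suc f)
      off-base N′ w′-g w′-f u u-old u-g = record
        { up = level-line line p∉line X (ofʸ′ u) (ofʸ′ (New.w N′)) ox u-old x-g (trans u-g y-g) w′-g w′-f t
        ; back = λ _ → level-zero {κ = old ox} {μ = base N′ w′-g w′-f u u-old u-g} refl refl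
            (≈±-zero (line Z (ofʸ′ (New.w N′)) X (suc g) (Direction.infinite dir) w′-g (≡±⇒≢𝟎 x-g)) w′-f) }

  orient : ∀ {A} (X : Point A) {h x} → X at h ≢ 𝟎 → x ≢ 𝟎 → Σ (Point A) λ X′ → X′ at h ≡ x × vec X′ ≈± vec X
  orient X {h} Xh x≢0 with same-or-opposite Xh x≢0
  ... | inj₁ eq = X , eq , inj₁ refl
  ... | inj₂ eq = ⊖ X , trans (!-neg (vec X) h) (trans (cong neg eq) (neg² _)) , inj₂ refl

  old-off-p : ∀ {V} (N : New V) (X : Point (Hyp V)) → Old (vec X) → X at zero ≢ 𝟎
  old-off-p {V} N X oX Xp with on-p⇒self (New.cV N) (New.new N) X Xp
  ... | inj₁ eq = New.new N (subst Old eq oX)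
  ... | inj₂ eq = New.new N (subst M.Cocircuit (trans (cong (λ V → tail (-ᵥ V)) eq) (trans (cong tail (-ᵥ² V)) refl))
                     (subst M.Cocircuit (sym (tail-neg (vec X))) (M.symmetric oX)))

  -- On the line through a base vertex y, f and g are parallel: y can be replaced by any old point u.
  module Base {s t x y} (E : Edge s t x y) (x-p : x ! zero ≡ 𝟎) (N′ : New y) (w′-g : New.w N′ at suc g ≡ 𝟎)
              (w′-f : New.w N′ at suc f ≡ 𝟎) (u : Point (Hyp y)) (u-old : Old (vec u)) (u-g : u at suc g ≡ y ! suc g) where
    open Edge E
    private module N′ = New N′
    open OnP E x-p N′.V-p

    κ′ : Kind y
    κ′ = base N′ w′-g w′-f u u-old u-g

    y-g≢0 : y ! suc g ≢ 𝟎
    y-g≢0 = ≡±⇒≢𝟎 y-g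

    w′C : Point (K ∪₁ suc g)
    w′C = ofʸ N′.w ⊕ w′-g

    a = proj₁ only-x
    ya = proj₁ (proj₂ only-x)
    xa = proj₂ (proj₂ only-x)

    w′a : N′.w at suc a ≡ 𝟎
    w′a = on N′.w ((λ ()) , ya)

    Za : Z at suc a ≡ neg (x ! suc a)
    Za = Zˣ ya xa

    -- `a` and `f` both vanish at `w′`, so they are parallel at infinity. This allows `Z` to be
    -- traded for the direction of a substitute edge between old points.
    same-f : (V : Point (K ∪₁ suc g)) → Z at suc a ≡ V at suc a → Z at suc f ≡ V at suc f
    same-f V eq = OnColine.parallel C-line w′C ZC V w′a w′-f (≢𝟎-resp (sym Za) (neg-≢𝟎 xa)) eq

    -- The point where the line of y meets an element b not vanishing at w′.
    record Crossing (b : Fin n) : Set where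
      field
        v     : Point (Hyp y)
        v-b   : v at suc b ≡ 𝟎
        v-g   : v at suc g ≡ y ! suc g
        v-old : Old (vec v)

      v-a : v at suc a ≡ 𝟎
      v-a = on v ((λ ()) , ya)

      v≲u : Le s t (tail (vec v)) (tail (vec u))
      v≲u = level-line N′.line (p∉Hyp y) v u N′.w v-old u-old (trans v-g y-g) (trans u-g y-g) w′-g w′-f t

    abstract
      crossing : ∀ b → N′.w at suc b ≢ 𝟎 → Crossing b
      crossing b wb with V , Vb ← meet N′.me N′.w (λ eq → N′.w-p (≈±-zero′ eq N′.V-p)) (suc b)
        with V′ , V′g , V′≈ ← orient V {suc g} (λ Vg → wb (≈±-zero′ (N′.line V N′.w N′.me (suc g) Vg w′-g y-g≢0) Vb)) y-g≢0
        = record { v = V′ ; v-b = V′b ; v-g = V′g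
                 ; v-old = off-p⇒old (coc V′) λ V′p → ≢𝟎-resp (sym (N′.near wb)) wb (≈±-zero′ (on-p⇒self N′.cV N′.new V′ V′p) V′b) }
        where
        V′b : V′ at suc b ≡ 𝟎
        V′b = ≈±-zero V′≈ Vb

    module Transverse {b} (xb : x ! suc b ≡ 𝟎) (w′b : N′.w at suc b ≢ 𝟎) where

      private module X′ = Crossing (crossing b w′b)
      open X′ using (v; v-b; v-old; v-a; v≲u)

      lineb : Coline (K ∪₁ suc b)
      lineb = K-line (suc b) y∈K (≢𝟎-resp (sym (N′.near w′b)) w′b)

      xB vB : Point (K ∪₁ suc b)
      xB = x∈K ⊕ xb
      vB = ofʸ v ⊕ v-b

      v-s : v at suc g ≡ ± s
      v-s = trans X′.v-g y-g

      found = directed {g = suc g} xB vB (λ eq → xa (trans (cong (_! suc a) eq) v-a)) (trans x-g (sym v-s)) (≡±⇒≢𝟎 x-g)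

      Z″ : Point (K ∪₁ suc b)
      Z″ = proj₁ found

      dir″ : Direction (suc g) xB vB Z″
      dir″ = proj₂ found

      Z″-g : Z″ at suc g ≡ 𝟎
      Z″-g = Direction.infinite dir″

      Z″a : Z″ at suc a ≡ neg (x ! suc a)
      Z″a = OnColine.forwardˡ lineb dir″ v-a xa

      Zf : Z at suc f ≡ Z″ at suc f
      Zf = same-f (re Z″ (on Z″ ∘′ inj₁) ⊕ Z″-g) (trans Za (sym Z″a))

      Z″-f : Nonneg t (Z″ at suc f)
      Z″-f = subst (Nonneg t) Zf Z-f

      from-old : (ox : Old x) → Result s t {x} (old ox) κ′ (Z at suc f)
      from-old ox = record
        { up = le-trans s t (le-step′ euclidean g f lineb p∉ dir″ ox v-old s t x-g Z″-f) v≲u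
        ; back = λ q → level-zero {κ = old ox} {μ = κ′} refl refl
            (trans Zf (le-level′ euclidean g f lineb p∉ dir″ ox v-old s t x-g Z″-f (le-trans s t v≲u q))) }

      from-base : (N : New x) (w-g : New.w N at suc g ≡ 𝟎) (w-f : New.w N at suc f ≡ 𝟎) (u₀ : Point (Hyp x)) (u₀-old : Old (vec u₀))
                  (u₀-g : u₀ at suc g ≡ x ! suc g) → Result s t (base N w-g w-f u₀ u₀-old u₀-g) κ′ (Z at suc f)
      from-base N w-g w-f u₀ u₀-old u₀-g = record
        { up = le-trans s t (level-line lineb p∉ (onB u₀) vB (onB w) u₀-old v-old (trans u₀-g x-g) v-s w-g w-f t) v≲u
        ; back = λ _ → level-zero {κ = base N w-g w-f u₀ u₀-old u₀-g} {μ = κ′} refl refl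
            (trans Zf (≈±-zero (lineb Z″ (onB w) xB (suc g) Z″-g w-g (≡±⇒≢𝟎 x-g)) w-f)) }
        where
        open New N using (w)
        onB : Point (Hyp x) → Point (K ∪₁ suc b)
        onB V = ofˣ V ⊕ on V ((λ ()) , xb)

      from-generic : (N : New x) (w-g : New.w N at suc g ≢ 𝟎) (S : Slope N g) → Result s t (generic N w-g S) κ′ (Z at suc f)
      from-generic N w-g S with vec (New.w N) ≟ᵥ vec v
      ... | yes w≡v = record { up = subst (λ W → Le s t (tail W) (tail (vec u))) (sym w≡v) v≲u ; back = λ _ → level }
        where
        open New N hiding (Slope; module Slope; line)
        dB : Point (K ∪₁ suc b)
        dB = ofˣ (d S) ⊕ on (d S) ((λ ()) , xb)
        Z″e : Z″ at e i ≡ neg (x ! e i)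
        Z″e = OnColine.forwardˡ lineb dir″ (trans (cong (_! e i) (sym w≡v)) w-e) (proj₂ first)
        Z″≡-d : vec Z″ ≡ vec (⊖ dB)
        Z″≡-d = ≈±-agree (lineb Z″ (⊖ dB) xB (suc g) Z″-g (trans (!-neg (vec (d S)) (suc g)) (neg-zero (d-g S))) (≡±⇒≢𝟎 x-g))
                  (≢𝟎-resp (sym Z″e) (neg-≢𝟎 (proj₂ first)))
                  (trans Z″e (trans (cong neg (sym (d-e S))) (sym (!-neg (vec (d S)) (e i)))))
        Zf≡-d : Z at suc f ≡ neg (d S at suc f)
        Zf≡-d = trans Zf (trans (cong (_! suc f) Z″≡-d) (!-neg (vec (d S)) (suc f)))
        nn : Nonneg (opposite t) (d S at suc f)
        nn = subst (Nonneg (opposite t)) (trans (cong neg Zf≡-d) (neg² _)) (nonneg-neg Z-f)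
        level : Level t (generic N w-g S) κ′ (Z at suc f)
        level = record
          { mono = (λ eq → contradiction (trans Zf≡-d (cong neg eq)) (nonneg-≢ Z-f)) , λ ()
          ; still = λ p _ → trans Zf≡-d (neg-zero p) ; rise = λ _ _ _ → inj₁ refl ; fall = λ _ _ _ → nn }
      ... | no w≢v = record
        { up = le-trans s t (le-step′ euclidean g f lineb p∉ dir₁ w-old v-old s t w-s Z″-f) v≲u
        ; back = λ q → let z = le-level′ euclidean g f lineb p∉ dir₁ w-old v-old s t w-s Z″-f (le-trans s t v≲u q) in
            level-zero {κ = generic N w-g S} {μ = κ′}
              (≈±-zero (lineb dB Z″ xB (suc g) (d-g S) Z″-g (≡±⇒≢𝟎 x-g)) z) refl (trans Zf z) }
        where
        open New N hiding (Slope; module Slope; line)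
        dB wB : Point (K ∪₁ suc b)
        dB = ofˣ (d S) ⊕ on (d S) ((λ ()) , xb)
        wB = ofˣ w ⊕ on w ((λ ()) , xb)
        w-s : w at suc g ≡ ± s
        w-s = trans (sym (near w-g)) x-g
        wa : w at suc a ≢ 𝟎
        wa p = w≢v (≈±-agree (lineb wB vB xB (suc a) p v-a xa) w-g (trans w-s (sym v-s)))
        dir₁ : Direction (suc g) wB vB Z″
        dir₁ = OnColine.direction-byˡ lineb w≢v (trans w-s (sym v-s)) w-g Z″-g v-a wa (trans Z″a (cong neg (near wa)))

    -- Both x and y lie on lines through w′.
    module Concurrent (N : New x) (sub : ∀ h → x ! suc h ≡ 𝟎 → N′.w at suc h ≡ 𝟎)
                      (u₁ : Point (Hyp x)) (u₁-old : Old (vec u₁)) (u₁-s : u₁ at suc g ≡ ± s) where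
      w′ˣ : Point (Hyp x)
      w′ˣ = re N′.w λ { {zero} (p , _) → contradiction refl p ; {suc h} (_ , xh) → sub h xh }

      witness : ∃[ b ] u₁ at suc b ≡ 𝟎 × N′.w at suc b ≢ 𝟎
      witness with distinguish (coc u₁) (coc N′.w) (λ eq → ≡±⇒≢𝟎 u₁-s (≈±-zero eq w′-g))
      ... | zero , u₁p , _ = contradiction u₁p (old-off-p N u₁ u₁-old)
      ... | suc b , ub , wb = b , ub , wb

      b = proj₁ witness
      u₁b = proj₁ (proj₂ witness)
      w′b = proj₂ (proj₂ witness)

      private module X′ = Crossing (crossing b w′b)
      open X′ using (v; v-b; v-old; v-a; v≲u)

      lineb : Coline (K ∪₁ suc b)
      lineb = K-line (suc b) y∈K (≢𝟎-resp (sym (N′.near w′b)) w′b)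

      u₁B vB : Point (K ∪₁ suc b)
      u₁B = ofˣ u₁ ⊕ u₁b
      vB = ofʸ v ⊕ v-b

      xa≡u₁a : x ! suc a ≡ u₁ at suc a
      xa≡u₁a = OnColine.parallel (New.line N) w′ˣ (New.me N) u₁ w′-g w′a (≡±⇒≢𝟎 x-g) (trans x-g (sym u₁-s))

      u₁a : u₁ at suc a ≢ 𝟎
      u₁a = ≢𝟎-resp xa≡u₁a xa

      found = directed {g = suc g} u₁B vB (λ eq → u₁a (trans (cong (_! suc a) eq) v-a)) (trans u₁-s (sym (trans X′.v-g y-g))) (≡±⇒≢𝟎 u₁-s)

      Z″ : Point (K ∪₁ suc b)
      Z″ = proj₁ found

      dir″ : Direction (suc g) u₁B vB Z″
      dir″ = proj₂ found

      Zf : Z at suc f ≡ Z″ at suc f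
      Zf = same-f (re Z″ (on Z″ ∘′ inj₁) ⊕ Direction.infinite dir″)
             (trans Za (trans (cong neg xa≡u₁a) (sym (OnColine.forwardˡ lineb dir″ v-a u₁a))))

      Z″-f : Nonneg t (Z″ at suc f)
      Z″-f = subst (Nonneg t) Zf Z-f

      result : (κ : Kind x) → position κ ≡ tail (vec u₁) → drift κ ≡ 𝟎 → Result s t κ κ′ (Z at suc f)
      result κ pos drift₀ = record
        { up = subst (λ W → Le s t W (tail (vec u))) (sym pos)
                 (le-trans s t (le-step′ euclidean g f lineb p∉ dir″ u₁-old v-old s t u₁-s Z″-f) v≲u)
        ; back = λ q → level-zero {κ = κ} {μ = κ′} drift₀ refl
            (trans Zf (le-level′ euclidean g f lineb p∉ dir″ u₁-old v-old s t u₁-s Z″-f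
              (le-trans s t v≲u (subst (λ W → Le s t (tail (vec u)) W) pos q)))) }

    -- An element `b` vanishing at `x` but not at `w′` cuts the line of `y` in an old point `v`, and
    -- `K ∪₁ suc b` is an old line joining it to `x`. If there is no such `b`, then `w′` lies on the
    -- line of `x` too.
    to-base : (κ : Kind x) → Result s t κ κ′ (Z at suc f)
    to-base κ with any? (λ b → (x ! suc b ≟₀ 𝟎) ×-dec ¬? (N′.w at suc b ≟₀ 𝟎))
    to-base (old ox) | yes (b , xb , w′b) = Transverse.from-old xb w′b ox
    to-base (generic N w-g S) | yes (b , xb , w′b) = Transverse.from-generic xb w′b N w-g S
    to-base (base N w-g w-f u₀ u₀-old u₀-g) | yes (b , xb , w′b) = Transverse.from-base xb w′b N w-g w-f u₀ u₀-old u₀-g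
    to-base (old ox) | no none = ⊥-elim (none witness)
      where
      witness : ∃[ b ] x ! suc b ≡ 𝟎 × N′.w at suc b ≢ 𝟎
      witness with b , xb , wb ← M.distinguish {tail x} {tail (vec N′.w)} ox N′.w-old
                     (λ eq → ≡±⇒≢𝟎 x-g (trans (sym (!-tail x g)) (≈±-zero eq (trans (!-tail (vec N′.w) g) w′-g))))
        = b , trans (sym (!-tail x b)) xb , ≢𝟎-resp (!-tail (vec N′.w) b) wb
    to-base κ@(generic N w-g S) | no none = Concurrent.result N sub (New.w N) (New.w-old N) (trans (sym (New.near N w-g)) x-g) κ refl
        (≈±-zero (New.line N (d S) (Concurrent.w′ˣ N sub (New.w N) (New.w-old N) (trans (sym (New.near N w-g)) x-g)) (New.me N) (suc g) (d-g S) w′-g (≡±⇒≢𝟎 x-g)) w′-f)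
      where
      sub : ∀ h → x ! suc h ≡ 𝟎 → N′.w at suc h ≡ 𝟎
      sub h xh = decidable-stable (N′.w at suc h ≟₀ 𝟎) λ wh → none (h , xh , wh)
    to-base κ@(base N w-g w-f u₀ u₀-old u₀-g) | no none = Concurrent.result N sub u₀ u₀-old (trans u₀-g x-g) κ refl refl
      where
      sub : ∀ h → x ! suc h ≡ 𝟎 → N′.w at suc h ≡ 𝟎
      sub h xh = decidable-stable (N′.w at suc h ≟₀ 𝟎) λ wh → none (h , xh , wh)

  ≢⇒opposite : ∀ {c t : Sign} → c ≢ t → c ≡ opposite t
  ≢⇒opposite {Sign.+} {Sign.+} c≢t = contradiction refl c≢t
  ≢⇒opposite {Sign.+} {Sign.-} _ = refl
  ≢⇒opposite {Sign.-} {Sign.+} _ = refl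
  ≢⇒opposite {Sign.-} {Sign.-} c≢t = contradiction refl c≢t

  private
    via-flip : ∀ {s t x y} (E : Edge s t x y) {κ : Kind x} {μ : Kind y} →
               Result s (opposite t) μ κ (Edge.Z (flip E) at suc f) → Result s t κ μ (Edge.Z E at suc f)
    via-flip E {κ} {μ} R = unflip (subst (Result _ _ μ κ) (!-neg (vec (Edge.Z E)) (suc f)) R)

  -- Each pair of kinds is treated for one orientation of the edge; `via-flip` reverses the edge
  -- together with `t`.
  edge-result : ∀ {s t x y} (E : Edge s t x y) (κ : Kind x) (μ : Kind y) → Result s t κ μ (Edge.Z E at suc f)
  edge-result E (old ox) (old oy) = old-old E ox oy
  edge-result {x = x} E (old ox) (generic N′ w′-g S′) with x ! zero ≟₀ 𝟎
  ... | yes xp = via-flip E {old ox} (generic-old (flip E) (New.V-p N′) xp N′ w′-g S′ ox)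
  ... | no xp = off-generic E xp ox N′ w′-g S′
  edge-result {y = y} E (generic N w-g S) (old oy) with y ! zero ≟₀ 𝟎
  ... | yes yp = generic-old E (New.V-p N) yp N w-g S oy
  ... | no yp = via-flip E {μ = old oy} (off-generic (flip E) yp oy N w-g S)
  edge-result E (generic N w-g S) (generic N′ w′-g S′) with <ᶠ-cmp (New.i N) (New.i N′)
  ... | tri< i<i′ _ _ = generic-higher E (New.V-p N) (New.V-p N′) N w-g S N′ w′-g S′ i<i′
  ... | tri≈ _ i≡i′ _ = SameIndex.generic-same E (New.V-p N) (New.V-p N′) N w-g S N′ w′-g S′ i≡i′
  ... | tri> _ _ i′<i = via-flip E (generic-higher (flip E) (New.V-p N′) (New.V-p N) N′ w′-g S′ N w-g S i′<i)
  edge-result {x = x} E (old ox) (base N′ w′-g w′-f u u-old u-g) with x ! zero ≟₀ 𝟎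
  ... | yes xp = Base.to-base E xp N′ w′-g w′-f u u-old u-g (old ox)
  ... | no xp = off-base E xp ox N′ w′-g w′-f u u-old u-g
  edge-result {y = y} E (base N w-g w-f u u-old u-g) (old oy) with y ! zero ≟₀ 𝟎
  ... | yes yp = via-flip E {μ = old oy} (Base.to-base (flip E) yp N w-g w-f u u-old u-g (old oy))
  ... | no yp = via-flip E {μ = old oy} (off-base (flip E) yp oy N w-g w-f u u-old u-g)
  edge-result E κ@(generic N _ _) (base N′ w′-g w′-f u u-old u-g) = Base.to-base E (New.V-p N) N′ w′-g w′-f u u-old u-g κ
  edge-result E κ@(base N _ _ _ _ _) (base N′ w′-g w′-f u u-old u-g) = Base.to-base E (New.V-p N) N′ w′-g w′-f u u-old u-g κ
  edge-result E (base N w-g w-f u u-old u-g) μ@(generic N′ _ _) = via-flip E (Base.to-base (flip E) (New.V-p N′) N w-g w-f u u-old u-g μ)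

  -- Closed walks whose vertices all have a kind

  Vertex : Set
  Vertex = Σ (SignVector (suc n)) Kind

  record Generic (v : Vertex) : Set where
    constructor gen
    field
      N   : New (proj₁ v)
      w-g : New.w N at suc g ≢ 𝟎
      S   : Slope N g
      is  : proj₂ v ≡ generic N w-g S

  drifting : (v : Vertex) → drift (proj₂ v) ≢ 𝟎 → Generic v
  drifting (_ , old _) nz = contradiction refl nz
  drifting (_ , generic N w-g S) nz = gen N w-g S refl
  drifting (_ , base _ _ _ _ _ _) nz = contradiction refl nz

  -- The slope d as a cocircuit of O; junk for vertices that have none.
  slope-of : Vertex → SignVector n
  slope-of (_ , generic _ _ S) = tail (vec (d S))
  slope-of (_ , old _) = 0ᵥ
  slope-of (_ , base _ _ _ _ _ _) = 0ᵥ

  module Closed {s t} {m : ℕ} (Q : Fin (suc m) → Vertex) (closed : Q (fromℕ m) ≡ Q zero)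
                (E : ∀ l → Edge s t (proj₁ (Q (inject₁ l))) (proj₁ (Q (suc l)))) where

    P : Fin (suc m) → SignVector (suc n)
    P l = proj₁ (Q l)

    κ : ∀ l → Kind (P l)
    κ l = proj₂ (Q l)

    Zf : Fin m → Sign₀
    Zf l = Edge.Z (E l) at suc f

    abstract
      level : ∀ l → Level t (κ (inject₁ l)) (κ (suc l)) (Zf l)
      level l = Result.back (edge-result (E l) (κ (inject₁ l)) (κ (suc l)))
        (cyclic (λ v v′ → Le s t (position (proj₂ v)) (position (proj₂ v′))) (le-refl s t) (le-trans s t) Q closed
          (λ l → Result.up (edge-result (E l) (κ (inject₁ l)) (κ (suc l)))) (suc l) (inject₁ l))

      drift-constant : ∀ l l′ → drift (κ l) ≡ drift (κ l′)
      drift-constant l l′ = mono-antisym t (mono l l′) (mono l′ l)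
        where
        mono : ∀ l l′ → Mono t (drift (κ l)) (drift (κ l′))
        mono = cyclic (λ v v′ → Mono t (drift (proj₂ v)) (drift (proj₂ v′))) (λ {v} → mono-refl {x = drift (proj₂ v)})
                 (λ {v} {v′} {v″} → mono-trans {x = drift (proj₂ v)} {drift (proj₂ v′)} {drift (proj₂ v″)}) Q closed λ l → Level.mono (level l)

    module Drifting (c : Sign) (drift-c : ∀ l → drift (κ l) ≡ ± c) where

      G : ∀ l → Generic (Q l)
      G l = drifting (Q l) (≡±⇒≢𝟎 (drift-c l))

      module Gen l = Generic (G l)

      -- With the drift fixed at `± c`, `fall` is impossible if `c` is `t` and `rise` is impossible
      -- otherwise, so the index is monotone around the walk.
      index-constant : ∀ l l′ → index (P l) ≡ index (P l′)
      index-constant l l′ with c ≟ₛ t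
      ... | yes c≡t = ≤-antisym (mono l l′) (mono l′ l)
        where
        mono = cyclic (λ v v′ → index (proj₁ v) ≤ index (proj₁ v′)) ≤-refl ≤-trans Q closed λ l →
          subst₂ _≤_ (sym (index-first (New.first (Gen.N (inject₁ l))))) (sym (index-first (New.first (Gen.N (suc l)))))
            (≮⇒≥ λ j<i → nonneg-≢ (Level.fall (level l) (New.first (Gen.N (inject₁ l))) (New.first (Gen.N (suc l))) j<i)
              (trans (drift-c _) (cong ± (trans c≡t (sym (opposite² t))))))
      ... | no c≢t = ≤-antisym (mono l′ l) (mono l l′)
        where
        mono = cyclic (λ v v′ → index (proj₁ v′) ≤ index (proj₁ v)) ≤-refl (λ p q → ≤-trans q p) Q closed λ l →
          subst₂ _≤_ (sym (index-first (New.first (Gen.N (suc l))))) (sym (index-first (New.first (Gen.N (inject₁ l)))))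
            (≮⇒≥ λ i<j → nonneg-≢ (Level.rise (level l) (New.first (Gen.N (inject₁ l))) (New.first (Gen.N (suc l))) i<j)
              (trans (drift-c _) (cong ± (≢⇒opposite c≢t))))

      lead : Fin k
      lead = New.i (Gen.N zero)

      abstract
        i≡lead : ∀ l → New.i (Gen.N l) ≡ lead
        i≡lead l = toℕ-injective (trans (sym (index-first (New.first (Gen.N l)))) (trans (index-constant l zero) (index-first (New.first (Gen.N zero)))))

      module S l = SameIndex (E l) (New.V-p (Gen.N (inject₁ l))) (New.V-p (Gen.N (suc l))) (Gen.N (inject₁ l)) (Gen.w-g (inject₁ l)) (Gen.S (inject₁ l))
                     (Gen.N (suc l)) (Gen.w-g (suc l)) (Gen.S (suc l)) (trans (i≡lead (inject₁ l)) (sym (i≡lead (suc l))))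
      module OP l = OnP (E l) (New.V-p (Gen.N (inject₁ l))) (New.V-p (Gen.N (suc l)))

      Z₁ : ∀ l → Point (OP.K l ∪₁ suc g)
      Z₁ l = S.Z₁ l

      dₗ : ∀ l → Point (Hyp (P l))
      dₗ l = d (Gen.S l)

      d-lead : ∀ l → dₗ l at e lead ≡ P l ! e lead
      d-lead l = subst (λ i → dₗ l at e i ≡ P l ! e i) (i≡lead l) (d-e (Gen.S l))

      lead-constant : ∀ l l′ → P l ! e lead ≡ P l′ ! e lead
      lead-constant = cyclic (λ v v′ → proj₁ v ! e lead ≡ proj₁ v′ ! e lead) refl trans Q closed λ l →
        subst (λ i → P (inject₁ l) ! e i ≡ P (suc l) ! e i) (i≡lead (inject₁ l)) (S.x-e≡y-e l)

      slope-sign : ∃[ r ] P zero ! e lead ≡ ± r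
      slope-sign = nonzero-± (proj₂ (New.first (Gen.N zero)))

      r : Sign
      r = proj₁ slope-sign

      d-sign : ∀ l → dₗ l at e lead ≡ ± r
      d-sign l = trans (d-lead l) (trans (lead-constant l zero) (proj₂ slope-sign))

      position-w : ∀ l → position (κ l) ≡ tail (vec (New.w (Gen.N l)))
      position-w l = cong position (Gen.is l)

      slope-d : ∀ l → slope-of (Q l) ≡ tail (vec (dₗ l))
      slope-d l = cong (λ κ → slope-of (P l , κ)) (Gen.is l)

      d-oldₗ : ∀ l → P l ! suc g ≢ 𝟎 → Old (vec (dₗ l))
      d-oldₗ l = Slope.d-old (Gen.S l)

      module _ (h : Fin n) (t′ : Sign) (nonneg : ∀ l → Nonneg t′ (Z₁ l at suc h)) where
        private
          module Lw = Levels O euclidean g h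
          module Ld = Levels O euclidean (lookup I lead) h

          w-step : ∀ l → Lw.Le s t′ (position (κ (inject₁ l))) (position (κ (suc l)))
          w-step l = subst₂ (Lw.Le s t′) (sym (position-w (inject₁ l))) (sym (position-w (suc l))) step
            where
            step : Lw.Le s t′ (tail (vec (New.w (Gen.N (inject₁ l))))) (tail (vec (New.w (Gen.N (suc l)))))
            step with S.move l
            ... | inj₁ dir₁ = le-step′ euclidean g h (S.B-line l) (OP.p∉ l) dir₁ (New.w-old (Gen.N (inject₁ l))) (New.w-old (Gen.N (suc l))) s t′ (S.w-s l) (nonneg l)
            ... | inj₂ (w≡w′ , _) = subst (λ W → Lw.Le s t′ (tail (vec (New.w (Gen.N (inject₁ l))))) (tail W)) w≡w′ (Lw.le-refl s t′)

          w-back : ∀ l → Lw.Le s t′ (tail (vec (New.w (Gen.N (suc l))))) (tail (vec (New.w (Gen.N (inject₁ l)))))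
          w-back l = subst₂ (Lw.Le s t′) (position-w (suc l)) (position-w (inject₁ l))
            (cyclic (λ v v′ → Lw.Le s t′ (position (proj₂ v)) (position (proj₂ v′))) (Lw.le-refl s t′) (Lw.le-trans s t′) Q closed w-step (suc l) (inject₁ l))

          d-old₁ : ∀ l → Old (vec (dₗ (inject₁ l)))
          d-old₁ l = d-oldₗ (inject₁ l) (≡±⇒≢𝟎 (Edge.x-g (E l)))

          d-old₂ : ∀ l → Old (vec (dₗ (suc l)))
          d-old₂ l = d-oldₗ (suc l) (≡±⇒≢𝟎 (Edge.y-g (E l)))

          turn : ∀ l {Z₂} → Direction (e (New.i (Gen.N (inject₁ l)))) (S.dC l) (S.d′C l) Z₂ → Direction (e lead) (S.dC l) (S.d′C l) Z₂
          turn l = subst (λ i → Direction (e i) (S.dC l) (S.d′C l) _) (i≡lead (inject₁ l))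

          d-step : ∀ l → Ld.Le r t′ (slope-of (Q (inject₁ l))) (slope-of (Q (suc l)))
          d-step l = subst₂ (Ld.Le r t′) (sym (slope-d (inject₁ l))) (sym (slope-d (suc l))) step
            where
            step : Ld.Le r t′ (tail (vec (dₗ (inject₁ l)))) (tail (vec (dₗ (suc l))))
            step with S.move l | vec (dₗ (inject₁ l)) ≟ᵥ vec (dₗ (suc l))
            ... | inj₂ (_ , dir₁) | _ = le-step′ euclidean _ h (OP.C-line l) (OP.p∉ l) (turn l dir₁) (d-old₁ l) (d-old₂ l) r t′ (d-sign (inject₁ l)) (nonneg l)
            ... | inj₁ _ | yes d≡d′ = subst (λ W → Ld.Le r t′ (tail (vec (dₗ (inject₁ l)))) (tail W)) d≡d′ (Ld.le-refl r t′)
            -- Where the position moves, no sign is given for the direction from `d` to `d′`. But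
            -- its point at infinity is `±Z₁`, and there `h` already vanishes because the walk of
            -- the `w` is level.
            ... | inj₁ dir₁ | no d≢d′ with Z₂ , dir₂ ← directed {g = e (New.i (Gen.N (inject₁ l)))} (S.dC l) (S.d′C l) d≢d′ (S.d≡d′ l) (d-e≢0 (Gen.S (inject₁ l))) =
              le-step′ euclidean _ h (OP.C-line l) (OP.p∉ l) (turn l dir₂) (d-old₁ l) (d-old₂ l) r t′ (d-sign (inject₁ l))
                (inj₁ (≈±-zero (≈±-sym (OnColine.direction-unique (OP.C-line l) dir₂ (Z₁ l) (S.Z₁-e l)))
                  (le-level′ euclidean g h (S.B-line l) (OP.p∉ l) dir₁ (New.w-old (Gen.N (inject₁ l))) (New.w-old (Gen.N (suc l))) s t′ (S.w-s l) (nonneg l) (w-back l))))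

          d-back : ∀ l → Ld.Le r t′ (tail (vec (dₗ (suc l)))) (tail (vec (dₗ (inject₁ l))))
          d-back l = subst₂ (Ld.Le r t′) (slope-d (suc l)) (slope-d (inject₁ l))
            (cyclic (λ v v′ → Ld.Le r t′ (slope-of v) (slope-of v′)) (Ld.le-refl r t′) (Ld.le-trans r t′) Q closed d-step (suc l) (inject₁ l))

        target-level : ∀ l → Z₁ l at suc h ≡ 𝟎
        target-level l with S.move l
        ... | inj₁ dir₁ = le-level′ euclidean g h (S.B-line l) (OP.p∉ l) dir₁ (New.w-old (Gen.N (inject₁ l))) (New.w-old (Gen.N (suc l))) s t′ (S.w-s l) (nonneg l) (w-back l)
        ... | inj₂ (_ , dir₁) = le-level′ euclidean _ h (OP.C-line l) (OP.p∉ l) (turn l dir₁) (d-old₁ l) (d-old₂ l) r t′ (d-sign (inject₁ l)) (nonneg l) (d-back l)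

      Z₁-old : ∀ l → Old (vec (Z₁ l))
      Z₁-old l with S.move l
      ... | inj₁ dir₁ = Off.old-direction (S.B-line l) (OP.p∉ l) dir₁
      ... | inj₂ (_ , dir₁) = Off.old-direction (OP.C-line l) (OP.p∉ l) dir₁

      Z₁f-zero : ∀ l → Z₁ l at suc f ≡ 𝟎
      Z₁f-zero = target-level f t S.Z₁-f

      d-f : ∀ l → dₗ l at suc f ≡ ± c
      d-f l = trans (cong drift (sym (Gen.is l))) (drift-c l)

      near-lead : ∀ l → lookup α lead *₀ (Edge.Z (E l) at e lead) ≡ neg (Z₁ l at zero)
      near-lead l = subst (λ i → lookup α i *₀ (Edge.Z (E l) at e i) ≡ neg (Z₁ l at zero)) (i≡lead (inject₁ l)) (S.near-p₁ l)

      Z₁p-zero : ∀ l → Z₁ l at zero ≡ 𝟎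
      Z₁p-zero l = trans (old-σ (coc (Z₁ l)) (Z₁-old l)) (lexσ-level (λ l → tail (vec (Z₁ l)))
          (λ h t′ nonneg l → trans (!-tail (vec (Z₁ l)) h) (target-level h t′ (λ l → subst (Nonneg t′) (!-tail (vec (Z₁ l)) h) (nonneg l)) l))
          I α _ (λ l → subst (Nonneg _) (old-σ (coc (Z₁ l)) (Z₁-old l))
            (transfer-sign (lookup α lead) r t c (compared l) (Edge.Z-f (E l)) (near-lead l))) l)
        where
        compared : ∀ l → let Z = Edge.Z (E l) in Z at e lead ≡ 𝟎 ⊎ (Z at e lead ≡ ± r × Z at suc f ≡ ± c) ⊎ (Z at e lead ≡ neg (± r) × Z at suc f ≡ neg (± c))
        compared l with subst (λ i → let Z = Edge.Z (E l) in Z at e i ≡ 𝟎 ⊎ (Z at e i ≡ dₗ (inject₁ l) at e i × Z at suc f ≡ dₗ (inject₁ l) at suc f) ⊎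
                              (Z at e i ≡ neg (dₗ (inject₁ l) at e i) × Z at suc f ≡ neg (dₗ (inject₁ l) at suc f))) (i≡lead (inject₁ l)) (S.compare l (Z₁f-zero l))
        ... | inj₁ p = inj₁ p
        ... | inj₂ (inj₁ (p , q)) = inj₂ (inj₁ (trans p (d-sign _) , trans q (d-f _)))
        ... | inj₂ (inj₂ (p , q)) = inj₂ (inj₂ (trans p (cong neg (d-sign _)) , trans q (cong neg (d-f _))))

      -- With `Z₁` on `p`, the nearness formula puts `Z` on the leading element, so the two points
      -- at infinity coincide up to sign.
      flat : ∀ l → Zf l ≡ 𝟎
      flat l = ≈±-zero (S.Z≈Z₁ l (*₀-zero (trans (S.near-p₁ l) (neg-zero (Z₁p-zero l))))) (Z₁f-zero l)
        where
        *₀-zero : ∀ {a x} → a *₀ x ≡ 𝟎 → x ≡ 𝟎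
        *₀-zero {a} {x} eq = decidable-stable (x ≟₀ 𝟎) λ nz → *₀-nonzero a nz eq

    all-level : ∀ l → Zf l ≡ 𝟎
    all-level l = decidable-stable (Zf l ≟₀ 𝟎) λ nz → nz (by-cases (drift (κ (inject₁ l)) ≟₀ 𝟎))
      where
      by-cases : Dec (drift (κ (inject₁ l)) ≡ 𝟎) → Zf l ≡ 𝟎
      by-cases (yes d₀) = Level.still (level l) d₀ (trans (drift-constant (suc l) (inject₁ l)) d₀)
      by-cases (no d≢0) = let c , eq = nonzero-± d≢0 in Drifting.flat c (λ l′ → trans (drift-constant l′ (inject₁ l)) eq) l

  -- V is infinitely close to a point w at infinity, and f does not vanish there.
  Infinite : SignVector (suc n) → Set
  Infinite V = Σ (New V) λ N → New.w N at suc g ≡ 𝟎 × New.w N at suc f ≢ 𝟎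

  classify : ∀ {V} → Cocircuit V → V ! suc g ≢ 𝟎 → Kind V ⊎ Infinite V
  classify {V} cV V-g with old? V
  ... | yes oV = inj₁ (old oV)
  ... | no new with new-vertex cV new
  ...   | N with New.w N at suc g ≟₀ 𝟎
  ...     | no w-g = inj₁ (generic N w-g (New.slope N g w-g))
  ...     | yes w-g with New.w N at suc f ≟₀ 𝟎
  ...       | no w-f = inj₂ (N , w-g , w-f)
  ...       | yes w-f with u , u-old , u-g ← New.finite-point N g w-g V-g = inj₁ (base N w-g w-f u u-old u-g)

  module _ {s t x y} (E : Edge s t x y) (N : New x) (w-g : New.w N at suc g ≡ 𝟎) (w-f : New.w N at suc f ≢ 𝟎) where
    open Edge E
    open New N hiding (Slope; module Slope; line)

    private
      off : y ! zero ≢ 𝟎 → Z at suc f ≡ neg (w at suc f)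
      off y-p = trans (cong (_! suc f) (≈±-agree Z≈-w (≢𝟎-resp (sym Zh) (neg-≢𝟎 wh)) (trans Zh (sym (!-neg (vec w) (suc h))))))
                      (!-neg (vec w) (suc f))
        where
        wˡ : Point (Common x y)
        wˡ = re w λ { {zero} (_ , yp) → contradiction yp y-p ; {suc h} (xh , _) → on w ((λ ()) , xh) }
        witness : ∃[ h ] y ! suc h ≡ 𝟎 × w at suc h ≢ 𝟎
        witness with distinguish cy (coc w) (λ eq → ≡±⇒≢𝟎 y-g (≈±-zero eq w-g))
        ... | zero , yp , _ = contradiction yp y-p
        ... | suc h , yh , wh = h , yh , wh
        h = proj₁ witness
        wh = proj₂ (proj₂ witness)
        Z≈-w : vec Z ≈± -ᵥ vec w
        Z≈-w = line Z (⊖ wˡ) (point x cx proj₁) (suc g) (Direction.infinite dir) (trans (!-neg (vec w) (suc g)) (neg-zero w-g)) (≡±⇒≢𝟎 x-g)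
        Zh : Z at suc h ≡ neg (w at suc h)
        Zh = trans (OnColine.forwardˡ line dir (proj₁ (proj₂ witness)) (≢𝟎-resp (sym (near wh)) wh)) (cong neg (near wh))

      module On (y-p : y ! zero ≡ 𝟎) where
        open OnP E V-p y-p

        wC : Point (K ∪₁ suc g)
        wC = ofˣ w ⊕ w-g

        -- `Z` and `±w` are close at infinity, and the sign is `-`: otherwise the nearness formulas
        -- for `Z` and for `x` would give `p` opposite signs at `w`, since `Z` and `x` are opposite
        -- at `e i`.
        later : (∀ j → j <ᶠ i → y ! e j ≡ 𝟎) → y ! e i ≡ 𝟎 → Z at suc f ≡ neg (w at suc f)
        later pre y-e = [ (λ eq → contradiction (w-p≡ eq) (≢neg w-p)) , (λ eq → eq) ]′ (same-or-opposite Zf w-f)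
          where
          Ze : Z at e i ≡ neg (x ! e i)
          Ze = Zˣ y-e (proj₂ first)
          Ze≢0 : Z at e i ≢ 𝟎
          Ze≢0 = ≢𝟎-resp (sym Ze) (neg-≢𝟎 (proj₂ first))
          zeros : ∀ j → j <ᶠ i → (K ∪₁ suc g) (e j)
          zeros j j<i = inj₁ ((λ ()) , proj₁ first j j<i , pre j j<i)
          Z-new : ¬ Old (vec Z)
          Z-new oZ = *₀-nonzero (lookup α i) Ze≢0 (trans (sym (old-lead (coc Z) oZ i (λ j j<i → on ZC (zeros j j<i)) Ze≢0)) Z-p)
          Zf : Z at suc f ≢ 𝟎
          Zf = Off.new-generic C-line p∉ ZC wC Z-new w-f
          *₀-neg : ∀ a z → a *₀ neg z ≡ neg (a *₀ z)
          *₀-neg a 𝟎 = refl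
          *₀-neg Sign.+ (± _) = refl
          *₀-neg Sign.- (± Sign.+) = refl
          *₀-neg Sign.- (± Sign.-) = refl
          w-p≡ : Z at suc f ≡ w at suc f → w at zero ≡ neg (w at zero)
          w-p≡ eq = sym (trans (sym (Off.Near.near-p C-line p∉ i zeros ZC Ze≢0 ZC wC Z-p w-e eq Zf))
            (trans (cong (lookup α i *₀_) Ze) (trans (*₀-neg (lookup α i) (x ! e i)) (trans (cong neg near-p) (neg² _)))))

        -- The leading element of `y` vanishes at `w`, so it normally forces `Z` near `±w`; the sign
        -- is read off at an element `b` where `y` vanishes and `x` agrees with `w`.
        module Earlier (N′ : New y) (κ : New.w N′ at suc g ≢ 𝟎 ⊎ New.w N′ at suc g ≡ 𝟎 × New.w N′ at suc f ≡ 𝟎)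
                       (pre : ∀ j → j <ᶠ New.i N′ → x ! e j ≡ 𝟎) (w-e′ : w at e (New.i N′) ≡ 𝟎) where
          private module N′ = New N′

          witness : ∃[ b ] y ! suc b ≡ 𝟎 × w at suc b ≢ 𝟎
          witness with any? (λ b → (y ! suc b ≟₀ 𝟎) ×-dec ¬? (w at suc b ≟₀ 𝟎))
          ... | yes p = p
          ... | no none = ⊥-elim ([ (λ nz → nz (≈±-zero (≈±-sym w≈w′) w-g)) , (λ (_ , z) → w-f (≈±-zero w≈w′ z)) ]′ κ)
            where
            wʸ : Point (Hyp y)
            wʸ = re w λ { {zero} (p , _) → contradiction refl p
                        ; {suc h} (_ , yh) → decidable-stable (w at suc h ≟₀ 𝟎) λ wh → none (h , yh , wh) }
            w≈w′ : vec w ≈± vec N′.w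
            w≈w′ = N′.line wʸ N′.w N′.me (e N′.i) w-e′ N′.w-e (proj₂ N′.first)

          b = proj₁ witness
          yb = proj₁ (proj₂ witness)
          wb = proj₂ (proj₂ witness)

          Zb : Z at suc b ≡ neg (w at suc b)
          Zb = trans (Zˣ yb (≢𝟎-resp (sym (near wb)) wb)) (cong neg (near wb))

          Zb≢0 : Z at suc b ≢ 𝟎
          Zb≢0 = ≢𝟎-resp (sym Zb) (neg-≢𝟎 wb)

          earlier : Z at suc f ≡ neg (w at suc f)
          earlier with Z at e N′.i ≟₀ 𝟎
          ... | no Ze = trans (Off.Near.near C-line p∉ N′.i (λ j j<i → inj₁ ((λ ()) , pre j j<i , proj₁ N′.first j j<i)) ZC Ze ZC (⊖ wC) Z-p
                  (trans (!-neg (vec w) _) (neg-zero w-e′)) (trans Zb (sym (!-neg (vec w) _))) Zb≢0 (λ p → w-f (neg-zero⁻ (trans (sym (!-neg (vec w) _)) p))))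
                  (!-neg (vec w) (suc f))
          -- Now `w′` lies on `g`: otherwise `Z` and `w` would be the same point of `K ∪₁ e N′.i`,
          -- although only `Z` is on `p`. Hence `w′` is on `f` too, and `b` and `f` are parallel at
          -- infinity.
          ... | yes Ze = OnColine.parallel⁻ C-line (ofʸ N′.w ⊕ w′-g) ZC wC (on N′.w ((λ ()) , yb)) w′-f Zb≢0 Zb
            where
            w′-g : N′.w at suc g ≡ 𝟎
            w′-g = decidable-stable (N′.w at suc g ≟₀ 𝟎) λ nz → w-p (≈±-zero′
              (K-line (e N′.i) y∈K (proj₂ N′.first) (Z∈K ⊕ Ze) (ofˣ w ⊕ w-e′) (ofʸ N′.w ⊕ N′.w-e) (suc g) (Direction.infinite dir) w-g nz) Z-p)
            w′-f : N′.w at suc f ≡ 𝟎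
            w′-f = [ (λ nz → contradiction w′-g nz) , proj₂ ]′ κ

        new-case : (N′ : New y) → New.w N′ at suc g ≢ 𝟎 ⊎ New.w N′ at suc g ≡ 𝟎 × New.w N′ at suc f ≡ 𝟎 → Z at suc f ≡ neg (w at suc f)
        new-case N′ κ with <ᶠ-cmp i (New.i N′)
        ... | tri< i<i′ _ _ = later (λ j j<i → proj₁ (New.first N′) j (<-trans j<i i<i′)) (proj₁ (New.first N′) i i<i′)
        ... | tri≈ _ i≡i′ _ = Earlier.earlier N′ κ (λ j j<i′ → proj₁ first j (subst (j <ᶠ_) (sym i≡i′) j<i′))
                                (subst (λ i → w at e i ≡ 𝟎) i≡i′ w-e)
        ... | tri> _ _ i′<i = Earlier.earlier N′ κ (λ j j<i′ → proj₁ first j (<-trans j<i′ i′<i)) (on w ((λ ()) , proj₁ first _ i′<i))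

    -- Seen from a vertex with a kind, `x` lies infinitely far away in the direction `w`; leaving it
    -- means moving along `-w`, and `f` has the same sign at `w` and `x`.
    from-infinity : Kind y → Z at suc f ≡ neg (x ! suc f)
    from-infinity κ = trans (go κ (y ! zero ≟₀ 𝟎)) (cong neg (sym (near w-f)))
      where
      go : Kind y → Dec (y ! zero ≡ 𝟎) → Z at suc f ≡ neg (w at suc f)
      go (old oy) (no yp) = off yp
      go (old oy) (yes yp) = On.later yp (λ j _ → old-on-p cy oy yp j) (old-on-p cy oy yp i)
      go (generic N′ w′-g _) _ = On.new-case (New.V-p N′) N′ (inj₁ w′-g)
      go (base N′ w′-g w′-f _ _ _) _ = On.new-case (New.V-p N′) N′ (inj₂ (w′-g , w′-f))

-- Interchange of `g` and `f`, and the conclusion for all programs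

all-or-some : ∀ {m} {A B : Fin m → Set} → (∀ l → A l ⊎ B l) → (∀ l → A l) ⊎ ∃ B
all-or-some {ℕ.zero} _ = inj₁ λ ()
all-or-some {suc m} {A} {B} choice with choice zero | all-or-some {m} {A ∘′ suc} {B ∘′ suc} (λ l → choice (suc l))
... | inj₂ b | _ = inj₂ (zero , b)
... | _ | inj₂ (l , b) = inj₂ (suc l , b)
... | inj₁ a | inj₁ as = inj₁ λ { zero → a ; (suc l) → as l }

module _ {A : Set} {B : A → Set} {m : ℕ} (P : Fin (suc m) → A) (closed : P (fromℕ m) ≡ P zero) (κ : ∀ l → B (P l)) where

  -- κ may differ at the two ends of the sequence; κ zero is used at both.
  decorate : Σ (Fin (suc m) → Σ A B) λ Q → Q (fromℕ m) ≡ Q zero × (∀ l → proj₁ (Q l) ≡ P l)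
  decorate = Q , trans Q-last (sym Q-zero) , Q-P
    where
    choose : ∀ l → Dec (l ≡ fromℕ m) → Σ A B
    choose l (yes _) = P zero , κ zero
    choose l (no _)  = P l , κ l
    Q : Fin (suc m) → Σ A B
    Q l = choose l (l ≟ᶠ fromℕ m)
    Q-last : Q (fromℕ m) ≡ (P zero , κ zero)
    Q-last with fromℕ m ≟ᶠ fromℕ m
    ... | yes _ = refl
    ... | no neq = contradiction refl neq
    Q-zero : Q zero ≡ (P zero , κ zero)
    Q-zero with zero ≟ᶠ fromℕ m
    ... | yes _ = refl
    ... | no _  = refl
    Q-P : ∀ l → proj₁ (Q l) ≡ P l
    Q-P l with l ≟ᶠ fromℕ m
    ... | yes eq = sym (trans (cong P eq) closed)
    ... | no _   = refl

module Theorem {n k : ℕ} (O : OrientedMatroid n) (I : Vec (Fin n) k) (α : Vec Sign k)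
               (O′ : OrientedMatroid (suc n)) (ext : IsLexExtension O I α O′)
               (euclidean : OrientedMatroid.Euclidean O) where
  open Extension O I α O′ ext
  open Boundary O I α O′ ext euclidean
  open Interior O I α O′ ext euclidean
  open Points O′
  open Rank O′ using (Common)

  module _ (g f : Fin n) where
    private
      module Gf = Edges O I α O′ ext euclidean g f
      module Fg = Edges O I α O′ ext euclidean f g

    -- The roles of g and f are interchanged, so that points at infinity become points on f = 0.
    module Swap {c x y} (E : Gf.Edge Sign.+ Sign.+ x y) (x-f : x ! suc f ≡ ± c) (y-f : y ! suc f ≡ ± c) where
      open Gf.Edge E

      found = directed {g = suc f} (point x cx proj₁) (point y cy proj₂) (Direction.distinct dir) (trans x-f (sym y-f)) (≡±⇒≢𝟎 x-f)

      Z′ : Point (Common x y)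
      Z′ = proj₁ found

      dir′ : Direction (suc f) (point x cx proj₁) (point y cy proj₂) Z′
      dir′ = proj₂ found

      Z′-g : Nonneg (opposite c) (Z′ at suc g)
      Z′-g with Z at suc f ≟₀ 𝟎
      ... | yes Zf = inj₁ (≈±-zero (≈±-sym (OnColine.direction-unique line dir′ Z Zf)) (Direction.infinite dir))
      ... | no Zf with a , xa , ya ← distinguish cx cy (Direction.X≉Y dir)
        with Za ← trans (OnColine.forwardʳ line dir xa ya) (sym (OnColine.forwardʳ line dir′ xa ya))
           | Z′a ← ≢𝟎-resp (sym (OnColine.forwardʳ line dir′ xa ya)) ya
        -- This recovers `±x` between `-Z′` and `Z`: its sign at `f` comes from `Z` and its sign at
        -- `g` from `-Z′`. Comparison with the known signs of `x` determines `Z′` at `g`.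
        with W , Wa , b ← eliminate⁻ Z′ Z (λ eq → Zf (trans (cong (_! suc f) (sym eq)) (Direction.infinite dir′))) (sym Za) Z′a
        with W≈x ← line W (point x cx proj₁) (point y cy proj₂) a Wa xa ya
        = result W≈x
        where
        Wg : W at suc g ≡ neg (Z′ at suc g)
        Wg = trans (betweenˡ b (Direction.infinite dir) (λ p → ≡±⇒≢𝟎 x-g (≈±-zero′ W≈x p))) (!-neg (vec Z′) (suc g))
        Wf : W at suc f ≡ Z at suc f
        Wf = betweenʳ b (trans (!-neg (vec Z′) (suc f)) (neg-zero (Direction.infinite dir′))) (λ p → ≡±⇒≢𝟎 x-f (≈±-zero′ W≈x p))
        signs : ∀ c {z z′} → Nonneg Sign.+ z → (z ≡ ± c × neg z′ ≡ ± Sign.+) ⊎ (z ≡ neg (± c) × neg z′ ≡ ± Sign.-) → Nonneg (opposite c) z′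
        signs Sign.+ _ (inj₁ (_ , q)) = inj₂ (neg-≡ q)
        signs Sign.- _ (inj₂ (_ , q)) = inj₂ (neg-≡ q)
        signs Sign.+ (inj₁ ()) (inj₂ (refl , _))
        signs Sign.+ (inj₂ ()) (inj₂ (refl , _))
        signs Sign.- (inj₁ ()) (inj₁ (refl , _))
        signs Sign.- (inj₂ ()) (inj₁ (refl , _))
        result : vec W ≈± x → Nonneg (opposite c) (Z′ at suc g)
        result (inj₁ eq) = signs c Z-f (inj₁ (trans (sym Wf) (trans (cong (_! suc f) eq) x-f) , trans (sym Wg) (trans (cong (_! suc g) eq) x-g)))
        result (inj₂ eq) = signs c Z-f (inj₂ (trans (sym Wf) (trans (cong (_! suc f) eq) (trans (!-neg x (suc f)) (cong neg x-f)))
                                            , trans (sym Wg) (trans (cong (_! suc g) eq) (trans (!-neg x (suc g)) (cong neg x-g)))))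

      swapped : Fg.Edge c (opposite c) x y
      swapped = record { line = line ; cx = cx ; cy = cy ; Z = Z′ ; dir = dir′ ; Z-f = Z′-g ; conf = conf ; x-g = x-f }

      level-back : Z′ at suc g ≡ 𝟎 → Z at suc f ≡ 𝟎
      level-back Z′g = ≈±-zero (line Z Z′ (point x cx proj₁) (suc g) (Direction.infinite dir) Z′g (≡±⇒≢𝟎 x-g)) (Direction.infinite dir′)

  module _ (g f : Fin n) where
    open Edges O I α O′ ext euclidean g f

    transport : ∀ {s t x y x′ y′} → x′ ≡ x → y′ ≡ y → (E : Edge s t x y) → Σ (Edge s t x′ y′) λ E′ → vec (Edge.Z E′) ≡ vec (Edge.Z E)
    transport refl refl E = E , refl

    closed-level : ∀ {s t m} (P : Fin (suc m) → SignVector (suc n)) → P (fromℕ m) ≡ P zero → (∀ l → Kind (P l)) →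
                   (E : ∀ l → Edge s t (P (inject₁ l)) (P (suc l))) → ∀ l → Edge.Z (E l) at suc f ≡ 𝟎
    closed-level P closed κ E l with Q , Q-closed , Q-P ← decorate P closed κ =
      trans (cong (_! suc f) (sym (proj₂ (E′ l)))) (Closed.all-level Q Q-closed (λ l → proj₁ (E′ l)) l)
      where
      E′ : ∀ l → Σ (Edge _ _ (proj₁ (Q (inject₁ l))) (proj₁ (Q (suc l)))) λ E″ → vec (Edge.Z E″) ≡ vec (Edge.Z (E l))
      E′ l = transport (Q-P (inject₁ l)) (Q-P (suc l)) (E l)

  interior : ∀ {g f} → ¬ Graph.DirectedCycle (suc g) (suc f)
  interior {g} {f} cycle = not-level (by-kind (all-or-some λ l → classify (cocircuit l) (≡±⇒≢𝟎 (on-g l))))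
    where
    open Cycle O′ cycle
    open Edges O I α O′ ext euclidean g f using (Edge; Kind; flip; Infinite; classify; from-infinity)
    module Fg = Edges O I α O′ ext euclidean f g

    E : ∀ l → Edge Sign.+ Sign.+ (from l) (to l)
    E l = record { line = line l ; cx = cocircuit _ ; cy = cocircuit _ ; Z = Z l ; dir = dir l ; Z-f = Z-f l ; conf = conformal l ; x-g = on-g _ }

    value : ∃[ c ] P zero ! suc f ≡ ± c
    value = nonzero-± (f-nonzero zero)

    c : Sign
    c = proj₁ value

    P-f : ∀ l → P l ! suc f ≡ ± c
    P-f l = trans (f-constant l zero) (proj₂ value)

    classify-P : ∀ l → Kind (P l) ⊎ Infinite (P l)
    classify-P l = classify (cocircuit l) (≡±⇒≢𝟎 (on-g l))

    -- Leaving infinity along an edge would give `Z` the sign opposite to `f` on the cycle, here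
    -- `-`. For `f` negative the same argument applies to the reversed edge.
    infinite-forward : P zero ! suc f ≡ ± Sign.+ → ∀ l → Infinite (from l) → Infinite (to l)
    infinite-forward pos l (N , w-g , w-f) with classify-P (suc l)
    ... | inj₂ inf = inf
    ... | inj₁ κ = contradiction (trans (from-infinity (E l) N w-g w-f κ) (cong neg (trans (f-constant (inject₁ l) zero) pos))) (nonneg-≢ (Z-f l))

    infinite-backward : P zero ! suc f ≡ ± Sign.- → ∀ l → Infinite (to l) → Infinite (from l)
    infinite-backward pos l (N , w-g , w-f) with classify-P (inject₁ l)
    ... | inj₂ inf = inf
    ... | inj₁ κ = contradiction (trans (sym (neg² _)) (cong neg (trans (sym (!-neg (vec (Z l)) (suc f)))
                     (trans (from-infinity (flip (E l)) N w-g w-f κ) (cong neg (trans (f-constant (suc l) zero) pos)))))) (nonneg-≢ (Z-f l))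

    infinite-everywhere : ∀ {l} → Infinite (P l) → ∀ l′ → Infinite (P l′)
    infinite-everywhere {l} inf l′ with proj₁ value | proj₂ value
    ... | Sign.+ | pos = cyclic (λ V W → Infinite V → Infinite W) (λ p → p) (λ p q → q ∘′ p) P closed (infinite-forward pos) l l′ inf
    ... | Sign.- | pos = cyclic (λ V W → Infinite W → Infinite V) (λ p → p) (λ p q → p ∘′ q) P closed (infinite-backward pos) l′ l inf

    by-kind : (∀ l → Kind (P l)) ⊎ ∃ (λ l → Infinite (P l)) → ∀ l → Z l at suc f ≡ 𝟎
    by-kind (inj₁ κ) = closed-level g f P closed κ E
    by-kind (inj₂ (_ , inf)) l = Swap.level-back g f (E l) (P-f _) (P-f _)
      (closed-level f g P closed (λ l → κ (infinite-everywhere inf l)) (λ l → Swap.swapped g f (E l) (P-f _) (P-f _)) l)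
      where
      -- Since `w` is off `f`, these vertices are all generic once `f` plays the role of `g`.
      κ : ∀ {V} → Infinite V → Fg.Kind V
      κ (N , _ , w-f) = Fg.generic N w-f (New.slope N f w-f)

  extension-euclidean : Euclidean
  extension-euclidean zero    zero    prog = contradiction refl (IsProgram.g≢f prog)
  extension-euclidean zero    (suc f) _    = g-is-p
  extension-euclidean (suc g) zero    _    = f-is-p
  extension-euclidean (suc g) (suc f) _    = interior

open OrientedMatroid using (Euclidean)

theorem1p2 : ∀ {n k : ℕ} (O : OrientedMatroid n) → Euclidean O →
    (I : Vec (Fin n) k) → Unique I → (α : Vec Sign k) →
    (O′ : OrientedMatroid (suc n)) → IsLexExtension O I α O′ →
    Euclidean O′
theorem1p2 O euclidean I _ α O′ ext = Theorem.extension-euclidean O I α O′ ext euclidean
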